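{- Let $q=p^n$ be a prime power with $q\equiv 5\pmod 8$, let $\chi$ be a generator of the cyclic group $\widehat{\mathbb{F}_q^{\times}}$ of multiplicative characters of $\mathbb{F}_q$, and let $1\le r\le q-2$ be an integer. Let $a_1,\dots,a_{(q-1)/4}$ be the distinct elements of $D_4=\{x^4:x\in\mathbb{F}_q^{\times}\}$ (in any fixed order) and let $$B_{q,4}(\chi^r):=\left[\chi^r(a_i+a_j)+\chi^r(a_i-a_j)\right]_{1\le i,j\le (q-1)/4}.$$ Then $$\det(B_{q,4}(\chi^r))=(-1)^r\left(\frac{q}{2}\right)^{\frac{q-1}{4}}\prod_{k=0}^{(q-5)/4}\ {}_{2}F_{1}\left(\begin{array}{cc}\chi^{ -r} & \chi^{4k}\\ & \chi^{4k+r}\end{array}\Bigg|\,-1\right)_q.$$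
   Context: Every multiplicative character $\psi$ of $\mathbb{F}_q$ is extended to $\mathbb{F}_q$ by $\psi(0)=0$ (including the trivial character). For characters $A,B$, the Jacobi sum is $J_q(A,B)=\sum_{x\in\mathbb{F}_q}A(x)B(1-x)$, and Greene's binomial coefficient is $\binom{A}{B}:=\frac{B(-1)}{q}J_q(A,\bar B)$, where $\bar B=B^{ -1}$. For characters $A_0,A_1,B_1$ and $x\in\mathbb{F}_q$, Greene's Gaussian hypergeometric function is $${}_{2}F_{1}\left(\begin{array}{cc}A_0 & A_1\\ & B_1\end{array}\Bigg|\,x\right)_q:=\frac{q}{q-1}\sum_{\psi\in\widehat{\mathbb{F}_q^{\times}}}\binom{A_0\psi}{\psi}\binom{A_1\psi}{B_1\psi}\psi(x).$$ -}

module Defs where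

open import Level using (Level; _⊔_; suc)
open import Data.Nat.Base as ℕ using (ℕ; _∸_)
open import Data.Integer.Base using (ℤ; +_; -[1+_])
open import Data.Fin.Base as Fin using (Fin; toℕ; punchIn)
open import Data.Fin.Properties as Finₚ using (any?)
open import Data.Product.Base using (∃; _×_; _,_; proj₁; proj₂)
open import Data.Sum.Base using (_⊎_; inj₁; inj₂)
open import Function.Base using (_∘_)
open import Function.Bundles using (Inverse)
open import Relation.Binary.Bundles using (Setoid)
open import Relation.Binary.Definitions using (Decidable)
open import Relation.Binary.PropositionalEquality as ≡ using (_≡_)
open import Relation.Nullary.Decidable using (Dec; yes; no; map′)
open import Relation.Nullary.Negation using (¬_; contradiction)
open import Algebra.Bundles using (RawSemiring; Semiring; CommutativeRing; Group; AbelianGroup)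
open import Algebra.Apartness.Bundles using (HeytingField; HeytingCommutativeRing)
import Algebra.Apartness.Properties.HeytingCommutativeRing as HeytingProperties
import Algebra.Definitions.RawMonoid as RawMonoidDefinitions
import Algebra.Definitions.RawSemiring as RawSemiringDefinitions
import Algebra.Properties.CommutativeSemigroup as CommutativeSemigroupProperties
import Relation.Binary.Reasoning.Setoid as SetoidReasoning
open import Algebra.Morphism.Structures using (module MonoidMorphisms)

private
  variable
    a ℓ c ℓ₁ ℓ₂ c′ ℓ₁′ ℓ₂′ : Level

record Finite (S : Setoid a ℓ) : Set (a ⊔ ℓ) where
  field
    size        : ℕ
    enumeration : Inverse (≡.setoid (Fin size)) S

  open Inverse enumeration public using (to; from)

  _≟_ : Decidable (Setoid._≈_ S)
  x ≟ y = map′ (λ eq → trans (sym (strictlyInverseˡ x)) (trans (to-cong eq) (strictlyInverseˡ y)))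
               from-cong
               (from x Finₚ.≟ from y)
    where
    open Setoid S using (sym; trans)
    open Inverse enumeration using (to-cong; from-cong; strictlyInverseˡ)

module Determinant (R : CommutativeRing c ℓ) where
  open CommutativeRing R
  open RawSemiringDefinitions (Semiring.rawSemiring semiring) using (sum; _^_)

  -- Laplace expansion along the first row.
  det : ∀ {n} → (Fin n → Fin n → Carrier) → Carrier
  det {ℕ.zero}  M = 1#
  det {ℕ.suc n} M =
    sum λ j → (- 1#) ^ toℕ j * (M Fin.zero j * det λ i k → M (Fin.suc i) (punchIn j k))

module IntegerPower (G : Group c ℓ) where
  open Group G
  open RawMonoidDefinitions rawMonoid using () renaming (_×_ to _times_)

  infixr 8 _^ᶻ_

  _^ᶻ_ : Carrier → ℤ → Carrier
  x ^ᶻ (+ n)    = n times x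
  x ^ᶻ -[1+ n ] = (ℕ.suc n times x) ⁻¹

  Generates : Carrier → Set (c ⊔ ℓ)
  Generates g = ∀ x → ∃ λ k → x ≈ g ^ᶻ k

-- In a Heyting field x # 0# says that x is invertible. When equality is
-- decidable, as in FiniteField, or classically, it amounts to ¬ (x ≈ 0#).
module FieldOps (F : HeytingField c ℓ₁ ℓ₂) where
  open HeytingField F using (heytingCommutativeRing)

  commutativeRing : CommutativeRing c ℓ₁
  commutativeRing = HeytingCommutativeRing.commutativeRing heytingCommutativeRing

  open Semiring (CommutativeRing.semiring commutativeRing) public using (rawSemiring)
  open RawSemiring rawSemiring public using (*-rawMonoid)
  open RawSemiringDefinitions rawSemiring public using (sum; product; _^_)
    renaming (_×_ to _times_)

record FiniteField c ℓ₁ ℓ₂ : Set (suc (c ⊔ ℓ₁ ⊔ ℓ₂)) where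
  field
    heytingField : HeytingField c ℓ₁ ℓ₂

  open HeytingField heytingField public
  open FieldOps heytingField public

  field
    finite : Finite setoid

  open Finite finite public using (_≟_; to; from) renaming (size to card)

  -- The inverse of a nonzero element; 0# is sent to 0#.
  inv : Carrier → Carrier
  inv x with any? (λ i → (x * to i) ≟ 1#)
  ... | yes (i , _) = to i
  ... | no _        = 0#

  1≉0 : ¬ (1# ≈ 0#)
  1≉0 eq = proj₂ (tight 1# 0#) eq (HeytingProperties.1#0 heytingCommutativeRing)

  inv-cases : ∀ x → (x * inv x ≈ 1#) ⊎ ((x ≈ 0#) × (inv x ≈ 0#))
  inv-cases x with any? (λ i → (x * to i) ≟ 1#)
  ... | yes (i , eq) = inj₁ eq
  ... | no ∄i        = inj₂ (proj₁ (tight x 0#) ¬x#0 , refl)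
    where
    ¬x#0 : ¬ (x # 0#)
    ¬x#0 x#0 with #⇒invertible x#0
    ... | y , _ , eq = ∄i (from y , (begin
      x * to (from y)  ≈⟨ *-congˡ (Inverse.strictlyInverseˡ (Finite.enumeration finite) y) ⟩
      x * y            ≈⟨ *-congʳ (HeytingProperties.x-0≈x heytingCommutativeRing x) ⟨
      (x - 0#) * y     ≈⟨ eq ⟩
      1#               ∎))
      where open SetoidReasoning setoid

  inv-nonzero : ∀ {x} → ¬ (x ≈ 0#) → x * inv x ≈ 1#
  inv-nonzero {x} x≉0 with inv-cases x
  ... | inj₁ eq        = eq
  ... | inj₂ (x≈0 , _) = contradiction x≈0 x≉0

  inv-zero : ∀ {x} → x ≈ 0# → inv x ≈ 0#
  inv-zero {x} x≈0 with inv-cases x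
  ... | inj₁ eq       = contradiction (trans (sym eq) (trans (*-congʳ x≈0) (zeroˡ _))) 1≉0
  ... | inj₂ (_ , eq) = eq

  inv-unique : ∀ {x y} → x * y ≈ 1# → inv x ≈ y
  inv-unique {x} {y} xy≈1 with inv-cases x
  ... | inj₂ (x≈0 , _) = contradiction (trans (sym xy≈1) (trans (*-congʳ x≈0) (zeroˡ y))) 1≉0
  ... | inj₁ eq = begin
    inv x            ≈⟨ *-identityʳ _ ⟨
    inv x * 1#       ≈⟨ *-congˡ xy≈1 ⟨
    inv x * (x * y)  ≈⟨ *-assoc _ _ _ ⟨
    inv x * x * y    ≈⟨ *-congʳ (trans (*-comm _ _) eq) ⟩
    1# * y           ≈⟨ *-identityˡ y ⟩
    y                ∎
    where open SetoidReasoning setoid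

  inv-cong : ∀ {x y} → x ≈ y → inv x ≈ inv y
  inv-cong {x} {y} x≈y with inv-cases y
  ... | inj₁ eq           = inv-unique (trans (*-congʳ x≈y) eq)
  ... | inj₂ (y≈0 , eq)   = trans (inv-zero (trans x≈y y≈0)) (sym eq)

  inv-* : ∀ x y → inv (x * y) ≈ inv x * inv y
  inv-* x y with inv-cases x | inv-cases y
  ... | inj₂ (x≈0 , ix≈0) | _ =
    trans (inv-zero (trans (*-congʳ x≈0) (zeroˡ y))) (sym (trans (*-congʳ ix≈0) (zeroˡ _)))
  ... | inj₁ _ | inj₂ (y≈0 , iy≈0) =
    trans (inv-zero (trans (*-congˡ y≈0) (zeroʳ x))) (sym (trans (*-congˡ iy≈0) (zeroʳ _)))
  ... | inj₁ ex | inj₁ ey = inv-unique (begin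
    x * y * (inv x * inv y)    ≈⟨ interchange x y (inv x) (inv y) ⟩
    x * inv x * (y * inv y)    ≈⟨ *-cong ex ey ⟩
    1# * 1#                    ≈⟨ *-identityˡ 1# ⟩
    1#                         ∎)
    where
    open SetoidReasoning setoid
    open CommutativeSemigroupProperties (CommutativeRing.*-commutativeSemigroup commutativeRing)
      using (interchange)

  *-nonzero : ∀ {x y} → ¬ (x ≈ 0#) → ¬ (y ≈ 0#) → ¬ (x * y ≈ 0#)
  *-nonzero {x} {y} x≉0 y≉0 xy≈0 = y≉0 (begin
    y                ≈⟨ *-identityˡ y ⟨
    1# * y           ≈⟨ *-congʳ (trans (*-comm _ _) (inv-nonzero x≉0)) ⟨
    inv x * x * y    ≈⟨ *-assoc _ _ _ ⟩
    inv x * (x * y)  ≈⟨ *-congˡ xy≈0 ⟩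
    inv x * 0#       ≈⟨ zeroʳ _ ⟩
    0#               ∎)
    where open SetoidReasoning setoid

-- Stands in for ℂ as the field of character values: since there are no complex
-- numbers in the standard library, results are stated for every field of
-- characteristic zero containing a primitive (q - 1)-th root of unity, which
-- makes its group of characters of F cyclic of order q - 1.
record CharZeroField c ℓ₁ ℓ₂ : Set (suc (c ⊔ ℓ₁ ⊔ ℓ₂)) where
  field
    heytingField : HeytingField c ℓ₁ ℓ₂

  open HeytingField heytingField public
  open FieldOps heytingField public

  fromℕ : ℕ → Carrier
  fromℕ n = n times 1#

  field
    charZero : ∀ n → fromℕ (ℕ.suc n) # 0#

  -- 1/ n is the inverse of fromℕ n; the value at n = 0 is arbitrary.
  infix 9 1/_
  1/_ : ℕ → Carrier
  1/ ℕ.zero  = 0#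
  1/ ℕ.suc n = proj₁ (#⇒invertible (charZero n))

  IsPrimitiveRoot : ℕ → Carrier → Set (ℓ₁ ⊔ ℓ₂)
  IsPrimitiveRoot n ζ = (ζ ^ n ≈ 1#) × (∀ k → 0 ℕ.< k → k ℕ.< n → ζ ^ k # 1#)

module Characters (F : FiniteField c ℓ₁ ℓ₂) (K : CharZeroField c′ ℓ₁′ ℓ₂′) where

  private
    module F = FiniteField F
    module K = CharZeroField K

  open MonoidMorphisms F.*-rawMonoid K.*-rawMonoid using (IsMonoidHomomorphism)

  -- A homomorphism from the nonzero elements of F to those of K, extended by
  -- zero: multiplicativity on all of F together with ⟦ 0# ⟧ ≈ 0# says the same,
  -- values at nonzero arguments being invertible as divisors of ⟦ 1# ⟧ ≈ 1#.
  record Character : Set (c ⊔ ℓ₁ ⊔ c′ ⊔ ℓ₁′) where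
    field
      ⟦_⟧                  : F.Carrier → K.Carrier
      isMonoidHomomorphism : IsMonoidHomomorphism ⟦_⟧
      zero-homo            : ⟦ F.0# ⟧ K.≈ K.0#

    open IsMonoidHomomorphism isMonoidHomomorphism public using (⟦⟧-cong; homo; ε-homo)

  open Character public using (⟦_⟧)

  mkCharacter : (f : F.Carrier → K.Carrier) →
                (∀ {x y} → x F.≈ y → f x K.≈ f y) →
                (∀ x y → f (x F.* y) K.≈ f x K.* f y) →
                f F.1# K.≈ K.1# → f F.0# K.≈ K.0# → Character
  mkCharacter f cong homo one zero = record
    { ⟦_⟧ = f
    ; isMonoidHomomorphism = record
      { isMagmaHomomorphism = record
        { isRelHomomorphism = record { cong = cong }
        ; homo = homo
        }
      ; ε-homo = one
      }
    ; zero-homo = zero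
    }

  trivialValue : ∀ {x} → Dec (x F.≈ F.0#) → K.Carrier
  trivialValue (yes _) = K.0#
  trivialValue (no _)  = K.1#

  trivial : Character
  trivial = mkCharacter (λ x → trivialValue (x F.≟ F.0#)) cong homo one zero′
    where
    cong : ∀ {x y} → x F.≈ y → trivialValue (x F.≟ F.0#) K.≈ trivialValue (y F.≟ F.0#)
    cong {x} {y} x≈y with x F.≟ F.0# | y F.≟ F.0#
    ... | yes _   | yes _   = K.refl
    ... | no _    | no _    = K.refl
    ... | yes x≈0 | no y≉0  = contradiction (F.trans (F.sym x≈y) x≈0) y≉0
    ... | no x≉0  | yes y≈0 = contradiction (F.trans x≈y y≈0) x≉0

    homo : ∀ x y → trivialValue ((x F.* y) F.≟ F.0#) K.≈
                   trivialValue (x F.≟ F.0#) K.* trivialValue (y F.≟ F.0#)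
    homo x y with x F.≟ F.0# | y F.≟ F.0# | (x F.* y) F.≟ F.0#
    ... | yes _   | _       | yes _    = K.sym (K.zeroˡ _)
    ... | yes x≈0 | _       | no xy≉0  = contradiction (F.trans (F.*-congʳ x≈0) (F.zeroˡ y)) xy≉0
    ... | no _    | yes _   | yes _    = K.sym (K.zeroʳ _)
    ... | no _    | yes y≈0 | no xy≉0  = contradiction (F.trans (F.*-congˡ y≈0) (F.zeroʳ x)) xy≉0
    ... | no x≉0  | no y≉0  | yes xy≈0 = contradiction xy≈0 (F.*-nonzero x≉0 y≉0)
    ... | no _    | no _    | no _     = K.sym (K.*-identityˡ _)

    one : trivialValue (F.1# F.≟ F.0#) K.≈ K.1#
    one with F.1# F.≟ F.0#
    ... | yes 1≈0 = contradiction 1≈0 F.1≉0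
    ... | no _    = K.refl

    zero′ : trivialValue (F.0# F.≟ F.0#) K.≈ K.0#
    zero′ with F.0# F.≟ F.0#
    ... | yes _  = K.refl
    ... | no 0≉0 = contradiction F.refl 0≉0

  infixl 7 _·_
  _·_ : Character → Character → Character
  A · B = mkCharacter (λ x → ⟦ A ⟧ x K.* ⟦ B ⟧ x)
    (λ x≈y → K.*-cong (A.⟦⟧-cong x≈y) (B.⟦⟧-cong x≈y))
    (λ x y → K.trans (K.*-cong (A.homo x y) (B.homo x y)) (interchange _ _ _ _))
    (K.trans (K.*-cong A.ε-homo B.ε-homo) (K.*-identityˡ _))
    (K.trans (K.*-congʳ A.zero-homo) (K.zeroˡ _))
    where
    module A = Character A
    module B = Character B
    open CommutativeSemigroupProperties (CommutativeRing.*-commutativeSemigroup K.commutativeRing)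
      using (interchange)

  infix 10 _⁻
  _⁻ : Character → Character
  A ⁻ = mkCharacter (λ x → ⟦ A ⟧ (F.inv x))
    (λ x≈y → A.⟦⟧-cong (F.inv-cong x≈y))
    (λ x y → K.trans (A.⟦⟧-cong (F.inv-* x y)) (A.homo _ _))
    (K.trans (A.⟦⟧-cong (F.inv-unique (F.*-identityˡ _))) A.ε-homo)
    (K.trans (A.⟦⟧-cong (F.inv-zero F.refl)) A.zero-homo)
    where module A = Character A

  characterGroup : AbelianGroup _ _
  characterGroup = record
    { Carrier = Character
    ; _≈_ = λ A B → ∀ x → ⟦ A ⟧ x K.≈ ⟦ B ⟧ x
    ; _∙_ = _·_
    ; ε   = trivial
    ; _⁻¹ = _⁻
    ; isAbelianGroup = record
      { isGroup = record
        { isMonoid = record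
          { isSemigroup = record
            { isMagma = record
              { isEquivalence = record
                { refl  = λ x → K.refl
                ; sym   = λ p x → K.sym (p x)
                ; trans = λ p q x → K.trans (p x) (q x)
                }
              ; ∙-cong = λ p q x → K.*-cong (p x) (q x)
              }
            ; assoc = λ A B C x → K.*-assoc _ _ _
            }
          ; identity = identityˡ , λ A x → K.trans (K.*-comm _ _) (identityˡ A x)
          }
        ; inverse = inverseˡ , λ A x → K.trans (K.*-comm _ _) (inverseˡ A x)
        ; ⁻¹-cong = λ p x → p (F.inv x)
        }
      ; comm = λ A B x → K.*-comm _ _
      }
    }
    where
    identityˡ : ∀ A x → ⟦ trivial ⟧ x K.* ⟦ A ⟧ x K.≈ ⟦ A ⟧ x
    identityˡ A x with x F.≟ F.0#
    ... | no _    = K.*-identityˡ _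
    ... | yes x≈0 = K.trans (K.zeroˡ _)
                      (K.sym (K.trans (Character.⟦⟧-cong A x≈0) (Character.zero-homo A)))

    inverseˡ : ∀ A x → ⟦ A ⁻ ⟧ x K.* ⟦ A ⟧ x K.≈ ⟦ trivial ⟧ x
    inverseˡ A x with x F.≟ F.0#
    ... | no x≉0  = K.trans (K.sym (A.homo _ _))
                      (K.trans (A.⟦⟧-cong (F.trans (F.*-comm _ _) (F.inv-nonzero x≉0))) A.ε-homo)
      where module A = Character A
    ... | yes x≈0 = K.trans (K.*-congˡ (K.trans (A.⟦⟧-cong x≈0) A.zero-homo)) (K.zeroʳ _)
      where module A = Character A

  open AbelianGroup characterGroup public using () renaming (setoid to characterSetoid)
  open IntegerPower (AbelianGroup.group characterGroup) public

  sumOver : {S : Setoid a ℓ} → Finite S → (Setoid.Carrier S → K.Carrier) → K.Carrier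
  sumOver S f = K.sum (f ∘ Finite.to S)

  q : ℕ
  q = F.card

  -- Jacobi sums, and the binomial coefficients and hypergeometric function in
  -- Greene's normalisation.
  jacobi : Character → Character → K.Carrier
  jacobi A B = sumOver F.finite λ x → ⟦ A ⟧ x K.* ⟦ B ⟧ (F.1# F.- x)

  binomial : Character → Character → K.Carrier
  binomial A B = ⟦ B ⟧ (F.- F.1#) K.* K.1/ q K.* jacobi A (B ⁻)

  -- The argument of type Finite characterSetoid only supplies the range of
  -- summation; the value does not depend on the chosen enumeration.
  ₂F₁ : Finite characterSetoid → (A₀ A₁ B₁ : Character) → F.Carrier → K.Carrier
  ₂F₁ chars A₀ A₁ B₁ x =
    K.fromℕ q K.* K.1/ (q ∸ 1) K.*
    sumOver chars λ ψ → binomial (A₀ · ψ) ψ K.* binomial (A₁ · ψ) (B₁ · ψ) K.* ⟦ ψ ⟧ x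

  D₄ : F.Carrier → Set _
  D₄ y = ∃ λ x → (x F.# F.0#) × (y F.≈ x F.^ 4)

{-# OPTIONS --safe #-}

-- Let q - 1 = 4n with n odd, P = χ^r and D = D₄. As -1 is a square outside D, the squares are
-- D ∪ -D. The matrix B has the entries P(aᵢ) h(aⱼ/aᵢ) with h(t) = P(1 + t) + P(1 - t), so the
-- characters χ^{2k} of D, 0 ≤ k < n, diagonalise it up to the factors P(aᵢ), whose product is
-- P(1) = 1 because the order of D is odd. Hence det B is the product of the
-- Λₖ = ∑_{t ∈ D} h(t) χ^{2k}(t).
-- Substituting s = x/(1 - x) in both Jacobi sums and summing over ψ by orthogonality gives
-- q ₂F₁(χ^{-r}, χ^{4k}; χ^{4k+r} | -1) = P(-1) ∑_t P(1 - t²) χ^{4k}(t); by t ↦ √-1 t and then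
-- t ↦ t² this is 2 P(-1) Λₖ. Finally P(-1) = (-1)^r, and the n + 1 signs cancel.
-- Orthogonality and the identification of D rest on F having a primitive element.

module Submission where

open import Defs
open import Algebra.Apartness.Bundles using (HeytingField)
open import Algebra.Bundles using (AbelianGroup; CommutativeMonoid; CommutativeRing; Semiring)
open import Data.Fin.Base using (Fin; zero; suc; toℕ; fromℕ; fromℕ<; inject₁; punchIn; punchOut)
open import Data.Fin.Properties as Finₚ
  using (any?; pigeonhole; injective⇒≤; toℕ<n; toℕ-fromℕ; toℕ-fromℕ<; toℕ-inject₁; toℕ-injective;
         punchIn-injective; punchIn-punchOut; punchInᵢ≢i; punchOut-injective)
import Data.Integer.Base as ℤ
import Data.List.Base as List
import Data.List.Relation.Unary.All as All
open import Data.Nat.Base as ℕ using (ℕ; zero; suc; NonZero)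
open import Data.Nat.Coprimality as Coprimality using (Coprime; coprime-divisor)
open import Data.Nat.Divisibility
  using (_∣_; _∣?_; divides; 1∣_; m%n≡0⇒n∣m; m∣m*n; n∣m*n; ∣-trans; ∣1⇒≡1; ∣m+n∣m⇒∣n; ∣⇒≤;
         *-cancelˡ-∣; *-monoʳ-∣)
open import Data.Nat.DivMod using (_%_; m%n<n; m*n/n≡m; m≡m%n+[m/n]*n)
open import Data.Nat.Induction using (<-wellFounded)
import Data.Nat.ListAction as ListAction
open import Data.Nat.Primality
  using (Prime; euclidsLemma; prime⇒irreducible; prime⇒nonTrivial; prime⇒nonZero; ¬prime[1])
open import Data.Nat.Primality.Factorisation using (factorise)
import Data.Nat.Properties as ℕₚ
open import Data.Nat.Tactic.RingSolver using (solve-∀)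
open import Data.Product.Base using (∃; ∃₂; _×_; _,_; proj₁; proj₂)
open import Data.Sum.Base as Sum using (_⊎_; inj₁; inj₂)
open import Data.Vec.Functional using (_∷_; insertAt)
open import Function.Base using (_∘_; flip)
open import Function.Bundles using (Inverse; mk↔ₛ′)
open import Function.Definitions using (Injective)
open import Induction.WellFounded using (Acc; acc)
open import Level using (_⊔_)
open import Relation.Binary.Bundles using (Setoid)
open import Relation.Binary.Definitions using (tri<; tri≈; tri>)
open import Relation.Binary.PropositionalEquality as ≡ using (_≡_; _≢_)
open import Relation.Nullary.Decidable using (Dec; yes; no; ¬?; _×-dec_; decidable-stable)
open import Relation.Nullary.Negation using (¬_; contradiction)
import Algebra.Apartness.Properties.HeytingCommutativeRing as HeytingProperties
import Relation.Binary.Reasoning.Setoid as SetoidReasoning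

-- The exponents `2k` on D₄ and `4k` in the hypergeometric parameters belong together: t ↦ t² turns
-- χ^(4k)(t) into χ^(2k)(t²). That map is two-to-one on the units, whence the 2 in q/2. `K` has an
-- apartness but no decidable equality, so every cancellation needs an explicit inverse. For this
-- reason the matrix of character values on D₄ is shown to have an invertible determinant. It is
-- also where the root of unity `ζ` enters: the character taking the primitive element `g` to `ζ` is
-- a power of `χ`, so `ζ` is a power of `η`, the value of `χ` at `g`. Apartness from 1 then passes
-- from powers of `ζ` to powers of `η`, and every vanishing character sum is a geometric sum with an
-- invertible x - 1. Sums over units, over D₄ and over characters all become sums over exponents of
-- `g` or `χ`. Substitutions are then shifts of indices; multiplication by √-1 = g^n is the shift by
-- `n`.

-- Determinants by row expansion: alternating forms and multiplicativity.

module DeterminantProperties {c ℓ} (R : CommutativeRing c ℓ) where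
  open CommutativeRing R hiding (zero)
  open Determinant R public
  open import Algebra.Definitions.RawSemiring (Semiring.rawSemiring semiring) using (_^_)
  open import Algebra.Properties.Semiring.Sum semiring
  open import Algebra.Properties.CommutativeSemigroup *-commutativeSemigroup
    using (x∙yz≈y∙xz; interchange)
  open import Algebra.Properties.Ring ring using (-1*x≈-x)
  open import Relation.Binary.Reasoning.Setoid setoid

  private
    variable
      m n p : ℕ

  Row : ℕ → Set c
  Row n = Fin n → Carrier

  Matrix : ℕ → ℕ → Set c
  Matrix m n = Fin m → Row n

  infix 4 _≋_
  _≋_ : Row n → Row n → Set ℓ
  u ≋ v = ∀ j → u j ≈ v j

  minor : Matrix (suc n) (suc n) → Fin (suc n) → Matrix n n
  minor M j i k = M (suc i) (punchIn j k)

  sign : Fin n → Carrier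
  sign j = (- 1#) ^ toℕ j

  sum-zero : (f : Fin n → Carrier) → (∀ i → f i ≈ 0#) → sum f ≈ 0#
  sum-zero {n} f f≈0 = trans (sum-cong-≋ f≈0) (sum-replicate-zero n)

  det-cong : {M N : Matrix n n} → (∀ i → M i ≋ N i) → det M ≈ det N
  det-cong {zero}  eq = refl
  det-cong {suc n} eq = sum-cong-≋ {suc n} λ j →
    *-congˡ {sign j} (*-cong (eq zero j) (det-cong λ i k → eq (suc i) (punchIn j k)))

  -- Induction on the size. In the term `j = c` of the expansion the entry is combined and the
  -- minors agree, since they omit column `c`; in the other terms the entry is common and the minor
  -- is combined in column `punchOut j≢c`. The shape `x * _ + _` covers additivity and scaling at
  -- once.
  det-linear-column : ∀ c x {M N Q : Matrix n n} →
    (∀ j → j ≢ c → ∀ i → Q i j ≈ M i j × Q i j ≈ N i j) →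
    (∀ i → Q i c ≈ x * M i c + N i c) →
    det Q ≈ x * det M + det N
  det-linear-column {suc n} c x {M} {N} {Q} off on = begin
    det Q                                    ≈⟨ sum-cong-≋ summand ⟩
    sum (λ j → x * term M j + term N j)      ≈⟨ ∑-distrib-+ (λ j → x * term M j) (term N) ⟩
    sum (λ j → x * term M j) + sum (term N)  ≈⟨ +-congʳ (*-distribˡ-sum x (term M)) ⟨
    x * det M + det N                        ∎
    where
    term : Matrix (suc n) (suc n) → Fin (suc n) → Carrier
    term A j = sign j * (A zero j * det (minor A j))

    summand : ∀ j → term Q j ≈ x * term M j + term N j
    summand j with j Finₚ.≟ c
    ... | yes ≡.refl = begin
      s * (Q zero j * det (minor Q j))
        ≈⟨ *-congˡ (*-congʳ (on zero)) ⟩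
      s * ((x * M zero j + N zero j) * det (minor Q j))
        ≈⟨ *-congˡ (distribʳ _ _ _) ⟩
      s * (x * M zero j * det (minor Q j) + N zero j * det (minor Q j))
        ≈⟨ *-congˡ (+-cong (*-congˡ (det-cong λ i k → proj₁ (off _ (punchInᵢ≢i j k) _)))
                           (*-congˡ (det-cong λ i k → proj₂ (off _ (punchInᵢ≢i j k) _)))) ⟩
      s * (x * M zero j * det (minor M j) + N zero j * det (minor N j))
        ≈⟨ distribˡ _ _ _ ⟩
      s * (x * M zero j * det (minor M j)) + term N j
        ≈⟨ +-congʳ (trans (*-congˡ (*-assoc _ _ _)) (x∙yz≈y∙xz _ _ _)) ⟩
      x * term M j + term N j ∎
      where s = sign j
    ... | no j≢c = begin
      s * (Q zero j * det (minor Q j))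
        ≈⟨ *-congˡ (*-congˡ (det-linear-column (punchOut j≢c) x off′ on′)) ⟩
      s * (Q zero j * (x * det (minor M j) + det (minor N j)))
        ≈⟨ *-congˡ (trans (distribˡ _ _ _)
             (+-cong (*-congʳ (proj₁ (off j j≢c zero))) (*-congʳ (proj₂ (off j j≢c zero))))) ⟩
      s * (M zero j * (x * det (minor M j)) + N zero j * det (minor N j))
        ≈⟨ distribˡ _ _ _ ⟩
      s * (M zero j * (x * det (minor M j))) + term N j
        ≈⟨ +-congʳ (trans (*-congˡ (x∙yz≈y∙xz _ _ _)) (x∙yz≈y∙xz _ _ _)) ⟩
      x * term M j + term N j ∎
      where
      s = sign j
      at-c : punchIn j (punchOut j≢c) ≡ c
      at-c = punchIn-punchOut j≢c
      off′ : ∀ k → k ≢ punchOut j≢c → ∀ i →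
             minor Q j i k ≈ minor M j i k × minor Q j i k ≈ minor N j i k
      off′ k k≢ i = off (punchIn j k)
        (λ eq → k≢ (punchIn-injective j _ _ (≡.trans eq (≡.sym at-c)))) (suc i)
      on′ : ∀ i → minor Q j i (punchOut j≢c) ≈
                  x * minor M j i (punchOut j≢c) + minor N j i (punchOut j≢c)
      on′ i rewrite at-c = on (suc i)

  -- Deleting a column outside the pair `inject₁ c`, `suc c` leaves the pair adjacent in the minor.
  -- Its place there is `d`, which is what the induction in `det-adjacent-columns` needs.
  data Adjacency : Fin (suc n) → Fin n → Set where
    left  : {c : Fin n} → Adjacency (inject₁ c) c
    right : {c : Fin n} → Adjacency (suc c) c
    apart : {j : Fin (suc (suc n))} {c : Fin (suc n)} (d : Fin n) →
            punchIn j (inject₁ d) ≡ inject₁ c → punchIn j (suc d) ≡ suc c → Adjacency j c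

  adjacency : (j : Fin (suc n)) (c : Fin n) → Adjacency j c
  adjacency zero          zero    = left
  adjacency (suc zero)    zero    = right
  adjacency {suc (suc n)} (suc (suc j)) zero = apart zero ≡.refl ≡.refl
  adjacency zero          (suc c) = apart c ≡.refl ≡.refl
  adjacency (suc j)       (suc c) with adjacency j c
  ... | left         = left
  ... | right        = right
  ... | apart d p q  = apart (suc d) (≡.cong suc p) (≡.cong suc q)

  sum-adjacent : ∀ {n} (c : Fin n) (f : Fin (suc n) → Carrier) →
    (∀ j → j ≢ inject₁ c → j ≢ suc c → f j ≈ 0#) → sum f ≈ f (inject₁ c) + f (suc c)
  sum-adjacent zero f z = +-congˡ (trans
    (+-congˡ (sum-zero (λ j → f (suc (suc j))) λ j → z (suc (suc j)) (λ ()) (λ ()))) (+-identityʳ _))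
  sum-adjacent (suc c) f z = trans (+-cong (z zero (λ ()) (λ ())) (sum-adjacent c (f ∘ suc)
    λ j a b → z (suc j) (λ { ≡.refl → a ≡.refl }) (λ { ≡.refl → b ≡.refl }))) (+-identityˡ _)

  punchIn-adjacent : ∀ {n} (c k : Fin n) → punchIn (inject₁ c) k ≡ punchIn (suc c) k ⊎
    punchIn (inject₁ c) k ≡ suc c × punchIn (suc c) k ≡ inject₁ c
  punchIn-adjacent zero    zero    = inj₂ (≡.refl , ≡.refl)
  punchIn-adjacent zero    (suc k) = inj₁ ≡.refl
  punchIn-adjacent (suc c) zero    = inj₁ ≡.refl
  punchIn-adjacent (suc c) (suc k) with punchIn-adjacent c k
  ... | inj₁ eq      = inj₁ (≡.cong suc eq)
  ... | inj₂ (p , q) = inj₂ (≡.cong suc p , ≡.cong suc q)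

  sign-inject₁ : (c : Fin n) → sign (inject₁ c) ≡ sign c
  sign-inject₁ zero    = ≡.refl
  sign-inject₁ (suc c) = ≡.cong (- 1# *_) (sign-inject₁ c)

  -- Only the deletions of the two equal columns survive in the expansion, since any other minor
  -- still has an equal adjacent pair. The two survivors have the same entry and the same minor,
  -- with opposite signs.
  det-adjacent-columns : (c : Fin n) (M : Matrix (suc n) (suc n)) →
    (∀ i → M i (inject₁ c) ≈ M i (suc c)) → det M ≈ 0#
  det-adjacent-columns {n} c M eq = begin
    det M                                         ≈⟨ sum-adjacent c term vanish ⟩
    term (inject₁ c) + term (suc c)               ≈⟨ +-cong first second ⟩
    t + - t                                       ≈⟨ -‿inverseʳ _ ⟩
    0#                                            ∎
    where
    term : Fin (suc n) → Carrier
    term j = sign j * (M zero j * det (minor M j))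

    vanish : ∀ j → j ≢ inject₁ c → j ≢ suc c → term j ≈ 0#
    vanish j a b with adjacency j c
    ... | left  = contradiction ≡.refl a
    ... | right = contradiction ≡.refl b
    ... | apart d p q = trans (*-congˡ (trans (*-congˡ
      (det-adjacent-columns d (minor M j) λ i →
        trans (reflexive (≡.cong (M (suc i)) p))
          (trans (eq (suc i)) (reflexive (≡.cong (M (suc i)) (≡.sym q))))))
      (zeroʳ _))) (zeroʳ _)

    t = sign c * (M zero (suc c) * det (minor M (suc c)))

    same-minor : ∀ i → minor M (inject₁ c) i ≋ minor M (suc c) i
    same-minor i k with punchIn-adjacent c k
    ... | inj₁ e       = reflexive (≡.cong (M (suc i)) e)
    ... | inj₂ (p , q) = trans (reflexive (≡.cong (M (suc i)) p))
      (trans (sym (eq (suc i))) (reflexive (≡.cong (M (suc i)) (≡.sym q))))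

    first : term (inject₁ c) ≈ t
    first = *-cong (reflexive (sign-inject₁ c)) (*-cong (eq zero) (det-cong same-minor))

    second : term (suc c) ≈ - t
    second = trans (*-assoc _ _ _) (-1*x≈-x _)

  -- Only neighbouring rows are compared, which is what the columns of an expanded determinant
  -- provide directly; copies of the head further down follow in `repeated-head`. Matrices are
  -- rectangular because fixing the head removes a row without shortening the others.
  record IsAlternating {m n} (F : Matrix m n → Carrier) : Set (c ⊔ ℓ) where
    field
      cong     : ∀ {M N} → (∀ i → M i ≋ N i) → F M ≈ F N
      linear   : ∀ i x {M N Q} → (∀ k → k ≢ i → Q k ≋ M k × Q k ≋ N k) →
                 (∀ j → Q i j ≈ x * M i j + N i j) → F Q ≈ x * F M + F N
      adjacent : ∀ {i k M} → toℕ k ≡ suc (toℕ i) → M i ≋ M k → F M ≈ 0#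

  open IsAlternating

  ≋-∷ : {u v : Row n} {M N : Matrix m n} → u ≋ v → (∀ i → M i ≋ N i) →
        ∀ i → (u ∷ M) i ≋ (v ∷ N) i
  ≋-∷ p q zero    = p
  ≋-∷ p q (suc i) = q i

  ∷-eta : (M : Matrix (suc m) n) → ∀ i → M i ≋ (M zero ∷ (M ∘ suc)) i
  ∷-eta M zero    j = refl
  ∷-eta M (suc i) j = refl

  fix-head : {F : Matrix (suc m) n → Carrier} → IsAlternating F →
             ∀ u → IsAlternating (λ M → F (u ∷ M))
  fix-head {F = F} A u = record
    { cong     = λ eq → cong A (≋-∷ (λ _ → refl) eq)
    ; linear   = λ i x off on → linear A (suc i) x
        (λ { zero    _ → (λ _ → refl) , (λ _ → refl)
           ; (suc k) k≢i → off k (k≢i ∘ ≡.cong suc) }) on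
    ; adjacent = λ eq same → adjacent A (≡.cong suc eq) same
    }

  compose-linear : {F : Matrix m n → Carrier} → IsAlternating F → (T : Row p → Row n) →
    (∀ {u v} → u ≋ v → T u ≋ T v) →
    (∀ x {u v w} → (∀ j → w j ≈ x * u j + v j) → ∀ j → T w j ≈ x * T u j + T v j) →
    IsAlternating (λ M → F (T ∘ M))
  compose-linear A T T-cong T-linear = record
    { cong     = λ eq → cong A (T-cong ∘ eq)
    ; linear   = λ i x off on → linear A i x
        (λ k k≢i → T-cong (proj₁ (off k k≢i)) , T-cong (proj₂ (off k k≢i))) (T-linear x on)
    ; adjacent = λ eq same → adjacent A eq (T-cong same)
    }

  module _ {F : Matrix (suc m) n → Carrier} (A : IsAlternating F) where

    linear-head : ∀ x u v M → F ((λ j → x * u j + v j) ∷ M) ≈ x * F (u ∷ M) + F (v ∷ M)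
    linear-head x u v M = linear A zero x
      (λ { zero 0≢0 → contradiction ≡.refl 0≢0 ; (suc k) _ → (λ _ → refl) , (λ _ → refl) })
      (λ _ → refl)

    additive-head : ∀ u v M → F ((λ j → u j + v j) ∷ M) ≈ F (u ∷ M) + F (v ∷ M)
    additive-head u v M = begin
      F ((λ j → u j + v j) ∷ M)       ≈⟨ cong A (≋-∷ (λ j → +-congʳ (sym (*-identityˡ _))) λ _ _ →
        refl) ⟩
      F ((λ j → 1# * u j + v j) ∷ M)  ≈⟨ linear-head 1# u v M ⟩
      1# * F (u ∷ M) + F (v ∷ M)      ≈⟨ +-congʳ (*-identityˡ _) ⟩
      F (u ∷ M) + F (v ∷ M)           ∎

    -- Linearity comes only in the form `x * _ + _`, so the zero row is written with `x = - 1#`,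
    -- which makes the value `- z + z`.
    zero-head : ∀ M → F ((λ _ → 0#) ∷ M) ≈ 0#
    zero-head M = begin
      F ((λ _ → 0#) ∷ M)               ≈⟨ cong A (≋-∷ (λ _ → sym zero-row) λ _ _ → refl) ⟩
      F ((λ _ → - 1# * 0# + 0#) ∷ M)   ≈⟨ linear-head (- 1#) _ _ M ⟩
      - 1# * z + z                     ≈⟨ +-congʳ (-1*x≈-x z) ⟩
      - z + z                          ≈⟨ -‿inverseˡ z ⟩
      0#                               ∎
      where
      z = F ((λ _ → 0#) ∷ M)
      zero-row : - 1# * 0# + 0# ≈ 0#
      zero-row = trans (+-identityʳ _) (zeroʳ _)

    sum-head : ∀ {p} (x : Row p) (u : Matrix p n) M →
      F ((λ j → sum (λ k → x k * u k j)) ∷ M) ≈ sum (λ k → x k * F (u k ∷ M))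
    sum-head {zero}  x u M = zero-head M
    sum-head {suc p} x u M = trans (linear-head (x zero) (u zero) _ M)
      (+-congˡ (sum-head (x ∘ suc) (u ∘ suc) M))

  -- Polarisation: the vanishing value at the rows `u+v`, `u+v` is expanded.
  swap-rows : {F : Matrix (suc (suc m)) n → Carrier} → IsAlternating F →
    ∀ u v M → F (u ∷ v ∷ M) ≈ - F (v ∷ u ∷ M)
  swap-rows {F = F} A u v M = begin
    F (u ∷ v ∷ M)                                             ≈⟨ +-identityʳ _ ⟨
    F (u ∷ v ∷ M) + 0#                                        ≈⟨ +-congˡ (-‿inverseʳ _) ⟨
    F (u ∷ v ∷ M) + (F (v ∷ u ∷ M) + - F (v ∷ u ∷ M))         ≈⟨ +-assoc _ _ _ ⟨
    F (u ∷ v ∷ M) + F (v ∷ u ∷ M) + - F (v ∷ u ∷ M)           ≈⟨ +-congʳ vanishing ⟨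
    0# + - F (v ∷ u ∷ M)                                      ≈⟨ +-identityˡ _ ⟩
    - F (v ∷ u ∷ M)                                           ∎
    where
    u+v : Row _
    u+v j = u j + v j
    repeated : ∀ w → F (w ∷ w ∷ M) ≈ 0#
    repeated w = adjacent A {zero} {suc zero} ≡.refl (λ _ → refl)
    second : ∀ w → F (w ∷ u+v ∷ M) ≈ F (w ∷ u ∷ M) + F (w ∷ v ∷ M)
    second w = additive-head (fix-head A w) u v M
    vanishing : 0# ≈ F (u ∷ v ∷ M) + F (v ∷ u ∷ M)
    vanishing = begin
      0#                                          ≈⟨ repeated u+v ⟨
      F (u+v ∷ u+v ∷ M)                           ≈⟨ additive-head A u v _ ⟩
      F (u ∷ u+v ∷ M) + F (v ∷ u+v ∷ M)           ≈⟨ +-cong (second u) (second v) ⟩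
      F (u ∷ u ∷ M) + F (u ∷ v ∷ M) + (F (v ∷ u ∷ M) + F (v ∷ v ∷ M))
        ≈⟨ +-cong (trans (+-congʳ (repeated u)) (+-identityˡ _))
                  (trans (+-congˡ (repeated v)) (+-identityʳ _)) ⟩
      F (u ∷ v ∷ M) + F (v ∷ u ∷ M)               ∎

  -- Swapping `u` past the head of `M` brings it one place closer to its copy; the row passed
  -- becomes a fixed head.
  repeated-head : {F : Matrix (suc m) n → Carrier} → IsAlternating F →
    ∀ i {u M} → M i ≋ u → F (u ∷ M) ≈ 0#
  repeated-head A zero    eq = adjacent A {zero} {suc zero} ≡.refl (λ j → sym (eq j))
  repeated-head {F = F} A (suc i) {u} {M} eq = begin
    F (u ∷ M)                       ≈⟨ cong A (≋-∷ (λ _ → refl) (∷-eta M)) ⟩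
    F (u ∷ M zero ∷ (M ∘ suc))      ≈⟨ swap-rows A _ _ _ ⟩
    - F (M zero ∷ u ∷ (M ∘ suc))    ≈⟨ -‿cong (repeated-head (fix-head A (M zero)) i eq) ⟩
    - 0#                            ≈⟨ +-identityˡ _ ⟨
    0# + - 0#                       ≈⟨ -‿inverseʳ _ ⟩
    0#                              ∎

  -- In the application `u` is a head row that has already been fixed, and `kill` records that a
  -- second copy of it makes the form vanish. The rows are treated one at a time.
  shift-rows : {F : Matrix m n → Carrier} → IsAlternating F →
    ∀ u → (∀ i {M} → M i ≋ u → F M ≈ 0#) →
    ∀ (x : Row m) {M N} → (∀ i j → M i j ≈ x i * u j + N i j) → F M ≈ F N
  shift-rows {zero}  A u kill x eq = cong A λ ()
  shift-rows {suc m} {F = F} A u kill x {M} {N} eq = begin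
    F M                                       ≈⟨ cong A head-eq ⟩
    F ((λ j → x zero * u j + N zero j) ∷ (M ∘ suc))
      ≈⟨ linear-head A _ u (N zero) _ ⟩
    x zero * F (u ∷ (M ∘ suc)) + F (N zero ∷ (M ∘ suc))
      ≈⟨ +-cong (trans (*-congˡ (kill zero λ _ → refl)) (zeroʳ _))
                (shift-rows (fix-head A (N zero)) u (λ i e → kill (suc i) e) (x ∘ suc) (eq ∘ suc)) ⟩
    0# + F (N zero ∷ (N ∘ suc))               ≈⟨ +-identityˡ _ ⟩
    F (N zero ∷ (N ∘ suc))                    ≈⟨ cong A (∷-eta N) ⟨
    F N                                       ∎
    where
    head-eq : ∀ i → M i ≋ ((λ j → x zero * u j + N zero j) ∷ (M ∘ suc)) i
    head-eq zero    j = eq zero j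
    head-eq (suc i) j = refl

  -- Row `j` reaches the front after `j` swaps; this is the origin of the signs in the Laplace
  -- expansion.
  front-row : {F : Matrix (suc m) n → Carrier} → IsAlternating F →
    ∀ M j → F (M j ∷ (M ∘ punchIn j)) ≈ sign j * F M
  front-row A M zero = trans (sym (cong A (∷-eta M))) (sym (*-identityˡ _))
  front-row {suc m} {F = F} A M (suc j) = begin
    F (M (suc j) ∷ (M ∘ punchIn (suc j)))
      ≈⟨ cong A (≋-∷ (λ _ → refl) (∷-eta _)) ⟩
    F (M (suc j) ∷ M zero ∷ (M ∘ suc ∘ punchIn j))
      ≈⟨ swap-rows A _ _ _ ⟩
    - F (M zero ∷ M (suc j) ∷ (M ∘ suc ∘ punchIn j))
      ≈⟨ -‿cong (front-row (fix-head A (M zero)) (M ∘ suc) j) ⟩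
    - (sign j * F (M zero ∷ (M ∘ suc)))
      ≈⟨ -‿cong (*-congˡ (sym (cong A (∷-eta M)))) ⟩
    - (sign j * F M)
      ≈⟨ -1*x≈-x _ ⟨
    - 1# * (sign j * F M)
      ≈⟨ *-assoc _ _ _ ⟨
    sign (suc j) * F M ∎

  δ : Matrix n n
  δ zero    zero    = 1#
  δ zero    (suc j) = 0#
  δ (suc i) zero    = 0#
  δ (suc i) (suc j) = δ i j

  δ-sym : (i j : Fin n) → δ i j ≈ δ j i
  δ-sym zero    zero    = refl
  δ-sym zero    (suc j) = refl
  δ-sym (suc i) zero    = refl
  δ-sym (suc i) (suc j) = δ-sym i j

  δ-diagonal : (i : Fin n) → δ i i ≈ 1#
  δ-diagonal zero    = refl
  δ-diagonal (suc i) = δ-diagonal i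

  δ-off-diagonal : {i j : Fin n} → i ≢ j → δ i j ≈ 0#
  δ-off-diagonal {i = zero}  {zero}  i≢j = contradiction ≡.refl i≢j
  δ-off-diagonal {i = zero}  {suc j} i≢j = refl
  δ-off-diagonal {i = suc i} {zero}  i≢j = refl
  δ-off-diagonal {i = suc i} {suc j} i≢j = δ-off-diagonal (i≢j ∘ ≡.cong suc)

  sum-δ : (x : Row n) (j : Fin n) → sum (λ k → x k * δ k j) ≈ x j
  sum-δ x zero    = trans (+-cong (*-identityʳ _) (sum-zero _ λ k → zeroʳ (x (suc k)))) (+-identityʳ _)
  sum-δ x (suc j) = trans (+-cong (zeroʳ _) (sum-δ (x ∘ suc) j)) (+-identityˡ _)

  insertAt-δ : (j : Fin (suc n)) (i : Fin n) → insertAt (δ i) j 0# ≋ δ (punchIn j i)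
  insertAt-δ zero    i       zero    = refl
  insertAt-δ zero    i       (suc k) = refl
  insertAt-δ (suc j) zero    zero    = refl
  insertAt-δ (suc j) zero    (suc k) = insertAt-zero j k
    where
    insertAt-zero : ∀ {n} (j k : Fin (suc n)) → insertAt {n = n} (λ _ → 0#) j 0# k ≈ 0#
    insertAt-zero           zero    zero    = refl
    insertAt-zero           zero    (suc k) = refl
    insertAt-zero {suc n}   (suc j) zero    = refl
    insertAt-zero {suc n}   (suc j) (suc k) = insertAt-zero j k
  insertAt-δ (suc j) (suc i) zero    = refl
  insertAt-δ (suc j) (suc i) (suc k) = insertAt-δ j i k

  insertAt-cong : {u v : Row n} (j : Fin (suc n)) {x y : Carrier} → u ≋ v → x ≈ y →
                  insertAt u j x ≋ insertAt v j y
  insertAt-cong         zero    u≋v x≈y zero    = x≈y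
  insertAt-cong         zero    u≋v x≈y (suc k) = u≋v k
  insertAt-cong {suc n} (suc j) u≋v x≈y zero    = u≋v zero
  insertAt-cong {suc n} (suc j) u≋v x≈y (suc k) = insertAt-cong j (u≋v ∘ suc) x≈y k

  insertAt-linear : ∀ x {u v w : Row n} (j : Fin (suc n)) → (∀ k → w k ≈ x * u k + v k) →
    ∀ k → insertAt w j 0# k ≈ x * insertAt u j 0# k + insertAt v j 0# k
  insertAt-linear         x zero    eq zero    = sym (trans (+-identityʳ _) (zeroʳ x))
  insertAt-linear         x zero    eq (suc k) = eq k
  insertAt-linear {suc n} x (suc j) eq zero    = eq zero
  insertAt-linear {suc n} x (suc j) eq (suc k) = insertAt-linear x j (eq ∘ suc) k

  split-column : (u : Row (suc n)) (j : Fin (suc n)) →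
    ∀ k → u k ≈ u j * δ j k + insertAt (u ∘ punchIn j) j 0# k
  split-column         u zero    zero    = sym (trans (+-identityʳ _) (*-identityʳ _))
  split-column         u zero    (suc k) = sym (trans (+-congʳ (zeroʳ _)) (+-identityˡ _))
  split-column {suc n} u (suc j) zero    = sym (trans (+-congʳ (zeroʳ _)) (+-identityˡ _))
  split-column {suc n} u (suc j) (suc k) = split-column (u ∘ suc) j k

  -- The head row is resolved into unit vectors `δ j`. With `δ j` as head, column `j` can be cleared
  -- from the other rows, which leaves an alternating form in the minor. By induction it is known up
  -- to its value at the identity, where row `j` of `δ` sits in front and costs `sign j`. The sum is
  -- the Laplace expansion times `F δ`.
  alternating-unique : {F : Matrix n n → Carrier} → IsAlternating F → ∀ M → F M ≈ F δ * det M
  alternating-unique {zero}          A M = trans (cong A λ ()) (sym (*-identityʳ _))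
  alternating-unique {suc n} {F = F} A M = begin
    F M
      ≈⟨ cong A (∷-eta M) ⟩
    F (M zero ∷ (M ∘ suc))
      ≈⟨ cong A (≋-∷ (λ j → sym (sum-δ (M zero) j)) λ _ _ → refl) ⟩
    F ((λ k → sum (λ j → M zero j * δ j k)) ∷ (M ∘ suc))
      ≈⟨ sum-head A (M zero) δ _ ⟩
    sum (λ j → M zero j * F (δ j ∷ (M ∘ suc)))
      ≈⟨ sum-cong-≋ (λ j → trans (*-congˡ (cofactor j)) (rearrange j)) ⟩
    sum (λ j → F δ * (sign j * (M zero j * det (minor M j))))
      ≈⟨ *-distribˡ-sum (F δ) (λ j → sign j * (M zero j * det (minor M j))) ⟨
    F δ * det M ∎
    where
    G : Fin (suc n) → Matrix n n → Carrier
    G j N = F (δ j ∷ λ i → insertAt (N i) j 0#)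

    G-alternating : ∀ j → IsAlternating (G j)
    G-alternating j = compose-linear (fix-head A (δ j)) (λ u → insertAt u j 0#)
      (λ eq → insertAt-cong j eq refl) (λ x eq → insertAt-linear x j eq)

    cofactor : ∀ j → F (δ j ∷ (M ∘ suc)) ≈ sign j * F δ * det (minor M j)
    cofactor j = begin
      F (δ j ∷ (M ∘ suc))
        ≈⟨ shift-rows (fix-head A (δ j)) (δ j) (λ i eq → repeated-head A i eq)
             (λ i → M (suc i) j) (λ i → split-column (M (suc i)) j) ⟩
      G j (minor M j)
        ≈⟨ alternating-unique (G-alternating j) (minor M j) ⟩
      G j δ * det (minor M j)
        ≈⟨ *-congʳ (cong A (≋-∷ (λ _ → refl) (insertAt-δ j))) ⟩
      F (δ j ∷ (δ ∘ punchIn j)) * det (minor M j)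
        ≈⟨ *-congʳ (front-row A δ j) ⟩
      sign j * F δ * det (minor M j) ∎

    rearrange : ∀ j → M zero j * (sign j * F δ * det (minor M j)) ≈
                      F δ * (sign j * (M zero j * det (minor M j)))
    rearrange j = begin
      M zero j * (sign j * F δ * det (minor M j))  ≈⟨ *-congˡ (*-congʳ (*-comm _ _)) ⟩
      M zero j * (F δ * sign j * det (minor M j))  ≈⟨ *-congˡ (*-assoc _ _ _) ⟩
      M zero j * (F δ * (sign j * det (minor M j))) ≈⟨ x∙yz≈y∙xz _ _ _ ⟩
      F δ * (M zero j * (sign j * det (minor M j))) ≈⟨ *-congˡ (x∙yz≈y∙xz _ _ _) ⟩
      F δ * (sign j * (M zero j * det (minor M j))) ∎

  det-δ : ∀ n → det (δ {n}) ≈ 1#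
  det-δ zero    = refl
  det-δ (suc n) = begin
    1# * (1# * det (δ {n})) + sum {n} (λ j → sign (suc j) * (0# * det (minor (δ {suc n}) (suc j))))
      ≈⟨ +-cong (trans (*-identityˡ _) (trans (*-identityˡ _) (det-δ n)))
                (sum-zero {n} (λ j → sign (suc j) * (0# * det (minor (δ {suc n}) (suc j)))) λ j →
                  trans (*-congˡ (zeroˡ _)) (zeroʳ _)) ⟩
    1# + 0#
      ≈⟨ +-identityʳ _ ⟩
    1# ∎

  -- With the expansion along the first row, the columns are the easy side; row properties
  -- and multiplicativity come from the uniqueness of alternating forms.
  det-transpose-alternating : IsAlternating {n} (det ∘ flip)
  det-transpose-alternating = record
    { cong     = λ eq → det-cong (λ i j → eq j i)
    ; linear   = λ c x off on → det-linear-column c x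
        (λ j j≢c i → proj₁ (off j j≢c) i , proj₂ (off j j≢c) i) on
    ; adjacent = adjacent-columns
    }
    where
    adjacent-columns : ∀ {n} {i k : Fin n} {M : Matrix n n} →
                       toℕ k ≡ suc (toℕ i) → M i ≋ M k → det (flip M) ≈ 0#
    adjacent-columns {i = i} {suc k} {M} eq same =
      det-adjacent-columns k (flip M) λ j → trans (reflexive (≡.cong (λ l → M l j) k≡i)) (same j)
      where
      k≡i : inject₁ k ≡ i
      k≡i = toℕ-injective (≡.trans (toℕ-inject₁ k) (≡.cong ℕ.pred eq))

  det-transpose : (M : Matrix n n) → det (flip M) ≈ det M
  det-transpose {n} M = begin
    det (flip M)           ≈⟨ alternating-unique det-transpose-alternating M ⟩
    det (flip (δ {n})) * det M   ≈⟨ *-congʳ (det-cong {n} {flip δ} {δ} (λ i j → δ-sym j i)) ⟩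
    det (δ {n}) * det M    ≈⟨ *-congʳ (det-δ n) ⟩
    1# * det M             ≈⟨ *-identityˡ _ ⟩
    det M                  ∎

  infixl 7 _⊡_
  _⊡_ : Matrix m n → Matrix n p → Matrix m p
  (M ⊡ N) i k = sum λ j → M i j * N j k

  det-alternating : IsAlternating {n} det
  det-alternating = record
    { cong     = det-cong
    ; linear   = λ i x {M} {N} {Q} off on → trans (sym (det-transpose Q))
        (trans (linear T i x off on) (+-cong (*-congˡ (det-transpose M)) (det-transpose N)))
    ; adjacent = λ {_} {_} {M} eq same → trans (sym (det-transpose M)) (adjacent T eq same)
    }
    where T = det-transpose-alternating

  -- For fixed `N` the left side is an alternating form in the rows of `M`, with value `det N` at
  -- the identity.
  det-⊡ : (M N : Matrix n n) → det (M ⊡ N) ≈ det M * det N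
  det-⊡ M N = begin
    det (M ⊡ N)          ≈⟨ alternating-unique (compose-linear det-alternating
      (λ u k → sum λ j → u j * N j k)
                               (λ eq k → sum-cong-≋ λ j → *-congʳ (eq j)) row-linear) M ⟩
    det (δ ⊡ N) * det M  ≈⟨ *-congʳ (det-cong λ i k → trans
                               (sum-cong-≋ λ j → trans (*-comm _ _) (*-congˡ (δ-sym i j)))
                               (sum-δ (λ j → N j k) i)) ⟩
    det N * det M        ≈⟨ *-comm _ _ ⟩
    det M * det N        ∎
    where
    row-linear : ∀ x {u v w} → (∀ j → w j ≈ x * u j + v j) →
      ∀ k → sum (λ j → w j * N j k) ≈ x * sum (λ j → u j * N j k) + sum (λ j → v j * N j k)
    row-linear x {u} {v} {w} eq k = begin
      sum (λ j → w j * N j k)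
        ≈⟨ sum-cong-≋ (λ j → trans (*-congʳ (eq j))
          (trans (distribʳ _ _ _) (+-congʳ (*-assoc _ _ _)))) ⟩
      sum (λ j → x * (u j * N j k) + v j * N j k)
        ≈⟨ ∑-distrib-+ (λ j → x * (u j * N j k)) _ ⟩
      sum (λ j → x * (u j * N j k)) + sum (λ j → v j * N j k)
        ≈⟨ +-congʳ (*-distribˡ-sum x λ j → u j * N j k) ⟨
      x * sum (λ j → u j * N j k) + sum (λ j → v j * N j k) ∎

  open import Algebra.Definitions.RawSemiring (Semiring.rawSemiring semiring) using (product)

  det-scale-rows : (x : Row n) (M : Matrix n n) → det (λ i j → x i * M i j) ≈ product x * det M
  det-scale-rows {zero}  x M = sym (*-identityˡ _)
  det-scale-rows {suc n} x M = begin
    sum (λ j → sign j * (x zero * M zero j * det (λ i k → x (suc i) * minor M j i k)))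
      ≈⟨ sum-cong-≋ {suc n} (λ j → *-congˡ {sign j}
        (*-congˡ {x zero * M zero j} (det-scale-rows (x ∘ suc) (minor M j)))) ⟩
    sum (λ j → sign j * (x zero * M zero j * (product (x ∘ suc) * det (minor M j))))
      ≈⟨ sum-cong-≋ {suc n} (λ j → trans (*-congˡ {sign j} (interchange (x zero) (M zero j) _ _))
           (x∙yz≈y∙xz (sign j) (product x) (M zero j * det (minor M j)))) ⟩
    sum (λ j → product x * (sign j * (M zero j * det (minor M j))))
      ≈⟨ *-distribˡ-sum (product x) (λ j → sign j * (M zero j * det (minor M j))) ⟨
    product x * det M ∎

  det-scale-columns : (x : Row n) (M : Matrix n n) → det (λ i j → x j * M i j) ≈ product x * det M
  det-scale-columns x M = begin
    det (λ i j → x j * M i j)  ≈⟨ det-transpose (λ i j → x j * M i j) ⟨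
    det (λ i j → x i * M j i)  ≈⟨ det-scale-rows x (flip M) ⟩
    product x * det (flip M)   ≈⟨ *-congˡ (det-transpose M) ⟩
    product x * det M          ∎

-- Reindexing finite sums and products.

module Reindexing {c ℓ} (M : CommutativeMonoid c ℓ) where
  open CommutativeMonoid M
  open import Algebra.Properties.CommutativeMonoid.Sum M

  sum-at : ∀ {n} (t : Fin n → Carrier) i → (∀ j → j ≢ i → t j ≈ ε) → sum t ≈ t i
  sum-at {suc n} t i t≈ε = trans (sum-remove {i = i} t) (trans
    (∙-congˡ (trans (sum-cong-≋ λ j → t≈ε (punchIn i j) (punchInᵢ≢i i j)) (sum-replicate-zero n)))
    (identityʳ _))

  module _ {b ℓ′} (B : Setoid b ℓ′) where
    private module B = Setoid B

    -- The two inclusions of images supply the permutation and its inverse. This removes the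
    -- dependence on the order in which D₄ or the characters are listed, for products as well as for
    -- sums.
    sum-same-image : ∀ {m n} (φ : Fin m → B.Carrier) (ψ : Fin n → B.Carrier) →
      Injective _≡_ B._≈_ φ → Injective _≡_ B._≈_ ψ →
      (∀ i → ∃ λ j → ψ j B.≈ φ i) → (∀ j → ∃ λ i → φ i B.≈ ψ j) →
      (f : B.Carrier → Carrier) → (∀ {x y} → x B.≈ y → f x ≈ f y) →
      sum (f ∘ φ) ≈ sum (f ∘ ψ)
    sum-same-image φ ψ φ-inj ψ-inj into onto f f-cong = trans
      (sum-permute (f ∘ φ) (mk↔ₛ′ (proj₁ ∘ onto) (proj₁ ∘ into)
        (λ i → φ-inj (B.trans (proj₂ (onto _)) (proj₂ (into i))))
        (λ j → ψ-inj (B.trans (proj₂ (into _)) (proj₂ (onto j))))))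
      (sum-cong-≋ λ j → f-cong (proj₂ (onto j)))

    module _ (fin : Finite B) where
      open Finite fin using (enumeration; to; from)
      open Inverse enumeration using (from-cong; strictlyInverseˡ; strictlyInverseʳ)

      to-injective : Injective _≡_ B._≈_ to
      to-injective eq = ≡.trans (≡.sym (strictlyInverseʳ _))
        (≡.trans (from-cong eq) (strictlyInverseʳ _))

      sum-enumeration : ∀ {n} (ψ : Fin n → B.Carrier) → Injective _≡_ B._≈_ ψ →
        (∀ x → ∃ λ j → ψ j B.≈ x) →
        (f : B.Carrier → Carrier) → (∀ {x y} → x B.≈ y → f x ≈ f y) →
        sum (f ∘ to) ≈ sum (f ∘ ψ)
      sum-enumeration ψ ψ-inj onto = sum-same-image to ψ to-injective ψ-inj
        (λ i → onto (to i)) (λ j → from (ψ j) , strictlyInverseˡ (ψ j))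

      sum-bijection : (σ τ : B.Carrier → B.Carrier) →
        (∀ {x y} → x B.≈ y → τ x B.≈ τ y) → (∀ x → τ (σ x) B.≈ x) → (∀ x → σ (τ x) B.≈ x) →
        (f : B.Carrier → Carrier) → (∀ {x y} → x B.≈ y → f x ≈ f y) →
        (∀ {x y} → x B.≈ y → σ x B.≈ σ y) →
        sum (f ∘ to) ≈ sum (f ∘ σ ∘ to)
      sum-bijection σ τ τ-cong τσ στ f f-cong σ-cong = sum-enumeration (σ ∘ to)
        (λ eq → to-injective (B.trans (B.sym (τσ _)) (B.trans (τ-cong eq) (τσ _))))
        (λ x → from (τ x) , B.trans (σ-cong (strictlyInverseˡ (τ x))) (στ x)) f f-cong

      sum-single : ∀ x₀ (f : B.Carrier → Carrier) → (∀ {x y} → x B.≈ y → f x ≈ f y) →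
        (∀ x → ¬ (x B.≈ x₀) → f x ≈ ε) → sum (f ∘ to) ≈ f x₀
      sum-single x₀ f f-cong f≈ε = trans
        (sum-at (f ∘ to) (from x₀) λ j j≢ → f≈ε (to j) λ eq →
          j≢ (≡.trans (≡.sym (strictlyInverseʳ j)) (from-cong eq)))
        (f-cong (strictlyInverseˡ x₀))

  sumTo : ℕ → (ℕ → Carrier) → Carrier
  sumTo n f = sum {n} (f ∘ toℕ)

  sumTo-cong : ∀ n {f g : ℕ → Carrier} → (∀ i → f i ≈ g i) → sumTo n f ≈ sumTo n g
  sumTo-cong n f≈g = sum-cong-≋ {n} λ i → f≈g (toℕ i)

  sumTo-last : ∀ n f → sumTo (suc n) f ≈ sumTo n f ∙ f n
  sumTo-last n f = trans (sum-init-last {n} (f ∘ toℕ)) (∙-cong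
    (sum-cong-≋ {n} λ i → reflexive (≡.cong f (toℕ-inject₁ i)))
    (reflexive (≡.cong f (toℕ-fromℕ n))))

  sumTo-+ : ∀ m n f → sumTo (m ℕ.+ n) f ≈ sumTo m f ∙ sumTo n (λ i → f (m ℕ.+ i))
  sumTo-+ zero    n f = sym (identityˡ _)
  sumTo-+ (suc m) n f = trans (∙-congˡ (sumTo-+ m n (f ∘ suc))) (sym (assoc _ _ _))

  sumTo-even-odd : ∀ n f → sumTo (n ℕ.* 2) f ≈ sumTo n (λ i → f (i ℕ.* 2) ∙ f (1 ℕ.+ i ℕ.* 2))
  sumTo-even-odd zero    f = refl
  sumTo-even-odd (suc n) f = trans (∙-congˡ (∙-congˡ (sumTo-even-odd n (λ i → f (2 ℕ.+ i)))))
    (sym (assoc _ _ _))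

module PeriodicSums {c ℓ} (A : AbelianGroup c ℓ) where
  open AbelianGroup A
  open Reindexing commutativeMonoid
  open import Algebra.Properties.Group group using (∙-cancelˡ)

  -- A shift by one exchanges the front term `f 0` for the back term `f n`. These agree by
  -- periodicity and are cancelled, which is why a group is assumed.
  sumTo-shift : ∀ n f → (∀ i → f (n ℕ.+ i) ≈ f i) → ∀ m → sumTo n (λ i → f (m ℕ.+ i)) ≈ sumTo n f
  sumTo-shift n f periodic zero    = refl
  sumTo-shift n f periodic (suc m) = trans (sumTo-shift n (f ∘ suc) suc-periodic m) one-step
    where
    suc-periodic : ∀ i → f (suc (n ℕ.+ i)) ≈ f (suc i)
    suc-periodic i = trans (reflexive (≡.cong f (≡.sym (ℕₚ.+-suc n i)))) (periodic (suc i))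
    one-step : sumTo n (f ∘ suc) ≈ sumTo n f
    one-step = ∙-cancelˡ (f 0) _ _ (trans (sumTo-last n f) (trans (comm _ _)
      (∙-congʳ (trans (reflexive (≡.cong f (≡.sym (ℕₚ.+-identityʳ n)))) (periodic 0)))))

-- Powers, geometric sums and cancellation in Heyting fields.

square-root-of-one : ∀ {c ℓ} (R : CommutativeRing c ℓ) → let open CommutativeRing R in
  ∀ u → u * u ≈ 1# → (u - 1#) * (u + 1#) ≈ 0#
square-root-of-one R u uu≈1 = begin
  (u - 1#) * (u + 1#)              ≈⟨ distribʳ _ _ _ ⟩
  u * (u + 1#) + - 1# * (u + 1#)   ≈⟨ +-cong (distribˡ _ _ _) (-1*x≈-x _) ⟩
  u * u + u * 1# - (u + 1#)        ≈⟨ +-congʳ (+-cong uu≈1 (*-identityʳ u)) ⟩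
  1# + u - (u + 1#)                ≈⟨ +-congʳ (+-comm 1# u) ⟩
  u + 1# - (u + 1#)                ≈⟨ -‿inverseʳ _ ⟩
  0#                               ∎
  where
  open CommutativeRing R
  open import Algebra.Properties.Ring ring using (-1*x≈-x)
  open SetoidReasoning setoid

module HeytingFieldProperties {c ℓ₁ ℓ₂} (H : HeytingField c ℓ₁ ℓ₂) where
  open HeytingField H hiding (zero)
  open HeytingProperties heytingCommutativeRing
  open FieldOps H using (commutativeRing; _^_)
  private module R = CommutativeRing commutativeRing
  open import Algebra.Properties.Ring R.ring using (x∙y⁻¹≈ε⇒x≈y; -1*x≈-x; -‿involutive)
  open import Algebra.Properties.Semiring.Exp R.semiring using (^-congˡ; ^-homo-*; ^-assocʳ)
  open import Algebra.Properties.Semiring.Sum R.semiring using (*-distribˡ-sum)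
  open Reindexing R.+-commutativeMonoid using (sumTo)
  module Products = Reindexing R.*-commutativeMonoid
  open SetoidReasoning setoid

  unit-cancel : ∀ {u x y} → (∃ λ v → u * v ≈ 1#) → u * x ≈ u * y → x ≈ y
  unit-cancel {u} {x} {y} (v , uv≈1) eq = begin
    x            ≈⟨ *-identityˡ x ⟨
    1# * x       ≈⟨ *-congʳ vu≈1 ⟨
    v * u * x    ≈⟨ *-assoc v u x ⟩
    v * (u * x)  ≈⟨ *-congˡ eq ⟩
    v * (u * y)  ≈⟨ *-assoc v u y ⟨
    v * u * y    ≈⟨ *-congʳ vu≈1 ⟩
    1# * y       ≈⟨ *-identityˡ y ⟩
    y            ∎
    where
    vu≈1 : v * u ≈ 1#
    vu≈1 = trans (*-comm v u) uv≈1

  unit-*-zero : ∀ {x y z} → x # y → (x - y) * z ≈ 0# → z ≈ 0#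
  unit-*-zero x#y eq with #⇒invertible x#y
  ... | v , _ , uv≈1 = unit-cancel (v , uv≈1) (trans eq (sym (zeroʳ _)))

  1^n≈1 : ∀ n → 1# ^ n ≈ 1#
  1^n≈1 zero    = refl
  1^n≈1 (suc n) = trans (*-identityˡ _) (1^n≈1 n)

  ^-comm : ∀ x m n → (x ^ m) ^ n ≈ (x ^ n) ^ m
  ^-comm x m n = trans (^-assocʳ x m n) (trans (reflexive (≡.cong (x ^_) (ℕₚ.*-comm m n)))
    (sym (^-assocʳ x n m)))

  ^-multiple : ∀ {x} m → x ^ m ≈ 1# → ∀ k → x ^ (m ℕ.* k) ≈ 1#
  ^-multiple {x} m eq k = trans (sym (^-assocʳ x m k)) (trans (^-congˡ k eq) (1^n≈1 k))

  -- The telescoping identity without subtraction, so that the induction uses semiring laws only.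
  geometric : ∀ x n → x * sumTo n (x ^_) + 1# ≈ sumTo n (x ^_) + x ^ n
  geometric x zero    = +-congʳ (zeroʳ x)
  geometric x (suc n) = begin
    x * sumTo (suc n) (x ^_) + 1#     ≈⟨ +-congʳ (*-congˡ (trans tail-sum (geometric x n))) ⟩
    x * (sumTo n (x ^_) + x ^ n) + 1# ≈⟨ +-congʳ (distribˡ _ _ _) ⟩
    x * sumTo n (x ^_) + x ^ suc n + 1# ≈⟨ +-assoc _ _ _ ⟩
    x * sumTo n (x ^_) + (x ^ suc n + 1#) ≈⟨ +-congˡ (+-comm _ _) ⟩
    x * sumTo n (x ^_) + (1# + x ^ suc n) ≈⟨ +-assoc _ _ _ ⟨
    x * sumTo n (x ^_) + 1# + x ^ suc n ≈⟨ +-congʳ tail-sum ⟨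
    sumTo (suc n) (x ^_) + x ^ suc n  ∎
    where
    tail-sum : sumTo (suc n) (x ^_) ≈ x * sumTo n (x ^_) + 1#
    tail-sum = trans (+-congˡ (sym (*-distribˡ-sum {n} x _))) (+-comm _ _)

  geometric-difference : ∀ x n → (x - 1#) * sumTo n (x ^_) ≈ x ^ n - 1#
  geometric-difference x n = begin
    (x - 1#) * S            ≈⟨ distribʳ _ _ _ ⟩
    x * S + - 1# * S        ≈⟨ +-congˡ (-1*x≈-x S) ⟩
    x * S - S               ≈⟨ +-congʳ xS≈ ⟩
    S + (x ^ n - 1#) - S    ≈⟨ +-congʳ (+-comm _ _) ⟩
    x ^ n - 1# + S - S      ≈⟨ +-assoc _ _ _ ⟩
    x ^ n - 1# + (S - S)    ≈⟨ +-congˡ (-‿inverseʳ S) ⟩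
    x ^ n - 1# + 0#         ≈⟨ +-identityʳ _ ⟩
    x ^ n - 1#              ∎
    where
    S = sumTo n (x ^_)
    xS≈ : x * S ≈ S + (x ^ n - 1#)
    xS≈ = begin
      x * S               ≈⟨ +-identityʳ _ ⟨
      x * S + 0#          ≈⟨ +-congˡ (-‿inverseʳ 1#) ⟨
      x * S + (1# - 1#)   ≈⟨ +-assoc _ _ _ ⟨
      x * S + 1# - 1#     ≈⟨ +-congʳ (geometric x n) ⟩
      S + x ^ n - 1#      ≈⟨ +-assoc _ _ _ ⟩
      S + (x ^ n - 1#)    ∎

  geometric-sum-root-of-unity : ∀ {x} n → x # 1# → x ^ n ≈ 1# → sumTo n (x ^_) ≈ 0#
  geometric-sum-root-of-unity {x} n x#1 x^n≈1 = unit-*-zero x#1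
    (trans (geometric-difference x n) (trans (+-congʳ x^n≈1) (-‿inverseʳ 1#)))

  -- `x - 1#` divides `x ^ n - 1#`, and a divisor of an invertible element is invertible. In this
  -- way primitivity passes from `ζ` to `η`.
  ^-#1 : ∀ {x} n → x ^ n # 1# → x # 1#
  ^-#1 {x} n x^n#1 with #⇒invertible x^n#1
  ... | y , _ , eq = invertibleʳ⇒# (sumTo n (x ^_) * y ,
    trans (sym (*-assoc _ _ _)) (trans (*-congʳ (geometric-difference x n)) eq))

  square-root≈-1 : ∀ {u} → u # 1# → u * u ≈ 1# → u ≈ - 1#
  square-root≈-1 {u} u#1 uu≈1 = x∙y⁻¹≈ε⇒x≈y _ _ (trans (+-congˡ (-‿involutive 1#))
    (unit-*-zero u#1 (square-root-of-one commutativeRing u uu≈1)))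

  product-const : ∀ x n → Products.sumTo n (λ _ → x) ≈ x ^ n
  product-const x zero    = refl
  product-const x (suc n) = *-congˡ (product-const x n)

  -- The exponents 0, ..., 2h add up to h(2h + 1), a multiple of the number of factors. For an even
  -- number of factors this would fail.
  product-powers : ∀ z h → z ^ suc (h ℕ.* 2) ≈ 1# → Products.sumTo (suc (h ℕ.* 2)) (z ^_) ≈ 1#
  product-powers z h z^n≈1 = trans (odd-length h) (^-multiple (suc (h ℕ.* 2)) z^n≈1 h)
    where
    odd-length : ∀ h → Products.sumTo (suc (h ℕ.* 2)) (z ^_) ≈ z ^ (suc (h ℕ.* 2) ℕ.* h)
    odd-length zero    = *-identityˡ 1#
    odd-length (suc h) = begin
      Products.sumTo (3 ℕ.+ h ℕ.* 2) (z ^_)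
        ≈⟨ Products.sumTo-last (2 ℕ.+ h ℕ.* 2) (z ^_) ⟩
      Products.sumTo (2 ℕ.+ h ℕ.* 2) (z ^_) * z ^ (2 ℕ.+ h ℕ.* 2)
        ≈⟨ *-congʳ (Products.sumTo-last (1 ℕ.+ h ℕ.* 2) (z ^_)) ⟩
      Products.sumTo (1 ℕ.+ h ℕ.* 2) (z ^_) * z ^ (1 ℕ.+ h ℕ.* 2) * z ^ (2 ℕ.+ h ℕ.* 2)
        ≈⟨ *-congʳ (*-congʳ (odd-length h)) ⟩
      z ^ ((1 ℕ.+ h ℕ.* 2) ℕ.* h) * z ^ (1 ℕ.+ h ℕ.* 2) * z ^ (2 ℕ.+ h ℕ.* 2)
        ≈⟨ *-congʳ (^-homo-* z ((1 ℕ.+ h ℕ.* 2) ℕ.* h) (1 ℕ.+ h ℕ.* 2)) ⟨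
      z ^ ((1 ℕ.+ h ℕ.* 2) ℕ.* h ℕ.+ (1 ℕ.+ h ℕ.* 2)) * z ^ (2 ℕ.+ h ℕ.* 2)
        ≈⟨ ^-homo-* z ((1 ℕ.+ h ℕ.* 2) ℕ.* h ℕ.+ (1 ℕ.+ h ℕ.* 2)) (2 ℕ.+ h ℕ.* 2) ⟨
      z ^ ((1 ℕ.+ h ℕ.* 2) ℕ.* h ℕ.+ (1 ℕ.+ h ℕ.* 2) ℕ.+ (2 ℕ.+ h ℕ.* 2))
        ≡⟨ ≡.cong (z ^_) (exponent h) ⟩
      z ^ ((3 ℕ.+ h ℕ.* 2) ℕ.* suc h) ∎
      where
      exponent : ∀ h → (1 ℕ.+ h ℕ.* 2) ℕ.* h ℕ.+ (1 ℕ.+ h ℕ.* 2) ℕ.+ (2 ℕ.+ h ℕ.* 2) ≡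
                       (3 ℕ.+ h ℕ.* 2) ℕ.* suc h
      exponent = solve-∀

-- Counting and divisibility in the natural numbers.

injective⇒surjective : ∀ {n} {f : Fin n → Fin n} → Injective _≡_ _≡_ f → ∀ y → ∃ λ x → f x ≡ y
injective⇒surjective {suc n} {f} inj y with any? (λ x → f x Finₚ.≟ y)
... | yes found = found
... | no missed = contradiction (injective⇒≤ {f = λ x → punchOut (y≢f x)} avoiding) ℕₚ.1+n≰n
  where
  y≢f : ∀ x → y ≢ f x
  y≢f x eq = missed (x , ≡.sym eq)
  avoiding : Injective _≡_ _≡_ (λ x → punchOut (y≢f x))
  avoiding {i} {j} eq = inj (punchOut-injective (y≢f i) (y≢f j) eq)

-- The prime factors of the product are cancelled against `m` one by one until some prime does not
-- divide what is left of `m`; it occurs more often in the product than in `m`. On the way back, a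
-- cancelled prime either equals it and raises `e`, or goes into the cofactor.
excess-prime : ∀ {ps} → All.All Prime ps → ∀ m → ¬ ListAction.product ps ∣ m →
  ∃ λ p → Prime p × ∃₂ λ e m′ → m ≡ p ℕ.^ e ℕ.* m′ × ¬ p ∣ m′ × p ℕ.^ suc e ∣ ListAction.product ps
excess-prime All.[]                     m b∤m = contradiction (1∣ m) b∤m
excess-prime {p List.∷ ps} (p-prime All.∷ primes) m b∤m with p ∣? m
... | no p∤m = p , p-prime , 0 , m , ≡.sym (ℕₚ.*-identityˡ m) , p∤m ,
               ≡.subst (_∣ p ℕ.* ListAction.product ps) (≡.sym (ℕₚ.*-identityʳ p))
                 (m∣m*n (ListAction.product ps))
... | yes (divides k ≡.refl)
  with excess-prime primes k (λ d → b∤m (≡.subst (p ℕ.* ListAction.product ps ∣_) (ℕₚ.*-comm p k)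
    (*-monoʳ-∣ p d)))
... | p′ , p′-prime , e , m′ , ≡.refl , p′∤m′ , p′^∣ with p ℕₚ.≟ p′
... | yes ≡.refl = p , p-prime , suc e , m′ ,
  ≡.trans (ℕₚ.*-comm _ p) (≡.sym (ℕₚ.*-assoc p (p ℕ.^ e) m′)) , p′∤m′ , *-monoʳ-∣ p p′^∣
... | no p≢p′ = p′ , p′-prime , e , m′ ℕ.* p , ℕₚ.*-assoc (p′ ℕ.^ e) m′ p , p′∤m′p ,
  ∣-trans p′^∣ (n∣m*n p)
  where
  p′∤m′p : ¬ p′ ∣ m′ ℕ.* p
  p′∤m′p d with euclidsLemma m′ p p′-prime d
  ... | inj₁ p′∣m′ = p′∤m′ p′∣m′
  ... | inj₂ p′∣p with prime⇒irreducible p-prime p′∣p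
  ...   | inj₁ ≡.refl = contradiction p′-prime ¬prime[1]
  ...   | inj₂ p′≡p   = p≢p′ (≡.sym p′≡p)

prime-power-coprime : ∀ {p m} → Prime p → ¬ p ∣ m → ∀ e → Coprime (p ℕ.^ e) m
prime-power-coprime p-prime p∤m zero    (d∣1 , _) = ∣1⇒≡1 d∣1
prime-power-coprime {p} {m} p-prime p∤m (suc e) {d} (d∣pp^e , d∣m) =
  prime-power-coprime p-prime p∤m e (coprime-divisor d-coprime-p d∣pp^e , d∣m)
  where
  d-coprime-p : Coprime d p
  d-coprime-p (c∣d , c∣p) with prime⇒irreducible p-prime c∣p
  ... | inj₁ c≡1    = c≡1
  ... | inj₂ ≡.refl = contradiction (∣-trans c∣d d∣m) p∤m

-- The multiplicative group of a finite field is cyclic.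

module FieldUnits {c ℓ₁ ℓ₂} (F : FiniteField c ℓ₁ ℓ₂) where
  open FiniteField F hiding (zero)
  private
    module R = CommutativeRing commutativeRing
  open import Algebra.Properties.Ring R.ring using (-‿distribʳ-*; x∙y⁻¹≈ε⇒x≈y)
  open import Algebra.Properties.Semiring.Exp R.semiring using (^-congˡ; ^-homo-*; ^-assocʳ)
  open import Algebra.Properties.CommutativeSemiring.Exp R.commutativeSemiring using (^-distrib-*)
  open import Algebra.Solver.Ring.NaturalCoefficients.Default R.commutativeSemiring
    using (solve; _:+_; _:*_; _:=_; con)
  open HeytingFieldProperties heytingField public using (1^n≈1; ^-multiple)
  open SetoidReasoning setoid

  private
    variable
      n k : ℕ
      f : Carrier → Carrier

  x-y≈0⇒x≈y : ∀ {x y} → x - y ≈ 0# → x ≈ y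
  x-y≈0⇒x≈y = x∙y⁻¹≈ε⇒x≈y _ _

  y+[x-y]≈x : ∀ x y → y + (x - y) ≈ x
  y+[x-y]≈x x y = begin
    y + (x - y)    ≈⟨ +-congˡ (+-comm x (- y)) ⟩
    y + (- y + x)  ≈⟨ +-assoc y (- y) x ⟨
    y - y + x      ≈⟨ +-congʳ (-‿inverseʳ y) ⟩
    0# + x         ≈⟨ +-identityˡ x ⟩
    x              ∎

  xy≈0⇒y≈0 : ∀ {x y} → ¬ (x ≈ 0#) → x * y ≈ 0# → y ≈ 0#
  xy≈0⇒y≈0 {x} {y} x≉0 xy≈0 = decidable-stable (y ≟ 0#) λ y≉0 → *-nonzero x≉0 y≉0 xy≈0

  ^-nonzero : ∀ {x} → ¬ (x ≈ 0#) → ∀ n → ¬ (x ^ n ≈ 0#)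
  ^-nonzero x≉0 zero    = 1≉0
  ^-nonzero x≉0 (suc n) = *-nonzero x≉0 (^-nonzero x≉0 n)

  -- Monic polynomial functions in Horner form, indexed by the degree. Coefficient lists never
  -- appear, only values.
  data Monic : ℕ → (Carrier → Carrier) → Set (c ⊔ ℓ₁) where
    one  : (∀ x → f x ≈ 1#) → Monic 0 f
    step : ∀ {g} a → Monic n g → (∀ x → f x ≈ a + x * g x) → Monic (suc n) f

  -- Synthetic division: if `h` is the quotient of `g` by `x - r`, then `g r + x * h x` is that of
  -- `a + x * g x`.
  factor-theorem : Monic (suc n) f → ∀ r →
    ∃ λ h → Monic n h × (∀ x → f x ≈ f r + (x - r) * h x)
  factor-theorem {f = f} (step {g = g} a (one g≈1) f≈) r = (λ _ → 1#) , one (λ _ → refl) , λ x → begin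
    f x                        ≈⟨ f≈ x ⟩
    a + x * g x                ≈⟨ +-congˡ (*-cong (sym (y+[x-y]≈x x r)) (g≈1 x)) ⟩
    a + (r + (x - r)) * 1#     ≈⟨ solve 3 (λ a r d → a :+ (r :+ d) :* con 1 :=
      (a :+ r :* con 1) :+ d :* con 1) refl a r (x - r) ⟩
    a + r * 1# + (x - r) * 1#  ≈⟨ +-congʳ (+-congˡ (*-congˡ (sym (g≈1 r)))) ⟩
    a + r * g r + (x - r) * 1# ≈⟨ +-congʳ (sym (f≈ r)) ⟩
    f r + (x - r) * 1#         ∎
  factor-theorem {f = f} (step {g = g} a M@(step _ _ _) f≈) r with factor-theorem M r
  ... | h , H , g≈ = (λ x → g r + x * h x) , step (g r) H (λ _ → refl) , λ x → begin
    f x                                      ≈⟨ f≈ x ⟩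
    a + x * g x                              ≈⟨ +-congˡ (*-congˡ (g≈ x)) ⟩
    a + x * (g r + (x - r) * h x)            ≈⟨ +-congˡ (distribˡ x (g r) _) ⟩
    a + (x * g r + x * ((x - r) * h x))      ≈⟨ +-congˡ (+-congʳ (*-congʳ (sym (y+[x-y]≈x x r)))) ⟩
    a + ((r + (x - r)) * g r + x * ((x - r) * h x))
      ≈⟨ solve 6 (λ a r d u x h → a :+ ((r :+ d) :* u :+ x :* (d :* h)) := (a :+ r :* u) :+ d :*
        (u :+ x :* h))
           refl a r (x - r) (g r) x (h x) ⟩
    a + r * g r + (x - r) * (g r + x * h x)  ≈⟨ +-congʳ (sym (f≈ r)) ⟩
    f r + (x - r) * (g r + x * h x)          ∎

  roots≤degree : Monic n f → (ρ : Fin k → Carrier) → Injective _≡_ _≈_ ρ →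
                 (∀ i → f (ρ i) ≈ 0#) → k ℕ.≤ n
  roots≤degree {k = zero}  M           ρ inj root = ℕ.z≤n
  roots≤degree {k = suc k} (one f≈1)   ρ inj root = contradiction (trans (sym (f≈1 _)) (root zero)) 1≉0
  roots≤degree {f = f} {k = suc k} M@(step _ _ _) ρ inj root with factor-theorem M (ρ zero)
  ... | h , H , f≈ = ℕ.s≤s (roots≤degree H (ρ ∘ suc) (λ eq → Finₚ.suc-injective (inj eq)) λ i →
    xy≈0⇒y≈0 (λ eq → contradiction (inj (x-y≈0⇒x≈y eq)) λ ()) (begin
      (ρ (suc i) - ρ zero) * h (ρ (suc i))               ≈⟨ +-identityˡ _ ⟨
      0# + (ρ (suc i) - ρ zero) * h (ρ (suc i))          ≈⟨ +-congʳ (root zero) ⟨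
      f (ρ zero) + (ρ (suc i) - ρ zero) * h (ρ (suc i))  ≈⟨ f≈ _ ⟨
      f (ρ (suc i))                                      ≈⟨ root (suc i) ⟩
      0#                                                 ∎))

  power-monic : ∀ n → Monic n (_^ n)
  power-monic zero    = one λ _ → refl
  power-monic (suc n) = step 0# (power-monic n) λ x → sym (+-identityˡ _)

  roots-of-unity≤ : ∀ m .{{_ : NonZero m}} (ρ : Fin k → Carrier) → Injective _≡_ _≈_ ρ →
                    (∀ i → ρ i ^ m ≈ 1#) → k ℕ.≤ m
  roots-of-unity≤ (suc m) ρ inj root =
    roots≤degree (step (- 1#) (power-monic m) λ _ → refl) ρ inj
      λ i → trans (+-congˡ (root i)) (-‿inverseˡ 1#)

  record UnitIndexing (N : ℕ) : Set (c ⊔ ℓ₁) where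
    field
      unit         : Fin N → Carrier
      unit-inj     : Injective _≡_ _≈_ unit
      unit-nonzero : ∀ i → ¬ (unit i ≈ 0#)
      index        : ∀ {x} → ¬ (x ≈ 0#) → Fin N
      unit-index   : ∀ {x} (x≉0 : ¬ (x ≈ 0#)) → unit (index x≉0) ≈ x

  private
    index-units : ∀ s → Inverse (≡.setoid (Fin s)) setoid → UnitIndexing (s ℕ.∸ 1)
    index-units zero    e with () ← Inverse.from e 0#
    index-units (suc N) e = record
      { unit         = e.to ∘ punchIn z
      ; unit-inj     = λ {i} {j} eq → punchIn-injective z i j
          (≡.trans (≡.sym (e.strictlyInverseʳ _)) (≡.trans (e.from-cong eq) (e.strictlyInverseʳ _)))
      ; unit-nonzero = λ i eq → punchInᵢ≢i z i
          (≡.trans (≡.sym (e.strictlyInverseʳ _)) (e.from-cong eq))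
      ; index        = λ {x} x≉0 → punchOut (z≢ x≉0)
      ; unit-index   = λ {x} x≉0 → trans
          (reflexive (≡.cong e.to (punchIn-punchOut (z≢ x≉0)))) (e.strictlyInverseˡ x)
      }
      where
      module e = Inverse e
      z = e.from 0#
      z≢ : ∀ {x} → ¬ (x ≈ 0#) → z ≢ e.from x
      z≢ x≉0 eq = x≉0 (trans (sym (e.strictlyInverseˡ _))
        (trans (e.to-cong (≡.sym eq)) (e.strictlyInverseˡ _)))

  N : ℕ
  N = card ℕ.∸ 1

  -- Kept abstract, like primitiveElement: otherwise every later with-abstraction unfolds it.
  abstract
    unitIndexing : UnitIndexing N
    unitIndexing = index-units card (Finite.enumeration finite)

  open UnitIndexing unitIndexing public

  index-inj : ∀ {x y} (x≉0 : ¬ (x ≈ 0#)) (y≉0 : ¬ (y ≈ 0#)) → index x≉0 ≡ index y≉0 → x ≈ y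
  index-inj x≉0 y≉0 eq = trans (sym (unit-index x≉0))
    (trans (reflexive (≡.cong unit eq)) (unit-index y≉0))

  -- Minimality is put in the divisibility form that the coprimality arguments use. Order 0 is not
  -- excluded, so `NonZero m` accompanies it where a genuine order is meant.
  record HasOrder (x : Carrier) (m : ℕ) : Set (c ⊔ ℓ₁) where
    constructor hasOrder
    field
      power≈1 : x ^ m ≈ 1#
      minimal : ∀ j → x ^ j ≈ 1# → m ∣ j

  open HasOrder

  module _ {x} (x≉0 : ¬ (x ≈ 0#)) where

    ^-cancel : ∀ i d → x ^ i ≈ x ^ (i ℕ.+ d) → x ^ d ≈ 1#
    ^-cancel i d eq = x-y≈0⇒x≈y (xy≈0⇒y≈0 (^-nonzero x≉0 i) (begin
      x ^ i * (x ^ d - 1#)               ≈⟨ distribˡ _ _ _ ⟩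
      x ^ i * x ^ d + x ^ i * (- 1#)     ≈⟨ +-cong (trans (sym (^-homo-* x i d)) (sym eq)) x·-1 ⟩
      x ^ i - x ^ i                      ≈⟨ -‿inverseʳ _ ⟩
      0#                                 ∎))
      where
      x·-1 : x ^ i * (- 1#) ≈ - (x ^ i)
      x·-1 = trans (sym (-‿distribʳ-* _ _)) (-‿cong (*-identityʳ _))

    equal-powers : ∀ {i j} → i ℕ.< j → x ^ i ≈ x ^ j → ∃ λ d → 0 ℕ.< d × d ℕ.≤ j × x ^ d ≈ 1#
    equal-powers {i} {j} i<j eq = j ℕ.∸ i , ℕₚ.m<n⇒0<n∸m i<j , ℕₚ.m∸n≤m j i ,
      ^-cancel i (j ℕ.∸ i) (trans eq (reflexive (≡.cong (x ^_) (≡.sym (ℕₚ.m+[n∸m]≡n (ℕₚ.<⇒≤ i<j))))))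

    powers-injective : ∀ {m} → HasOrder x m → Injective _≡_ _≈_ (λ (i : Fin m) → x ^ toℕ i)
    powers-injective {m} ord {i} {j} eq = toℕ-injective toℕ-eq
      where
      not-less : ∀ {i j} → j ℕ.< m → i ℕ.< j → ¬ (x ^ i ≈ x ^ j)
      not-less j<m i<j eq with equal-powers i<j eq
      ... | d , 0<d , d≤j , x^d≈1 =
        ℕₚ.<⇒≱ (ℕₚ.≤-<-trans d≤j j<m) (∣⇒≤ {{ℕ.>-nonZero 0<d}} (minimal ord d x^d≈1))
      toℕ-eq : toℕ i ≡ toℕ j
      toℕ-eq with ℕₚ.<-cmp (toℕ i) (toℕ j)
      ... | tri< i<j _ _ = contradiction eq (not-less (toℕ<n j) i<j)
      ... | tri≈ _ i≡j _ = i≡j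
      ... | tri> _ _ j<i = contradiction (sym eq) (not-less (toℕ<n i) j<i)

    power-index : ℕ → Fin N
    power-index i = index (^-nonzero x≉0 i)

    power-index-cancel : ∀ i j → power-index i ≡ power-index j → x ^ i ≈ x ^ j
    power-index-cancel i j = index-inj (^-nonzero x≉0 i) (^-nonzero x≉0 j)

    power-index-injective : ∀ {m} → HasOrder x m → Injective _≡_ _≡_
      (λ (i : Fin m) → power-index (toℕ i))
    power-index-injective ord {i} {j} eq = powers-injective ord (power-index-cancel (toℕ i) (toℕ j) eq)

    order≤N : ∀ {m} → HasOrder x m → m ℕ.≤ N
    order≤N ord = injective⇒≤ (power-index-injective ord)

    -- Descent: a smaller positive exponent restarts the search. If there is none, then the
    -- remainder modulo `k` of any `j` with `x ^ j ≈ 1#` has to vanish.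
    least-order : ∀ k → Acc ℕ._<_ k → .{{NonZero k}} → x ^ k ≈ 1# → ∃ λ m → NonZero m × HasOrder x m
    least-order k (acc rec) x^k≈1 with any? (λ (j : Fin k) → (0 ℕₚ.<? toℕ j) ×-dec ((x ^ toℕ j) ≟ 1#))
    ... | yes (j , 0<j , x^j≈1) = least-order (toℕ j) (rec (toℕ<n j)) {{ℕ.>-nonZero 0<j}} x^j≈1
    ... | no none = k , ℕ.≢-nonZero (ℕ.≢-nonZero⁻¹ k) , hasOrder x^k≈1 λ j x^j≈1 → m%n≡0⇒n∣m j k
      (remainder j x^j≈1)
      where
      remainder : ∀ j → x ^ j ≈ 1# → j % k ≡ 0
      remainder j x^j≈1 with j % k in eq
      ... | zero  = ≡.refl
      ... | suc r = contradiction (fromℕ< r<k , ≡.subst (0 ℕ.<_) (≡.sym toℕ-r) ℕ.z<s ,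
                      trans (reflexive (≡.cong (x ^_) toℕ-r)) x^r≈1) none
        where
        r<k : suc r ℕ.< k
        r<k = ≡.subst (ℕ._< k) eq (m%n<n j k)
        toℕ-r = toℕ-fromℕ< r<k
        x^r≈1 : x ^ suc r ≈ 1#
        x^r≈1 = begin
          x ^ suc r                              ≈⟨ *-identityʳ _ ⟨
          x ^ suc r * 1#                         ≈⟨ *-congˡ (1^n≈1 (j ℕ./ k)) ⟨
          x ^ suc r * 1# ^ (j ℕ./ k)             ≈⟨ *-congˡ (^-congˡ (j ℕ./ k) x^k≈1) ⟨
          x ^ suc r * (x ^ k) ^ (j ℕ./ k)        ≈⟨ *-congˡ (^-assocʳ x k (j ℕ./ k)) ⟩
          x ^ suc r * x ^ (k ℕ.* (j ℕ./ k))      ≈⟨ ^-homo-* x (suc r) (k ℕ.* (j ℕ./ k)) ⟨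
          x ^ (suc r ℕ.+ k ℕ.* (j ℕ./ k))
            ≡⟨ ≡.cong (x ^_) (≡.sym (≡.trans (m≡m%n+[m/n]*n j k)
              (≡.cong₂ ℕ._+_ eq (ℕₚ.*-comm (j ℕ./ k) k)))) ⟩
          x ^ j                                  ≈⟨ x^j≈1 ⟩
          1#                                     ∎

    -- The powers with exponents 0, ..., `N` take values among only `N` units, so two of them
    -- coincide.
    order : ∃ λ m → NonZero m × HasOrder x m
    order with pigeonhole (ℕₚ.n<1+n N) (λ i → power-index (toℕ i))
    ... | i , j , i<j , eq with equal-powers i<j (power-index-cancel (toℕ i) (toℕ j) eq)
    ... | d , 0<d , _ , x^d≈1 = least-order d (<-wellFounded d) {{ℕ.>-nonZero 0<d}} x^d≈1

  order-^ : ∀ {x} a b .{{_ : NonZero a}} → HasOrder x (a ℕ.* b) → HasOrder (x ^ a) b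
  order-^ {x} a b ord = hasOrder
    (trans (^-assocʳ x a b) (power≈1 ord))
    (λ j eq → *-cancelˡ-∣ a (minimal ord (a ℕ.* j) (trans (sym (^-assocʳ x a j)) eq)))

  -- Raising `(x * y) ^ j ≈ 1#` to the power `b` removes `y`, so `a` divides `b j` and hence `j`.
  -- Removing `x` instead then shows that `b` divides the quotient.
  order-* : ∀ {x y a b} → Coprime a b → HasOrder x a → HasOrder y b → HasOrder (x * y) (a ℕ.* b)
  order-* {x} {y} {a} {b} coprime ox oy = hasOrder power minimal-*
    where
    power : (x * y) ^ (a ℕ.* b) ≈ 1#
    power = begin
      (x * y) ^ (a ℕ.* b)          ≈⟨ ^-distrib-* x y (a ℕ.* b) ⟩
      x ^ (a ℕ.* b) * y ^ (a ℕ.* b)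
        ≈⟨ *-cong (^-multiple a (power≈1 ox) b) (trans (reflexive (≡.cong (y ^_) (ℕₚ.*-comm a b)))
          (^-multiple b (power≈1 oy) a)) ⟩
      1# * 1#                      ≈⟨ *-identityˡ 1# ⟩
      1#                           ∎

    separate : ∀ u v c → v ^ c ≈ 1# → ∀ j → (u * v) ^ j ≈ 1# → u ^ (c ℕ.* j) ≈ 1#
    separate u v c v^c≈1 j eq = begin
      u ^ (c ℕ.* j)                  ≈⟨ *-identityʳ _ ⟨
      u ^ (c ℕ.* j) * 1#             ≈⟨ *-congˡ (^-multiple c v^c≈1 j) ⟨
      u ^ (c ℕ.* j) * v ^ (c ℕ.* j)  ≈⟨ ^-distrib-* u v (c ℕ.* j) ⟨
      (u * v) ^ (c ℕ.* j)            ≡⟨ ≡.cong ((u * v) ^_) (ℕₚ.*-comm c j) ⟩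
      (u * v) ^ (j ℕ.* c)            ≈⟨ ^-multiple j eq c ⟩
      1#                             ∎

    minimal-* : ∀ j → (x * y) ^ j ≈ 1# → a ℕ.* b ∣ j
    minimal-* j eq with coprime-divisor coprime (minimal ox (b ℕ.* j)
      (separate x y b (power≈1 oy) j eq))
    ... | divides i ≡.refl = ≡.subst (a ℕ.* b ∣_) (ℕₚ.*-comm a i) (*-monoʳ-∣ a b∣i)
      where
      b∣a*ia : b ∣ a ℕ.* (i ℕ.* a)
      b∣a*ia = minimal oy (a ℕ.* (i ℕ.* a)) (separate y x a (power≈1 ox) (i ℕ.* a)
        (trans (^-congˡ (i ℕ.* a) (*-comm y x)) eq))
      b∣i : b ∣ i
      b∣i = coprime-divisor (Coprimality.sym coprime)
        (≡.subst (b ∣_) (ℕₚ.*-comm i a) (coprime-divisor (Coprimality.sym coprime) b∣a*ia))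

  -- The order b of `x` does not divide `m`, so some prime p satisfies m = p^e m′ with p not
  -- dividing m′, and b = s p^(e+1). Then x^s has order p^(e+1) and g^(p^e) has order m′; these are
  -- coprime, and the product of the two elements has order p m.
  increase-order : ∀ {g m x} → ¬ (g ≈ 0#) → .{{NonZero m}} → HasOrder g m →
    ¬ (x ≈ 0#) → ¬ (x ^ m ≈ 1#) →
    ∃₂ λ g′ m′ → ¬ (g′ ≈ 0#) × NonZero m′ × HasOrder g′ m′ × m ℕ.< m′
  increase-order {g} {m} {x} g≉0 g-order x≉0 x^m≉1
    with order x≉0
  ... | b , b≢0 , x-order with factorise b {{b≢0}}
  ... | record { factors = ps ; isFactorisation = ≡.refl ; factorsPrime = primes }
    with excess-prime primes m (λ { (divides k ≡.refl) → x^m≉1 (begin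
      x ^ (k ℕ.* ListAction.product ps)   ≡⟨ ≡.cong (x ^_) (ℕₚ.*-comm k (ListAction.product ps)) ⟩
      x ^ (ListAction.product ps ℕ.* k)   ≈⟨ ^-assocʳ x (ListAction.product ps) k ⟨
      (x ^ ListAction.product ps) ^ k     ≈⟨ ^-congˡ k (power≈1 x-order) ⟩
      1# ^ k                   ≈⟨ 1^n≈1 k ⟩
      1#                       ∎) })
  ... | p , p-prime , e , m′ , ≡.refl , p∤m′ , divides s b≡ =
    x ^ s * g ^ (p ℕ.^ e) , p ℕ.^ suc e ℕ.* m′ ,
    *-nonzero (^-nonzero x≉0 s) (^-nonzero g≉0 (p ℕ.^ e)) ,
    ℕ.>-nonZero (ℕₚ.≤-<-trans ℕ.z≤n larger) ,
    order-* (prime-power-coprime p-prime p∤m′ (suc e))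
      (order-^ s (p ℕ.^ suc e) {{ℕₚ.m*n≢0⇒m≢0 s {{≡.subst NonZero b≡ b≢0}}}}
        (≡.subst (HasOrder x) b≡ x-order))
      (order-^ (p ℕ.^ e) m′ {{ℕₚ.m^n≢0 p e {{prime⇒nonZero p-prime}}}} g-order) ,
    larger
    where
    larger : p ℕ.^ e ℕ.* m′ ℕ.< p ℕ.^ suc e ℕ.* m′
    larger = ≡.subst (p ℕ.^ e ℕ.* m′ ℕ.<_)
      (≡.trans (ℕₚ.*-comm (p ℕ.^ e ℕ.* m′) p) (≡.sym (ℕₚ.*-assoc p (p ℕ.^ e) m′)))
      (ℕₚ.m<m*n (p ℕ.^ e ℕ.* m′) p (ℕ.nonTrivial⇒n>1 p {{prime⇒nonTrivial p-prime}}))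

  -- `fuel` bounds the possible increases: an order never exceeds `N`, so the inequality cannot hold
  -- at `fuel = 0`. The search ends with an element whose order is an exponent of the whole group.
  exponent-element : ∀ fuel {g m} → ¬ (g ≈ 0#) → .{{NonZero m}} → HasOrder g m → N ℕ.< m ℕ.+ fuel →
    ∃₂ λ g m → ¬ (g ≈ 0#) × NonZero m × HasOrder g m × (∀ i → unit i ^ m ≈ 1#)
  exponent-element zero {m = m} g≉0 ord N<m =
    contradiction (order≤N g≉0 ord) (ℕₚ.<⇒≱ (≡.subst (N ℕ.<_) (ℕₚ.+-identityʳ m) N<m))
  exponent-element (suc fuel) {g} {m} g≉0 ord N< with any? (λ i → ¬? ((unit i ^ m) ≟ 1#))
  ... | no none = g , m , g≉0 , ℕ.≢-nonZero (ℕ.≢-nonZero⁻¹ m) , ord , λ i → decidable-stable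
    ((unit i ^ m) ≟ 1#) λ ne → none (i , ne)
  ... | yes (i , u^m≉1) with increase-order g≉0 ord (unit-nonzero i) u^m≉1
  ...   | g′ , m′ , g′≉0 , m′≢0 , ord′ , m<m′ = exponent-element fuel g′≉0 {{m′≢0}} ord′
    (ℕₚ.<-≤-trans N< (≡.subst (ℕ._≤ m′ ℕ.+ fuel) (≡.sym (ℕₚ.+-suc m fuel)) (ℕₚ.+-monoˡ-≤ fuel m<m′)))

  record PrimitiveElement : Set (c ⊔ ℓ₁) where
    field
      g         : Carrier
      g≉0       : ¬ (g ≈ 0#)
      g-order   : HasOrder g N
      log       : ∀ {x} → ¬ (x ≈ 0#) → Fin N
      g^log     : ∀ {x} (x≉0 : ¬ (x ≈ 0#)) → g ^ toℕ (log x≉0) ≈ x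

  abstract
    primitiveElement : PrimitiveElement
    primitiveElement with exponent-element N {1#} {1} 1≉0
      (hasOrder (*-identityˡ 1#) (λ j _ → 1∣ j)) (ℕₚ.n<1+n N)
    ... | g , m , g≉0 , m≢0 , ord , exponent
      -- The powers of `g` are distinct units, so m ≤ N; all `N` units are roots of X^m - 1, so N ≤
      -- m.
      with ℕₚ.≤-antisym (order≤N g≉0 ord) (roots-of-unity≤ m {{m≢0}} unit unit-inj exponent)
    ... | ≡.refl = record
      { g       = g
      ; g≉0     = g≉0
      ; g-order = ord
      ; log     = λ x≉0 → proj₁ (surjective (index x≉0))
      ; g^log   = λ x≉0 → index-inj (^-nonzero g≉0 (toℕ (proj₁ (surjective (index x≉0))))) x≉0
        (proj₂ (surjective (index x≉0)))
      }
      where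
      surjective : ∀ i → ∃ λ (j : Fin N) → power-index g≉0 (toℕ j) ≡ i
      surjective = injective⇒surjective (power-index-injective g≉0 ord)

-- Characters as powers of a generator, and their orthogonality.

module CharacterProperties {c ℓ₁ ℓ₂ c′ ℓ₁′ ℓ₂′} (F : FiniteField c ℓ₁ ℓ₂)
  (K : CharZeroField c′ ℓ₁′ ℓ₂′) where
  module F where
    open FiniteField F public
    open FieldUnits F public
    private module R = CommutativeRing commutativeRing
    open import Algebra.Properties.Semiring.Exp R.semiring public
      using (^-congˡ; ^-homo-*; ^-assocʳ)
  module K where
    open CharZeroField K public
    open HeytingFieldProperties heytingField public
    open HeytingProperties heytingCommutativeRing public
    private module R = CommutativeRing commutativeRing
    open import Algebra.Properties.Semiring.Exp R.semiring public
      using (^-congˡ; ^-homo-*; ^-assocʳ)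
    open import Algebra.Properties.Semiring.Sum R.semiring public
      using (sum-cong-≋; sum-replicate; sum-replicate-zero; *-distribˡ-sum)
    open import Algebra.Properties.CommutativeSemiring.Exp R.commutativeSemiring public
      using (^-distrib-*)
    open Reindexing R.+-commutativeMonoid public
  open Characters F K public
  open F.PrimitiveElement F.primitiveElement public using (g; g≉0; g-order; log; g^log)
  open F.HasOrder
  open SetoidReasoning K.setoid

  N : ℕ
  N = F.N

  instance
    N≢0 : NonZero N
    N≢0 with N | F.index F.1≉0
    ... | suc _ | _ = _

  character-zero : ∀ A {x} → x F.≈ F.0# → ⟦ A ⟧ x K.≈ K.0#
  character-zero A x≈0 = K.trans (Character.⟦⟧-cong A x≈0) (Character.zero-homo A)

  character-^ : ∀ A x n → ⟦ A ⟧ (x F.^ n) K.≈ ⟦ A ⟧ x K.^ n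
  character-^ A x zero    = Character.ε-homo A
  character-^ A x (suc n) = K.trans (Character.homo A _ _) (K.*-congˡ (character-^ A x n))

  trivial-nonzero : ∀ {x} → ¬ (x F.≈ F.0#) → ⟦ trivial ⟧ x K.≈ K.1#
  trivial-nonzero {x} x≉0 with x F.≟ F.0#
  ... | yes x≈0 = contradiction x≈0 x≉0
  ... | no _    = K.refl

  power-value : ∀ A n {x} → ¬ (x F.≈ F.0#) → ⟦ A ^ᶻ (ℤ.+ n) ⟧ x K.≈ ⟦ A ⟧ x K.^ n
  power-value A zero    x≉0 = trivial-nonzero x≉0
  power-value A (suc n) x≉0 = K.*-congˡ (power-value A n x≉0)

  reduce-exponent : ∀ {z} → z K.^ N K.≈ K.1# → ∀ j → z K.^ j K.≈ z K.^ (j % N)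
  reduce-exponent {z} z^N≈1 j = begin
    z K.^ j                                          ≡⟨ ≡.cong (z K.^_) (m≡m%n+[m/n]*n j N) ⟩
    z K.^ (j % N ℕ.+ (j ℕ./ N) ℕ.* N)
      ≡⟨ ≡.cong (λ k → z K.^ (j % N ℕ.+ k)) (ℕₚ.*-comm (j ℕ./ N) N) ⟩
    z K.^ (j % N ℕ.+ N ℕ.* (j ℕ./ N))                ≈⟨ K.^-homo-* z (j % N) _ ⟩
    z K.^ (j % N) K.* z K.^ (N ℕ.* (j ℕ./ N))        ≈⟨ K.*-congˡ (K.^-multiple N z^N≈1 (j ℕ./ N)) ⟩
    z K.^ (j % N) K.* K.1#                           ≈⟨ K.*-identityʳ _ ⟩
    z K.^ (j % N)                                    ∎

  g^≉0 : ∀ i → ¬ (g F.^ i F.≈ F.0#)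
  g^≉0 = F.^-nonzero g≉0

  -- Equal powers of `g` have exponents that differ by a multiple of `N`. This makes the map g^i ↦
  -- z^i well defined.
  transfer-powers : ∀ {z} → z K.^ N K.≈ K.1# → ∀ i j → g F.^ i F.≈ g F.^ j → z K.^ i K.≈ z K.^ j
  transfer-powers {z} z^N≈1 i j eq =
    Sum.reduce (Sum.map (λ i≤j → K.sym (ordered i j i≤j eq)) (λ j≤i → ordered j i j≤i (F.sym eq))
      (ℕₚ.≤-total i j))
    where
    ordered : ∀ i j → i ℕ.≤ j → g F.^ i F.≈ g F.^ j → z K.^ j K.≈ z K.^ i
    ordered i j i≤j eq with j ℕ.∸ i | ℕₚ.m+[n∸m]≡n i≤j
    ... | d | ≡.refl with minimal g-order d (F.^-cancel g≉0 i d eq)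
    ... | divides k ≡.refl = begin
      z K.^ (i ℕ.+ k ℕ.* N)        ≡⟨ ≡.cong (λ e → z K.^ (i ℕ.+ e)) (ℕₚ.*-comm k N) ⟩
      z K.^ (i ℕ.+ N ℕ.* k)        ≈⟨ K.^-homo-* z i (N ℕ.* k) ⟩
      z K.^ i K.* z K.^ (N ℕ.* k)  ≈⟨ K.*-congˡ (K.^-multiple N z^N≈1 k) ⟩
      z K.^ i K.* K.1#             ≈⟨ K.*-identityʳ _ ⟩
      z K.^ i                      ∎

  determined-by-generator : ∀ A B → ⟦ A ⟧ g K.≈ ⟦ B ⟧ g → ∀ x → ⟦ A ⟧ x K.≈ ⟦ B ⟧ x
  determined-by-generator A B eq x with x F.≟ F.0#
  ... | yes x≈0 = K.trans (character-zero A x≈0) (K.sym (character-zero B x≈0))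
  ... | no x≉0  = begin
    ⟦ A ⟧ x          ≈⟨ Character.⟦⟧-cong A (g^log x≉0) ⟨
    ⟦ A ⟧ (g F.^ i)  ≈⟨ character-^ A g i ⟩
    ⟦ A ⟧ g K.^ i    ≈⟨ K.^-congˡ i eq ⟩
    ⟦ B ⟧ g K.^ i    ≈⟨ character-^ B g i ⟨
    ⟦ B ⟧ (g F.^ i)  ≈⟨ Character.⟦⟧-cong B (g^log x≉0) ⟩
    ⟦ B ⟧ x          ∎
    where i = toℕ (log x≉0)

  sum-over-units : ∀ f → (∀ {x y} → x F.≈ y → f x K.≈ f y) → f F.0# K.≈ K.0# →
    sumOver F.finite f K.≈ K.sumTo N (λ i → f (g F.^ i))
  sum-over-units f f-cong f0≈0 = begin
    sumOver F.finite f                       ≈⟨ K.sum-enumeration F.setoid F.finite e e-injective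
      e-onto f f-cong ⟩
    f F.0# K.+ K.sumTo N (λ i → f (g F.^ i)) ≈⟨ K.+-congʳ f0≈0 ⟩
    K.0# K.+ K.sumTo N (λ i → f (g F.^ i))   ≈⟨ K.+-identityˡ _ ⟩
    K.sumTo N (λ i → f (g F.^ i))            ∎
    where
    e : Fin (suc N) → F.Carrier
    e zero    = F.0#
    e (suc i) = g F.^ toℕ i
    e-injective : Injective _≡_ F._≈_ e
    e-injective {zero}  {zero}  eq = ≡.refl
    e-injective {zero}  {suc j} eq = contradiction (F.sym eq) (g^≉0 (toℕ j))
    e-injective {suc i} {zero}  eq = contradiction eq (g^≉0 (toℕ i))
    e-injective {suc i} {suc j} eq = ≡.cong suc (F.powers-injective g≉0 g-order eq)
    e-onto : ∀ x → ∃ λ i → e i F.≈ x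
    e-onto x with x F.≟ F.0#
    ... | yes x≈0 = zero , F.sym x≈0
    ... | no x≉0  = suc (log x≉0) , g^log x≉0

  -- The character taking `g` to `ζ`, through the discrete logarithm. By means of it the root of
  -- unity becomes a value of some power of `χ`.
  module FromRootOfUnity {ζ} (ζ^N≈1 : ζ K.^ N K.≈ K.1#) where

    value : ∀ {x} → Dec (x F.≈ F.0#) → K.Carrier
    value (yes _)  = K.0#
    value (no x≉0) = ζ K.^ toℕ (log x≉0)

    f : F.Carrier → K.Carrier
    f x = value (x F.≟ F.0#)

    f-zero : ∀ {x} → x F.≈ F.0# → f x K.≈ K.0#
    f-zero {x} x≈0 with x F.≟ F.0#
    ... | yes _  = K.refl
    ... | no x≉0 = contradiction x≈0 x≉0

    f-power : ∀ {x} i → g F.^ i F.≈ x → f x K.≈ ζ K.^ i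
    f-power {x} i eq with x F.≟ F.0#
    ... | yes x≈0 = contradiction (F.trans eq x≈0) (g^≉0 i)
    ... | no x≉0  = transfer-powers ζ^N≈1 (toℕ (log x≉0)) i (F.trans (g^log x≉0) (F.sym eq))

    f-cong : ∀ {x y} → x F.≈ y → f x K.≈ f y
    f-cong {x} {y} x≈y with x F.≟ F.0#
    ... | yes x≈0 = K.sym (f-zero (F.trans (F.sym x≈y) x≈0))
    ... | no x≉0  = K.sym (f-power (toℕ (log x≉0)) (F.trans (g^log x≉0) x≈y))

    f-homo : ∀ x y → f (x F.* y) K.≈ f x K.* f y
    f-homo x y with x F.≟ F.0# | y F.≟ F.0#
    ... | yes x≈0 | _       = K.trans (f-zero (F.trans (F.*-congʳ x≈0) (F.zeroˡ y))) (K.sym (K.zeroˡ _))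
    ... | no _    | yes y≈0 = K.trans (f-zero (F.trans (F.*-congˡ y≈0) (F.zeroʳ x))) (K.sym (K.zeroʳ _))
    ... | no x≉0  | no y≉0  = K.trans
      (f-power (i ℕ.+ j) (F.trans (F.^-homo-* g i j) (F.*-cong (g^log x≉0) (g^log y≉0))))
      (K.^-homo-* ζ i j)
      where
      i = toℕ (log x≉0)
      j = toℕ (log y≉0)

    character : Character
    character = mkCharacter f f-cong f-homo (f-power 0 F.refl) (f-zero F.refl)

    character-g : ⟦ character ⟧ g K.≈ ζ
    character-g = K.trans (f-power 1 (F.*-identityʳ g)) (K.*-identityʳ ζ)

  module Generator {ζ} (ζ-primitive : K.IsPrimitiveRoot N ζ) (chars : Finite characterSetoid)
                   (χ : Character) (generates : Generates χ) where

    η : K.Carrier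
    η = ⟦ χ ⟧ g

    χ-g^ : ∀ i → ⟦ χ ⟧ (g F.^ i) K.≈ η K.^ i
    χ-g^ = character-^ χ g

    character-g^N : ∀ A → ⟦ A ⟧ g K.^ N K.≈ K.1#
    character-g^N A = K.trans (K.sym (character-^ A g N))
      (K.trans (Character.⟦⟧-cong A (power≈1 g-order)) (Character.ε-homo A))

    η^N≈1 : η K.^ N K.≈ K.1#
    η^N≈1 = character-g^N χ

    character-power : ∀ A → ∃ λ k → ⟦ A ⟧ g K.≈ η K.^ k
    character-power A with generates A
    ... | ℤ.+ k , eq      = k , K.trans (eq g) (power-value χ k g≉0)
    -- The inverse of `g` is g^(N-1), which turns a negative power of `χ` into a natural power of
    -- `η`.
    ... | ℤ.-[1+ k ] , eq = ℕ.pred N ℕ.* suc k , (begin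
      ⟦ A ⟧ g                            ≈⟨ eq g ⟩
      ⟦ χ ^ᶻ (ℤ.+ suc k) ⟧ (F.inv g)       ≈⟨ Character.⟦⟧-cong (χ ^ᶻ (ℤ.+ suc k))
        (F.inv-unique g*g^pred) ⟩
      ⟦ χ ^ᶻ (ℤ.+ suc k) ⟧ (g F.^ ℕ.pred N) ≈⟨ power-value χ (suc k) (g^≉0 (ℕ.pred N)) ⟩
      ⟦ χ ⟧ (g F.^ ℕ.pred N) K.^ suc k   ≈⟨ K.^-congˡ (suc k) (χ-g^ (ℕ.pred N)) ⟩
      (η K.^ ℕ.pred N) K.^ suc k         ≈⟨ K.^-assocʳ η (ℕ.pred N) (suc k) ⟩
      η K.^ (ℕ.pred N ℕ.* suc k)         ∎)
      where
      g*g^pred : g F.* g F.^ ℕ.pred N F.≈ F.1#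
      g*g^pred = F.trans (F.reflexive (≡.cong (g F.^_) (ℕₚ.suc-pred N))) (power≈1 g-order)

    -- The character with value `ζ` at `g` is a power of `χ`, so ζ = η^k for some k. Then (η^j)^k =
    -- ζ^j is apart from 1, and therefore η^j is.
    η-primitive : ∀ j → ¬ N ∣ j → η K.^ j K.# K.1#
    η-primitive j N∤j = K.^-#1 k (K.#-congʳ ζ^j%N≈ (proj₂ ζ-primitive (j % N) 0<j%N (m%n<n j N)))
      where
      module ψ = FromRootOfUnity {ζ} (proj₁ ζ-primitive)
      k = proj₁ (character-power ψ.character)
      0<j%N : 0 ℕ.< j % N
      0<j%N = ℕₚ.n≢0⇒n>0 λ j%N≡0 → N∤j (m%n≡0⇒n∣m j N j%N≡0)
      ζ^j%N≈ : ζ K.^ (j % N) K.≈ (η K.^ j) K.^ k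
      ζ^j%N≈ = begin
        ζ K.^ (j % N)       ≈⟨ reduce-exponent (proj₁ ζ-primitive) j ⟨
        ζ K.^ j             ≈⟨ K.^-congˡ j (K.trans (K.sym ψ.character-g)
          (proj₂ (character-power ψ.character))) ⟩
        (η K.^ k) K.^ j     ≈⟨ K.^-comm η k j ⟩
        (η K.^ j) K.^ k     ∎

    η^-unit : ∀ i → ∃ λ v → η K.^ i K.* v K.≈ K.1#
    η^-unit i = (η K.^ ℕ.pred N) K.^ i , K.trans (K.sym (K.^-distrib-* η (η K.^ ℕ.pred N) i))
      (K.trans (K.^-congˡ i η·) (K.1^n≈1 i))
      where
      η· : η K.* η K.^ ℕ.pred N K.≈ K.1#
      η· = K.trans (K.reflexive (≡.cong (η K.^_) (ℕₚ.suc-pred N))) η^N≈1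

    η^-injective : Injective _≡_ K._≈_ (λ (i : Fin N) → η K.^ toℕ i)
    η^-injective {i} {j} eq = toℕ-injective toℕ-eq
      where
      not-less : ∀ {i j} → j ℕ.< N → i ℕ.< j → ¬ (η K.^ i K.≈ η K.^ j)
      not-less {i} {j} j<N i<j eq = K.#-irrefl η^d≈1 (η-primitive (j ℕ.∸ i) λ N∣ →
        ℕₚ.<⇒≱ (ℕₚ.≤-<-trans (ℕₚ.m∸n≤m j i) j<N) (∣⇒≤ {{ℕ.>-nonZero (ℕₚ.m<n⇒0<n∸m i<j)}} N∣))
        where
        η^d≈1 : η K.^ (j ℕ.∸ i) K.≈ K.1#
        η^d≈1 = K.unit-cancel (η^-unit i) (begin
          η K.^ i K.* η K.^ (j ℕ.∸ i)  ≈⟨ K.^-homo-* η i (j ℕ.∸ i) ⟨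
          η K.^ (i ℕ.+ (j ℕ.∸ i))      ≡⟨ ≡.cong (η K.^_) (ℕₚ.m+[n∸m]≡n (ℕₚ.<⇒≤ i<j)) ⟩
          η K.^ j                      ≈⟨ eq ⟨
          η K.^ i                      ≈⟨ K.*-identityʳ _ ⟨
          η K.^ i K.* K.1#             ∎)
      toℕ-eq : toℕ i ≡ toℕ j
      toℕ-eq with ℕₚ.<-cmp (toℕ i) (toℕ j)
      ... | tri< i<j _ _ = contradiction eq (not-less (toℕ<n j) i<j)
      ... | tri≈ _ i≡j _ = i≡j
      ... | tri> _ _ j<i = contradiction (K.sym eq) (not-less (toℕ<n i) j<i)

    -- A character is determined by its value at `g`, which is a power of `η`; hence χ^0, ...,
    -- χ^(N-1) list every character once, whatever enumeration `chars` uses.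
    sum-over-characters : ∀ f → (∀ {A B} → (∀ x → ⟦ A ⟧ x K.≈ ⟦ B ⟧ x) → f A K.≈ f B) →
      sumOver chars f K.≈ K.sumTo N (λ k → f (χ ^ᶻ (ℤ.+ k)))
    sum-over-characters f f-cong = K.sum-enumeration characterSetoid chars (λ k → χ ^ᶻ (ℤ.+ toℕ k))
      (λ {i} {j} eq → η^-injective (K.trans (K.sym (power-value χ (toℕ i) g≉0))
        (K.trans (eq g) (power-value χ (toℕ j) g≉0))))
      onto f f-cong
      where
      onto : ∀ A → ∃ λ (i : Fin N) → ∀ x → ⟦ χ ^ᶻ (ℤ.+ toℕ i) ⟧ x K.≈ ⟦ A ⟧ x
      onto A with character-power A
      ... | k , eq = fromℕ< (m%n<n k N) , determined-by-generator
        (χ ^ᶻ (ℤ.+ toℕ (fromℕ< (m%n<n k N)))) A (begin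
        ⟦ χ ^ᶻ (ℤ.+ toℕ (fromℕ< (m%n<n k N))) ⟧ g  ≈⟨ power-value χ (toℕ (fromℕ< (m%n<n k N))) g≉0 ⟩
        η K.^ toℕ (fromℕ< (m%n<n k N))           ≡⟨ ≡.cong (η K.^_) (toℕ-fromℕ< (m%n<n k N)) ⟩
        η K.^ (k % N)                            ≈⟨ reduce-exponent η^N≈1 k ⟨
        η K.^ k                                  ≈⟨ eq ⟨
        ⟦ A ⟧ g                                  ∎)

    character-sum : F.Carrier → K.Carrier
    character-sum x = sumOver chars λ ψ → ⟦ ψ ⟧ x

    character-sum-cong : ∀ {x y} → x F.≈ y → character-sum x K.≈ character-sum y
    character-sum-cong x≈y = K.sum-cong-≋ λ i → Character.⟦⟧-cong (Finite.to chars i) x≈y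

    character-sum-powers : ∀ {x} → ¬ (x F.≈ F.0#) → character-sum x K.≈ K.sumTo N (⟦ χ ⟧ x K.^_)
    character-sum-powers {x} x≉0 = K.trans (sum-over-characters (λ ψ → ⟦ ψ ⟧ x) (λ eq → eq x))
      (K.sumTo-cong N λ k → power-value χ k x≉0)

    character-sum-one : character-sum F.1# K.≈ K.fromℕ N
    character-sum-one = K.trans (character-sum-powers F.1≉0)
      (K.trans (K.sumTo-cong N λ k → K.trans (K.^-congˡ k (Character.ε-homo χ)) (K.1^n≈1 k))
        (K.sum-replicate N {K.1#}))

    character-sum-other : ∀ {x} → ¬ (x F.≈ F.1#) → character-sum x K.≈ K.0#
    character-sum-other {x} x≉1 with x F.≟ F.0#
    -- At zero all characters vanish, the trivial one included, so no geometric sum arises.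
    ... | yes x≈0 = K.trans (sum-over-characters (λ ψ → ⟦ ψ ⟧ x) (λ eq → eq x))
      (K.trans (K.sumTo-cong N λ k → character-zero (χ ^ᶻ (ℤ.+ k)) x≈0) (K.sum-replicate-zero N))
    ... | no x≉0  = K.trans (character-sum-powers x≉0)
      (K.geometric-sum-root-of-unity N (K.#-congʳ (K.sym χx≈) (η-primitive i N∤i))
        (K.trans (K.^-congˡ N χx≈) (K.trans (K.^-comm η i N)
          (K.trans (K.^-congˡ i η^N≈1) (K.1^n≈1 i)))))
      where
      i = toℕ (log x≉0)
      χx≈ : ⟦ χ ⟧ x K.≈ η K.^ i
      χx≈ = K.trans (Character.⟦⟧-cong χ (F.sym (g^log x≉0))) (χ-g^ i)
      N∤i : ¬ N ∣ i
      N∤i N∣i with i in i≡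
      ... | zero  = x≉1 (F.trans (F.sym (g^log x≉0)) (F.reflexive (≡.cong (g F.^_) i≡)))
      ... | suc _ = ℕₚ.<⇒≱ (≡.subst (ℕ._< N) i≡ (toℕ<n (log x≉0))) (∣⇒≤ N∣i)

-- The hypergeometric function at -1.

module Hypergeometric {c ℓ₁ ℓ₂ c′ ℓ₁′ ℓ₂′} (F : FiniteField c ℓ₁ ℓ₂)
  (K : CharZeroField c′ ℓ₁′ ℓ₂′) where
  open CharacterProperties F K

  private
    module RF = CommutativeRing F.commutativeRing
    module RK = CommutativeRing K.commutativeRing
  open import Algebra.Properties.AbelianGroup RF.+-abelianGroup using (xyx⁻¹≈y)
  open import Algebra.Properties.Ring RF.ring using (-‿distribˡ-*; -‿distribʳ-*; -‿involutive)
  open import Algebra.Properties.Semiring.Sum RK.semiring using (∑-comm; *-distribʳ-sum)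
  open import Algebra.Solver.Ring.NaturalCoefficients.Default RK.commutativeSemiring
    using (solve; _:*_; _:=_)

  module _ where
    open SetoidReasoning F.setoid

    inv-involutive : ∀ x → F.inv (F.inv x) F.≈ x
    inv-involutive x with x F.≟ F.0#
    ... | yes x≈0 = F.trans (F.inv-zero (F.inv-zero x≈0)) (F.sym x≈0)
    ... | no x≉0  = F.inv-unique (F.trans (F.*-comm _ _) (F.inv-nonzero x≉0))

    x-[x-y]≈y : ∀ x y → x F.- (x F.- y) F.≈ y
    x-[x-y]≈y x y = begin
      x F.- (x F.- y)                    ≈⟨ F.+-congʳ (F.trans (F.+-comm _ _) (F.y+[x-y]≈x x y)) ⟨
      (x F.- y) F.+ y F.- (x F.- y)      ≈⟨ xyx⁻¹≈y (x F.- y) y ⟩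
      y                                  ∎

    1-inv≈ : ∀ {s} → ¬ (F.1# F.+ s F.≈ F.0#) → F.1# F.- F.inv (F.1# F.+ s) F.≈ s F.* F.inv (F.1# F.+ s)
    1-inv≈ {s} 1+s≉0 = begin
      F.1# F.- i                     ≈⟨ F.+-congʳ (F.inv-nonzero 1+s≉0) ⟨
      (F.1# F.+ s) F.* i F.- i       ≈⟨ F.+-congʳ (F.trans (F.distribʳ _ _ _)
        (F.+-congʳ (F.*-identityˡ i))) ⟩
      i F.+ s F.* i F.- i            ≈⟨ xyx⁻¹≈y i (s F.* i) ⟩
      s F.* i                        ∎
      where i = F.inv (F.1# F.+ s)

    -- This is the argument of `U` at the one point that will matter, s = -1/t: there (1 + s)/s = 1
    -- - t.
    inverse-neg-inverse : ∀ {t} → ¬ (t F.≈ F.0#) →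
      F.inv (F.- F.inv t) F.* (F.1# F.+ F.- F.inv t) F.≈ F.1# F.- t
    inverse-neg-inverse {t} t≉0 = begin
      F.inv (F.- F.inv t) F.* (F.1# F.+ F.- F.inv t)  ≈⟨ F.*-congʳ (F.inv-unique -inv*-t) ⟩
      F.- t F.* (F.1# F.+ F.- F.inv t)                ≈⟨ F.distribˡ _ _ _ ⟩
      F.- t F.* F.1# F.+ F.- t F.* F.- F.inv t        ≈⟨ F.+-cong (F.*-identityʳ _) -t*-inv ⟩
      F.- t F.+ F.1#                                  ≈⟨ F.+-comm _ _ ⟩
      F.1# F.- t                                      ∎
      where
      -t*-inv : F.- t F.* F.- F.inv t F.≈ F.1#
      -t*-inv = begin
        F.- t F.* F.- F.inv t        ≈⟨ -‿distribˡ-* _ _ ⟨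
        F.- (t F.* F.- F.inv t)      ≈⟨ F.-‿cong (-‿distribʳ-* _ _) ⟨
        F.- F.- (t F.* F.inv t)      ≈⟨ -‿involutive _ ⟩
        t F.* F.inv t                ≈⟨ F.inv-nonzero t≉0 ⟩
        F.1#                         ∎
      -inv*-t : F.- F.inv t F.* F.- t F.≈ F.1#
      -inv*-t = F.trans (F.*-comm _ _) -t*-inv

  open SetoidReasoning K.setoid

  ΣF : (F.Carrier → K.Carrier) → K.Carrier
  ΣF = sumOver F.finite

  ΣF-cong : ∀ {f h} → (∀ x → f x K.≈ h x) → ΣF f K.≈ ΣF h
  ΣF-cong f≈h = K.sum-cong-≋ λ i → f≈h (F.to i)

  cancel-inverse : ∀ A {s u} → ¬ (u F.≈ F.0#) →
    ⟦ A ⟧ (s F.* F.inv u) K.* ⟦ A ⟧ u K.≈ ⟦ A ⟧ s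
  cancel-inverse A {s} {u} u≉0 = K.trans (K.sym (Character.homo A _ _)) (Character.⟦⟧-cong A
    (F.trans (F.*-assoc _ _ _) (F.trans (F.*-congˡ (F.trans (F.*-comm _ _) (F.inv-nonzero u≉0)))
      (F.*-identityʳ s))))

  -- The substitution x = 1 - 1/(1 + s), that is s = x/(1 - x). With inv 0 = 0 it
  -- is a bijection of the whole field, and the terms x = 1 and s = -1 correspond.
  jacobi-substitution : ∀ A C →
    jacobi A (C ⁻) K.≈ ΣF λ s → ⟦ A ⟧ (s F.* F.inv (F.1# F.+ s)) K.* ⟦ C ⟧ (F.1# F.+ s)
  jacobi-substitution A C = K.trans
    (K.sum-bijection F.setoid F.finite σ τ τ-cong τσ στ f f-cong σ-cong)
    (ΣF-cong summand)
    where
    f : F.Carrier → K.Carrier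
    f x = ⟦ A ⟧ x K.* ⟦ C ⟧ (F.inv (F.1# F.- x))
    f-cong : ∀ {x y} → x F.≈ y → f x K.≈ f y
    f-cong eq = K.*-cong (Character.⟦⟧-cong A eq)
      (Character.⟦⟧-cong C (F.inv-cong (F.+-congˡ (F.-‿cong eq))))
    σ τ : F.Carrier → F.Carrier
    σ s = F.1# F.- F.inv (F.1# F.+ s)
    τ x = F.inv (F.1# F.- x) F.- F.1#
    σ-cong : ∀ {x y} → x F.≈ y → σ x F.≈ σ y
    σ-cong eq = F.+-congˡ (F.-‿cong (F.inv-cong (F.+-congˡ eq)))
    τ-cong : ∀ {x y} → x F.≈ y → τ x F.≈ τ y
    τ-cong eq = F.+-congʳ (F.inv-cong (F.+-congˡ (F.-‿cong eq)))
    inv[1-σ]≈ : ∀ s → F.inv (F.1# F.- σ s) F.≈ F.1# F.+ s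
    inv[1-σ]≈ s = F.trans (F.inv-cong (x-[x-y]≈y _ _)) (inv-involutive _)
    τσ : ∀ s → τ (σ s) F.≈ s
    τσ s = F.trans (F.+-congʳ (inv[1-σ]≈ s)) (xyx⁻¹≈y F.1# s)
    στ : ∀ x → σ (τ x) F.≈ x
    στ x = F.trans (F.+-congˡ (F.-‿cong (F.trans (F.inv-cong (F.y+[x-y]≈x _ _)) (inv-involutive _))))
      (x-[x-y]≈y _ _)
    summand : ∀ s → f (σ s) K.≈ ⟦ A ⟧ (s F.* F.inv (F.1# F.+ s)) K.* ⟦ C ⟧ (F.1# F.+ s)
    summand s with (F.1# F.+ s) F.≟ F.0#
    ... | no 1+s≉0 = K.*-cong (Character.⟦⟧-cong A (1-inv≈ 1+s≉0)) (Character.⟦⟧-cong C (inv[1-σ]≈ s))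
    ... | yes 1+s≈0 = K.trans
      (K.*-congˡ (character-zero C (F.trans (inv[1-σ]≈ s) 1+s≈0)))
      (K.trans (K.zeroʳ _) (K.sym (K.trans (K.*-congˡ (character-zero C 1+s≈0)) (K.zeroʳ _))))

  -- The factor ψ(1 + s) completes ψ(s/(1 + s)) to ψ(s), and the inverse of `P` turns the fraction
  -- over. At s = -1 both summands are zero.
  jacobi-first : ∀ P ψ → jacobi (P ⁻ · ψ) (ψ ⁻) K.≈
    ΣF λ s → ⟦ P ⟧ (F.inv s F.* (F.1# F.+ s)) K.* ⟦ ψ ⟧ s
  jacobi-first P ψ = K.trans (jacobi-substitution (P ⁻ · ψ) ψ) (ΣF-cong summand)
    where
    summand : ∀ s → ⟦ P ⁻ · ψ ⟧ (s F.* F.inv (F.1# F.+ s)) K.* ⟦ ψ ⟧ (F.1# F.+ s) K.≈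
                    ⟦ P ⟧ (F.inv s F.* (F.1# F.+ s)) K.* ⟦ ψ ⟧ s
    summand s with (F.1# F.+ s) F.≟ F.0#
    ... | no 1+s≉0 = K.trans (K.*-assoc _ _ _) (K.*-cong
      (Character.⟦⟧-cong P (F.trans (F.inv-* _ _) (F.*-congˡ (inv-involutive _))))
      (cancel-inverse ψ 1+s≉0))
    ... | yes 1+s≈0 = K.trans (K.*-congˡ (character-zero ψ 1+s≈0)) (K.trans (K.zeroʳ _) (K.sym (K.trans
      (K.*-congʳ (character-zero P (F.trans (F.*-congˡ 1+s≈0) (F.zeroʳ _)))) (K.zeroˡ _))))

  -- `Q` and `ψ` at 1 + t complete the fractions to `t`, and the excess factor of `C` is P(1 + t).
  -- `C` is kept apart from `Q · P` because a power of `χ` with a sum as exponent agrees with the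
  -- product of powers only pointwise.
  jacobi-second : ∀ P Q C ψ → (∀ x → ⟦ C ⟧ x K.≈ ⟦ Q · P ⟧ x) →
    jacobi (Q · ψ) ((C · ψ) ⁻) K.≈ ΣF λ t → ⟦ Q ⟧ t K.* ⟦ P ⟧ (F.1# F.+ t) K.* ⟦ ψ ⟧ t
  jacobi-second P Q C ψ C≈QP = K.trans (jacobi-substitution (Q · ψ) (C · ψ)) (ΣF-cong summand)
    where
    summand : ∀ t → ⟦ Q · ψ ⟧ (t F.* F.inv (F.1# F.+ t)) K.* ⟦ C · ψ ⟧ (F.1# F.+ t) K.≈
                    ⟦ Q ⟧ t K.* ⟦ P ⟧ (F.1# F.+ t) K.* ⟦ ψ ⟧ t
    summand t with (F.1# F.+ t) F.≟ F.0#
    ... | no 1+t≉0 = begin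
      Q₁ K.* ψ₁ K.* (⟦ C ⟧ u K.* ⟦ ψ ⟧ u)
        ≈⟨ K.*-congˡ (K.*-congʳ (C≈QP u)) ⟩
      Q₁ K.* ψ₁ K.* (⟦ Q ⟧ u K.* ⟦ P ⟧ u K.* ⟦ ψ ⟧ u)
        ≈⟨ solve 5 (λ a b q p c → a :* b :* (q :* p :* c) := a :* q :* p :* (b :* c)) K.refl
             Q₁ ψ₁ (⟦ Q ⟧ u) (⟦ P ⟧ u) (⟦ ψ ⟧ u) ⟩
      Q₁ K.* ⟦ Q ⟧ u K.* ⟦ P ⟧ u K.* (ψ₁ K.* ⟦ ψ ⟧ u)
        ≈⟨ K.*-cong (K.*-congʳ (cancel-inverse Q 1+t≉0)) (cancel-inverse ψ 1+t≉0) ⟩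
      ⟦ Q ⟧ t K.* ⟦ P ⟧ u K.* ⟦ ψ ⟧ t ∎
      where
      u  = F.1# F.+ t
      Q₁ = ⟦ Q ⟧ (t F.* F.inv u)
      ψ₁ = ⟦ ψ ⟧ (t F.* F.inv u)
    ... | yes 1+t≈0 = K.trans (K.*-congˡ (character-zero (C · ψ) 1+t≈0)) (K.trans (K.zeroʳ _) (K.sym
      (K.trans (K.*-congʳ (K.trans (K.*-congˡ (character-zero P 1+t≈0)) (K.zeroʳ _))) (K.zeroˡ _))))

  1/-inverse : ∀ n .{{_ : NonZero n}} → K.fromℕ n K.* K.1/ n K.≈ K.1#
  1/-inverse (suc n) with K.#⇒invertible (K.charZero n)
  ... | y , _ , eq = K.trans (K.*-congʳ (K.sym (K.x-0≈x _))) eq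

  instance
    q≢0 : NonZero q
    q≢0 = ℕ.>-nonZero (ℕₚ.<-≤-trans (ℕ.>-nonZero⁻¹ N) (ℕₚ.m∸n≤m q 1))

  module _ {ζ} (ζ-primitive : K.IsPrimitiveRoot N ζ) (chars : Finite characterSetoid)
           (χ : Character) (generates : Generates χ) where
    open Generator ζ-primitive chars χ generates

    private
      Σχ : (Character → K.Carrier) → K.Carrier
      Σχ = sumOver chars

    module _ (P Q C : Character) (C≈QP : ∀ x → ⟦ C ⟧ x K.≈ ⟦ Q · P ⟧ x) where

      private
        -1F : F.Carrier
        -1F = F.- F.1#

        -- `U` and `V` are the coefficients of ψ(s) and ψ(t) in the two Jacobi sums; for nonzero t,
        -- `W` is their product at s = -1/t.
        U V W : F.Carrier → K.Carrier
        U s = ⟦ P ⟧ (F.inv s F.* (F.1# F.+ s))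
        V t = ⟦ Q ⟧ t K.* ⟦ P ⟧ (F.1# F.+ t)
        W t = ⟦ Q ⟧ t K.* ⟦ P ⟧ ((F.1# F.+ t) F.* (F.1# F.- t))

        ι : K.Carrier
        ι = K.1/ q

      U-cong : ∀ {s s′} → s F.≈ s′ → U s K.≈ U s′
      U-cong eq = Character.⟦⟧-cong P (F.*-cong (F.inv-cong eq) (F.+-congˡ eq))

      -- Only s = -1/t contributes.
      inner-sum : ∀ t → ΣF (λ s → U s K.* V t K.* character-sum (F.- (s F.* t))) K.≈ K.fromℕ N K.* W t
      inner-sum t with t F.≟ F.0#
      ... | yes t≈0 = K.trans
        (K.trans (ΣF-cong vanishes)
          (K.sum-replicate-zero q))
        (K.sym (K.trans (K.*-congˡ (K.trans (K.*-congʳ Qt≈0) (K.zeroˡ _))) (K.zeroʳ _)))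
        where
        Qt≈0 : ⟦ Q ⟧ t K.≈ K.0#
        Qt≈0 = character-zero Q t≈0
        Vt≈0 : V t K.≈ K.0#
        Vt≈0 = K.trans (K.*-congʳ Qt≈0) (K.zeroˡ _)
        vanishes : ∀ s → U s K.* V t K.* character-sum (F.- (s F.* t)) K.≈ K.0#
        vanishes s = K.trans (K.*-congʳ (K.trans (K.*-congˡ Vt≈0) (K.zeroʳ _))) (K.zeroˡ _)
      ... | no t≉0 = begin
        ΣF (λ s → U s K.* V t K.* character-sum (F.- (s F.* t)))
          ≈⟨ K.sum-single F.setoid F.finite s₀ (λ s → U s K.* V t K.* character-sum (F.- (s F.* t)))
               (λ eq → K.*-cong (K.*-congʳ (U-cong eq)) (character-sum-cong (F.-‿cong (F.*-congʳ eq))))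
               (λ s s≉ → K.trans (K.*-congˡ (character-sum-other λ eq → s≉ (solve-s eq))) (K.zeroʳ _)) ⟩
        U s₀ K.* V t K.* character-sum (F.- (s₀ F.* t))
          ≈⟨ K.*-cong (K.*-congʳ (Character.⟦⟧-cong P (inverse-neg-inverse t≉0)))
               (K.trans (character-sum-cong -s₀t≈1) character-sum-one) ⟩
        ⟦ P ⟧ (F.1# F.- t) K.* V t K.* K.fromℕ N
          ≈⟨ solve 4 (λ a q b n → a :* (q :* b) :* n := n :* (q :* (b :* a))) K.refl
               (⟦ P ⟧ (F.1# F.- t)) (⟦ Q ⟧ t) (⟦ P ⟧ (F.1# F.+ t)) (K.fromℕ N) ⟩
        K.fromℕ N K.* (⟦ Q ⟧ t K.* (⟦ P ⟧ (F.1# F.+ t) K.* ⟦ P ⟧ (F.1# F.- t)))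
          ≈⟨ K.*-congˡ (K.*-congˡ (Character.homo P _ _)) ⟨
        K.fromℕ N K.* W t ∎
        where
        s₀ = F.- F.inv t
        -s₀t≈1 : F.- (s₀ F.* t) F.≈ F.1#
        -s₀t≈1 = F.trans (F.-‿cong (F.sym (-‿distribˡ-* _ _))) (F.trans (-‿involutive _)
          (F.trans (F.*-comm _ _) (F.inv-nonzero t≉0)))
        solve-s : ∀ {s} → F.- (s F.* t) F.≈ F.1# → s F.≈ s₀
        solve-s {s} eq = F.trans (F.sym (-‿involutive s)) (F.-‿cong (F.sym (F.inv-unique
          (F.trans (F.*-comm _ _) (F.trans (F.sym (-‿distribˡ-* s t)) eq)))))

      -- ψ(-1) occurs three times: once in each binomial coefficient and once from the argument -1.
      -- Its square is 1, so a single copy remains and goes into ψ(-st).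
      term-expansion : ∀ ψ →
        binomial (P ⁻ · ψ) ψ K.* binomial (Q · ψ) (C · ψ) K.* ⟦ ψ ⟧ -1F K.≈
        ι K.* ι K.* ⟦ C ⟧ -1F K.* ΣF λ t → ΣF λ s → U s K.* V t K.* ⟦ ψ ⟧ (F.- (s F.* t))
      term-expansion ψ = begin
        ε K.* ι K.* J₁ K.* (⟦ C ⟧ -1F K.* ε K.* ι K.* J₂) K.* ε
          ≈⟨ solve 5 (λ ε ι j k c → ε :* ι :* j :* (c :* ε :* ι :* k) :* ε := ι :* ι :* c :*
            ((ε :* ε) :* ε :* (j :* k)))
               K.refl ε ι J₁ J₂ (⟦ C ⟧ -1F) ⟩
        κ K.* (ε K.* ε K.* ε K.* (J₁ K.* J₂))
          ≈⟨ K.*-congˡ (K.*-cong (K.trans (K.*-congʳ εε≈1) (K.*-identityˡ ε))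
            (K.*-cong (jacobi-first P ψ) (jacobi-second P Q C ψ C≈QP))) ⟩
        κ K.* (ε K.* (ΣF (λ s → U s K.* ⟦ ψ ⟧ s) K.* ΣF (λ t → V t K.* ⟦ ψ ⟧ t)))
          ≈⟨ K.*-congˡ (K.*-congˡ (K.*-distribˡ-sum _ (λ i → V (F.to i) K.* ⟦ ψ ⟧ (F.to i)))) ⟩
        κ K.* (ε K.* ΣF (λ t → ΣF (λ s → U s K.* ⟦ ψ ⟧ s) K.* (V t K.* ⟦ ψ ⟧ t)))
          ≈⟨ K.*-congˡ (K.*-distribˡ-sum ε (λ i → ΣF (λ s → U s K.* ⟦ ψ ⟧ s) K.*
            (V (F.to i) K.* ⟦ ψ ⟧ (F.to i)))) ⟩
        κ K.* ΣF (λ t → ε K.* (ΣF (λ s → U s K.* ⟦ ψ ⟧ s) K.* (V t K.* ⟦ ψ ⟧ t)))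
          ≈⟨ K.*-congˡ (ΣF-cong λ t → K.trans (K.*-congˡ
            (*-distribʳ-sum _ (λ i → U (F.to i) K.* ⟦ ψ ⟧ (F.to i))))
               (K.trans (K.*-distribˡ-sum ε (λ i → U (F.to i) K.* ⟦ ψ ⟧ (F.to i) K.*
                 (V t K.* ⟦ ψ ⟧ t))) (ΣF-cong λ s → pair s t))) ⟩
        κ K.* ΣF (λ t → ΣF λ s → U s K.* V t K.* ⟦ ψ ⟧ (F.- (s F.* t))) ∎
        where
        ε  = ⟦ ψ ⟧ -1F
        J₁ = jacobi (P ⁻ · ψ) (ψ ⁻)
        J₂ = jacobi (Q · ψ) ((C · ψ) ⁻)
        κ  = ι K.* ι K.* ⟦ C ⟧ -1F
        -1*x : ∀ x → -1F F.* x F.≈ F.- x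
        -1*x x = F.trans (F.sym (-‿distribˡ-* F.1# x)) (F.-‿cong (F.*-identityˡ x))
        εε≈1 : ε K.* ε K.≈ K.1#
        εε≈1 = K.trans (K.sym (Character.homo ψ _ _)) (K.trans
          (Character.⟦⟧-cong ψ (F.trans (-1*x _) (-‿involutive F.1#))) (Character.ε-homo ψ))
        pair : ∀ s t → ε K.* (U s K.* ⟦ ψ ⟧ s K.* (V t K.* ⟦ ψ ⟧ t)) K.≈ U s K.* V t K.* ⟦ ψ ⟧
          (F.- (s F.* t))
        pair s t = begin
          ε K.* (U s K.* ⟦ ψ ⟧ s K.* (V t K.* ⟦ ψ ⟧ t))
            ≈⟨ solve 5 (λ e u a v b → e :* (u :* a :* (v :* b)) := u :* v :* (e :* (a :* b))) K.refl
                 ε (U s) (⟦ ψ ⟧ s) (V t) (⟦ ψ ⟧ t) ⟩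
          U s K.* V t K.* (ε K.* (⟦ ψ ⟧ s K.* ⟦ ψ ⟧ t))
            ≈⟨ K.*-congˡ (K.*-congˡ (Character.homo ψ s t)) ⟨
          U s K.* V t K.* (ε K.* ⟦ ψ ⟧ (s F.* t))
            ≈⟨ K.*-congˡ (Character.homo ψ _ _) ⟨
          U s K.* V t K.* ⟦ ψ ⟧ (-1F F.* (s F.* t))
            ≈⟨ K.*-congˡ (Character.⟦⟧-cong ψ (-1*x _)) ⟩
          U s K.* V t K.* ⟦ ψ ⟧ (F.- (s F.* t)) ∎

      -- With the sum over ψ innermost, the result is `N` on s t = -1 and zero elsewhere. This `N`
      -- cancels the denominator of q/(q - 1), and `q` cancels one of the two factors 1/q from the
      -- binomial coefficients.
      ₂F₁-evaluation : ₂F₁ chars (P ⁻) Q C -1F K.≈ ι K.* ⟦ C ⟧ -1F K.* ΣF W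
      ₂F₁-evaluation = begin
        K.fromℕ q K.* ν K.* Σχ (λ ψ → binomial (P ⁻ · ψ) ψ K.* binomial (Q · ψ) (C · ψ) K.* ⟦ ψ ⟧ -1F)
          ≈⟨ K.*-congˡ (K.sum-cong-≋ λ i → term-expansion (Finite.to chars i)) ⟩
        K.fromℕ q K.* ν K.* Σχ (λ ψ → κ K.* ΣF λ t → ΣF λ s → U s K.* V t K.* ⟦ ψ ⟧ (F.- (s F.* t)))
          ≈⟨ K.*-congˡ (K.*-distribˡ-sum κ (λ i → ΣF λ t → ΣF λ s →
            U s K.* V t K.* ⟦ Finite.to chars i ⟧ (F.- (s F.* t)))) ⟨
        K.fromℕ q K.* ν K.* (κ K.* Σχ (λ ψ → ΣF λ t → ΣF λ s → U s K.* V t K.* ⟦ ψ ⟧ (F.- (s F.* t))))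
          ≈⟨ K.*-congˡ (K.*-congˡ sum-over-all) ⟩
        K.fromℕ q K.* ν K.* (κ K.* (K.fromℕ N K.* ΣF W))
          ≈⟨ solve 6 (λ q ν ι c n w → q :* ν :* (ι :* ι :* c :* (n :* w)) := (q :* ι) :*
            (n :* ν) :* (ι :* c :* w)) K.refl
               (K.fromℕ q) ν ι (⟦ C ⟧ -1F) (K.fromℕ N) (ΣF W) ⟩
        K.fromℕ q K.* ι K.* (K.fromℕ N K.* ν) K.* (ι K.* ⟦ C ⟧ -1F K.* ΣF W)
          ≈⟨ K.*-congʳ (K.trans (K.*-cong (1/-inverse q) (1/-inverse N)) (K.*-identityˡ _)) ⟩
        K.1# K.* (ι K.* ⟦ C ⟧ -1F K.* ΣF W)
          ≈⟨ K.*-identityˡ _ ⟩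
        ι K.* ⟦ C ⟧ -1F K.* ΣF W ∎
        where
        ν = K.1/ N
        κ = ι K.* ι K.* ⟦ C ⟧ -1F
        sum-over-all : Σχ (λ ψ → ΣF λ t → ΣF λ s → U s K.* V t K.* ⟦ ψ ⟧ (F.- (s F.* t))) K.≈
          K.fromℕ N K.* ΣF W
        sum-over-all = begin
          Σχ (λ ψ → ΣF λ t → ΣF λ s → U s K.* V t K.* ⟦ ψ ⟧ (F.- (s F.* t)))
            ≈⟨ ∑-comm (λ i j → ΣF λ s → U s K.* V (F.to j) K.* ⟦ Finite.to chars i ⟧
              (F.- (s F.* F.to j))) ⟩
          ΣF (λ t → Σχ λ ψ → ΣF λ s → U s K.* V t K.* ⟦ ψ ⟧ (F.- (s F.* t)))
            ≈⟨ ΣF-cong (λ t → K.trans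
                 (∑-comm (λ i j → U (F.to j) K.* V t K.* ⟦ Finite.to chars i ⟧ (F.- (F.to j F.* t))))
                 (ΣF-cong λ s → K.sym (K.*-distribˡ-sum (U s K.* V t)
                   (λ i → ⟦ Finite.to chars i ⟧ (F.- (s F.* t)))))) ⟩
          ΣF (λ t → ΣF λ s → U s K.* V t K.* character-sum (F.- (s F.* t)))
            ≈⟨ ΣF-cong inner-sum ⟩
          ΣF (λ t → K.fromℕ N K.* W t)
            ≈⟨ K.*-distribˡ-sum (K.fromℕ N) (λ i → W (F.to i)) ⟨
          K.fromℕ N K.* ΣF W ∎

odd-coprime-two : ∀ h → Coprime (suc (h ℕ.* 2)) 2
odd-coprime-two h {d} (d∣n , d∣2) = ∣1⇒≡1 (∣m+n∣m⇒∣n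
  (≡.subst (d ∣_) (ℕₚ.+-comm 1 (h ℕ.* 2)) d∣n) (∣-trans d∣2 (n∣m*n h)))

-- The matrix over the fourth powers and its determinant.

module FourthPowerMatrix {c ℓ₁ ℓ₂ c′ ℓ₁′ ℓ₂′} (F : FiniteField c ℓ₁ ℓ₂)
  (K : CharZeroField c′ ℓ₁′ ℓ₂′) where
  open CharacterProperties F K
  open Hypergeometric F K
  open DeterminantProperties K.commutativeRing
  private
    module RF = CommutativeRing F.commutativeRing
    module RK = CommutativeRing K.commutativeRing
  open import Algebra.Properties.Ring RF.ring using (-‿distribʳ-*; -‿involutive; -1*x≈-x)
  import Algebra.Properties.Ring RK.ring as KRing
  open import Algebra.Properties.Semiring.Sum RK.semiring using (∑-distrib-+)
  open PeriodicSums RK.+-abelianGroup using (sumTo-shift)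
  import Algebra.Properties.CommutativeMonoid.Sum RK.*-commutativeMonoid as Product
  open import Algebra.Properties.Monoid.Mult (AbelianGroup.monoid characterGroup) using (×-homo-+)
  open import Algebra.Solver.Ring.NaturalCoefficients.Default RK.commutativeSemiring
    using (solve; _:*_; _:=_)
  open F.HasOrder

  module _ {ζ} (ζ-primitive : K.IsPrimitiveRoot N ζ) (chars : Finite characterSetoid)
           (χ : Character) (generates : Generates χ)
           (h : ℕ) (N≡ : N ≡ suc (h ℕ.* 2) ℕ.* 4) where
    open Generator ζ-primitive chars χ generates

    n : ℕ
    n = suc (h ℕ.* 2)

    power-value-g : ∀ k i → ⟦ χ ^ᶻ (ℤ.+ k) ⟧ (g F.^ i) K.≈ η K.^ (i ℕ.* k)
    power-value-g k i = K.trans (power-value χ k (g^≉0 i))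
      (K.trans (K.^-congˡ k (χ-g^ i)) (K.^-assocʳ η i k))

    g^-period : ∀ i k → g F.^ (k ℕ.* (n ℕ.* 4) ℕ.+ i) F.≈ g F.^ i
    g^-period i k = F.trans (F.^-homo-* g (k ℕ.* (n ℕ.* 4)) i)
      (F.trans (F.*-congʳ one) (F.*-identityˡ _))
      where
      one : g F.^ (k ℕ.* (n ℕ.* 4)) F.≈ F.1#
      one = F.trans (F.reflexive (≡.cong (g F.^_) (≡.trans (≡.cong (k ℕ.*_) (≡.sym N≡))
        (ℕₚ.*-comm k N))))
        (F.trans (F.sym (F.^-assocʳ g N k)) (F.trans (F.^-congˡ k (power≈1 g-order)) (F.1^n≈1 k)))

    η^-multiple : ∀ {e} k → e ≡ n ℕ.* 4 ℕ.* k → η K.^ e K.≈ K.1#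
    η^-multiple k e≡ = K.trans (K.reflexive (≡.cong (η K.^_) (≡.trans e≡ (≡.cong (ℕ._* k) (≡.sym N≡)))))
      (K.^-multiple N η^N≈1 k)

    N∤half : ¬ N ∣ n ℕ.* 2
    N∤half N∣ = ℕₚ.<⇒≱ (ℕₚ.*-monoʳ-< n {2} {4} (ℕ.s≤s (ℕ.s≤s (ℕ.s≤s ℕ.z≤n))))
      (∣⇒≤ (≡.subst (_∣ n ℕ.* 2) N≡ N∣))

    half+half : ∀ h → suc (h ℕ.* 2) ℕ.* 2 ℕ.+ suc (h ℕ.* 2) ℕ.* 2 ≡ suc (h ℕ.* 2) ℕ.* 4
    half+half = solve-∀

    g^half≈-1 : g F.^ (n ℕ.* 2) F.≈ F.- F.1#
    g^half≈-1 = F.x-y≈0⇒x≈y (F.trans (F.+-congˡ (-‿involutive F.1#)) (F.xy≈0⇒y≈0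
      (λ eq → N∤half (minimal g-order (n ℕ.* 2) (F.x-y≈0⇒x≈y eq)))
      (square-root-of-one F.commutativeRing _ (F.trans (F.sym (F.^-homo-* g (n ℕ.* 2) (n ℕ.* 2)))
        (F.trans (F.reflexive (≡.cong (g F.^_) (≡.trans (half+half h) (≡.sym N≡))))
          (power≈1 g-order))))))

    η^half≈-1 : η K.^ (n ℕ.* 2) K.≈ K.- K.1#
    η^half≈-1 = K.square-root≈-1 (η-primitive (n ℕ.* 2) N∤half) (K.trans
      (K.sym (K.^-homo-* η (n ℕ.* 2) (n ℕ.* 2)))
      (K.trans (K.reflexive (≡.cong (η K.^_) (≡.trans (half+half h) (≡.sym N≡)))) η^N≈1))

    g^[half+i]≈ : ∀ i → g F.^ (n ℕ.* 2 ℕ.+ i) F.≈ F.- g F.^ i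
    g^[half+i]≈ i = F.trans (F.^-homo-* g (n ℕ.* 2) i) (F.trans (F.*-congʳ g^half≈-1) (-1*x≈-x _))

    -- -1 = g^(N/2), and η^(N/2) is a square root of 1 that is apart from 1 because `η` is
    -- primitive; hence χ(-1) = -1.
    value-at--1 : ∀ k → ⟦ χ ^ᶻ (ℤ.+ k) ⟧ (F.- F.1#) K.≈ (K.- K.1#) K.^ k
    value-at--1 k = K.trans (power-value χ k -1≉0) (K.^-congˡ k (K.trans
      (Character.⟦⟧-cong χ (F.sym g^half≈-1)) (K.trans (χ-g^ (n ℕ.* 2)) η^half≈-1)))
      where
      -1≉0 : ¬ (F.- F.1# F.≈ F.0#)
      -1≉0 eq = g^≉0 (n ℕ.* 2) (F.trans g^half≈-1 eq)

    T : ℕ → F.Carrier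
    T i = g F.^ (i ℕ.* 4)

    T-+ : ∀ i j → T (i ℕ.+ j) F.≈ T i F.* T j
    T-+ i j = F.trans (F.reflexive (≡.cong (g F.^_) (ℕₚ.*-distribʳ-+ 4 i j)))
      (F.^-homo-* g (i ℕ.* 4) (j ℕ.* 4))

    T-period : ∀ i k → T (k ℕ.* n ℕ.+ i) F.≈ T i
    T-period i k = F.trans (F.reflexive (≡.cong (g F.^_)
      (≡.trans (ℕₚ.*-distribʳ-+ 4 (k ℕ.* n) i) (≡.cong (ℕ._+ i ℕ.* 4) (ℕₚ.*-assoc k n 4)))))
        (g^-period (i ℕ.* 4) k)

    T-reduce : ∀ i → T (i % n) F.≈ T i
    T-reduce i = F.trans (F.sym (T-period (i % n) (i ℕ./ n)))
      (F.reflexive (≡.cong T (≡.trans (ℕₚ.+-comm _ (i % n)) (≡.sym (m≡m%n+[m/n]*n i n)))))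

    T-injective : Injective _≡_ F._≈_ (λ (i : Fin n) → T (toℕ i))
    T-injective {i} {j} eq = toℕ-injective (ℕₚ.*-cancelʳ-≡ (toℕ i) (toℕ j) 4
      (≡.trans (≡.sym (toℕ-fromℕ< (bound i))) (≡.trans (≡.cong toℕ (F.powers-injective g≉0 g-order
        {fromℕ< (bound i)} {fromℕ< (bound j)}
        (F.trans (F.reflexive (≡.cong (g F.^_) (toℕ-fromℕ< (bound i))))
          (F.trans eq (F.reflexive (≡.cong (g F.^_) (≡.sym (toℕ-fromℕ< (bound j)))))))))
        (toℕ-fromℕ< (bound j)))))
      where
      bound : ∀ (i : Fin n) → toℕ i ℕ.* 4 ℕ.< N
      bound i = ≡.subst (toℕ i ℕ.* 4 ℕ.<_) (≡.sym N≡) (ℕₚ.*-monoˡ-< 4 (toℕ<n i))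

    module _ (r : ℕ) where
      open SetoidReasoning K.setoid

      P : Character
      P = χ ^ᶻ (ℤ.+ r)

      -- The eigenvalues of B. Since n is odd, the even powers of χ restrict to all characters of D₄.
      Λ : ℕ → K.Carrier
      Λ k = K.sumTo n λ i → (⟦ P ⟧ (F.1# F.+ T i) K.+ ⟦ P ⟧ (F.1# F.- T i)) K.* η K.^
        (i ℕ.* 4 ℕ.* (2 ℕ.* k))

      module _ (k : ℕ) where

        Q : Character
        Q = χ ^ᶻ (ℤ.+ (4 ℕ.* k))

        -- The substitution t ↦ √-1 t is the shift of exponents by `n`, since g^n squares to -1. On
        -- `c₁` it changes the sign of g^(2j) and leaves η^(4jk) alone, because 4n = N.
        c₁ : ℕ → K.Carrier
        c₁ j = ⟦ P ⟧ (F.1# F.+ g F.^ (j ℕ.* 2)) K.* η K.^ (j ℕ.* (4 ℕ.* k))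

        W : F.Carrier → K.Carrier
        W t = ⟦ Q ⟧ t K.* ⟦ P ⟧ ((F.1# F.+ t) F.* (F.1# F.- t))

        g^-cong : ∀ {i j} → i ≡ j → g F.^ i F.≈ g F.^ j
        g^-cong eq = F.reflexive (≡.cong (g F.^_) eq)

        η^-cong : ∀ {i j} → i ≡ j → η K.^ i K.≈ η K.^ j
        η^-cong eq = K.reflexive (≡.cong (η K.^_) eq)

        P-cong : ∀ {x y} → x F.≈ y → ⟦ P ⟧ x K.≈ ⟦ P ⟧ y
        P-cong = Character.⟦⟧-cong P

        η-half-period : ∀ i → η K.^ ((n ℕ.+ i) ℕ.* (4 ℕ.* k)) K.≈ η K.^ (i ℕ.* (4 ℕ.* k))
        η-half-period i = begin
          η K.^ ((n ℕ.+ i) ℕ.* (4 ℕ.* k))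
            ≡⟨ ≡.cong (η K.^_) (ℕₚ.*-distribʳ-+ (4 ℕ.* k) n i) ⟩
          η K.^ (n ℕ.* (4 ℕ.* k) ℕ.+ i ℕ.* (4 ℕ.* k))          ≈⟨ K.^-homo-* η (n ℕ.* (4 ℕ.* k)) _ ⟩
          η K.^ (n ℕ.* (4 ℕ.* k)) K.* η K.^ (i ℕ.* (4 ℕ.* k))
            ≈⟨ K.*-congʳ (η^-multiple k (≡.sym (ℕₚ.*-assoc n 4 k))) ⟩
          K.1# K.* η K.^ (i ℕ.* (4 ℕ.* k))                     ≈⟨ K.*-identityˡ _ ⟩
          η K.^ (i ℕ.* (4 ℕ.* k))                              ∎

        c₁-half-period : ∀ i → c₁ (n ℕ.+ i) K.≈ ⟦ P ⟧ (F.1# F.- g F.^ (i ℕ.* 2)) K.* η K.^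
          (i ℕ.* (4 ℕ.* k))
        c₁-half-period i = K.*-cong
          (P-cong (F.+-congˡ (F.trans (g^-cong (ℕₚ.*-distribʳ-+ 2 n i)) (g^[half+i]≈ (i ℕ.* 2)))))
          (η-half-period i)

        W-g^ : ∀ i → W (g F.^ i) K.≈ c₁ (n ℕ.+ i)
        W-g^ i = K.trans (K.*-cong (power-value-g (4 ℕ.* k) i) (P-cong difference-of-squares))
          (K.trans (K.*-comm _ _) (K.sym (c₁-half-period i)))
          where
          x = g F.^ i
          difference-of-squares : (F.1# F.+ x) F.* (F.1# F.- x) F.≈ F.1# F.- g F.^ (i ℕ.* 2)
          difference-of-squares = F.trans (F.distribˡ _ _ _) (F.trans
            (F.+-cong (F.*-identityʳ _) (F.trans (F.sym (-‿distribʳ-* _ _))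
              (F.-‿cong (F.trans (F.distribʳ _ _ _) (F.+-congʳ (F.*-identityˡ x))))))
            (F.trans (cancel-middle x (x F.* x)) (F.+-congˡ
              (F.-‿cong (F.trans (F.*-congˡ (F.sym (F.*-identityʳ x))) (F.^-assocʳ g i 2))))))
            where
            cancel-middle : ∀ x y → F.1# F.+ x F.- (x F.+ y) F.≈ F.1# F.- y
            cancel-middle x y = F.trans (F.+-assoc _ _ _)
              (F.+-congˡ (F.trans (F.+-congˡ (F.trans (F.sym (⁻¹-∙-comm x y)) F.refl))
              (F.trans (F.sym (F.+-assoc _ _ _)) (F.trans (F.+-congʳ (F.-‿inverseʳ x))
                (F.+-identityˡ _)))))
              where open import Algebra.Properties.AbelianGroup RF.+-abelianGroup using (⁻¹-∙-comm)

        c₁-period : ∀ i → c₁ (n ℕ.* 2 ℕ.+ i) K.≈ c₁ i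
        c₁-period i = K.trans (K.reflexive (≡.cong c₁ (regroup n i)))
          (K.trans (c₁-half-period (n ℕ.+ i))
          (K.*-cong (P-cong (F.+-congˡ (F.trans (F.-‿cong
            (F.trans (g^-cong (ℕₚ.*-distribʳ-+ 2 n i)) (g^[half+i]≈ (i ℕ.* 2)))) (-‿involutive _))))
            (η-half-period i)))
          where
          regroup : ∀ n i → n ℕ.* 2 ℕ.+ i ≡ n ℕ.+ (n ℕ.+ i)
          regroup = solve-∀

        -- Since n is odd, the odd residues modulo 2n are the n + 2i: these give the terms 1 - T i of Λ.
        ΣW : ΣF W K.≈ Λ k K.+ Λ k
        ΣW = begin
          ΣF W
            ≈⟨ sum-over-units W (λ eq → K.*-cong (Character.⟦⟧-cong Q eq)
              (P-cong (F.*-cong (F.+-congˡ eq) (F.+-congˡ (F.-‿cong eq)))))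
                 (K.trans (K.*-congʳ (character-zero Q F.refl)) (K.zeroˡ _)) ⟩
          K.sumTo N (λ i → W (g F.^ i))
            ≈⟨ K.sumTo-cong N W-g^ ⟩
          K.sumTo N (λ i → c₁ (n ℕ.+ i))
            -- `N` is twice the period 2n of `c₁`, and each period contributes one copy of `Λ k`.
            ≡⟨ ≡.cong (λ m → K.sumTo m (λ i → c₁ (n ℕ.+ i))) (≡.trans N≡ (≡.sym (half+half h))) ⟩
          K.sumTo (n ℕ.* 2 ℕ.+ n ℕ.* 2) (λ i → c₁ (n ℕ.+ i))
            ≈⟨ K.sumTo-+ (n ℕ.* 2) (n ℕ.* 2) (λ i → c₁ (n ℕ.+ i)) ⟩
          S K.+ K.sumTo (n ℕ.* 2) (λ i → c₁ (n ℕ.+ (n ℕ.* 2 ℕ.+ i)))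
            ≈⟨ K.+-congˡ (K.sumTo-cong (n ℕ.* 2) λ i → K.trans
              (K.reflexive (≡.cong c₁ (exchange n (n ℕ.* 2) i))) (c₁-period (n ℕ.+ i))) ⟩
          S K.+ S
            ≈⟨ K.+-cong S≈Λ S≈Λ ⟩
          Λ k K.+ Λ k ∎
          where
          S = K.sumTo (n ℕ.* 2) (λ i → c₁ (n ℕ.+ i))
          exchange : ∀ a b i → a ℕ.+ (b ℕ.+ i) ≡ b ℕ.+ (a ℕ.+ i)
          exchange = solve-∀
          odd : ℕ → K.Carrier
          odd i = c₁ (1 ℕ.+ i ℕ.* 2)
          odd-period : ∀ i → odd (n ℕ.+ i) K.≈ odd i
          odd-period i = K.trans (K.reflexive (≡.cong c₁ (shift n i))) (c₁-period (1 ℕ.+ i ℕ.* 2))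
            where
            shift : ∀ n i → 1 ℕ.+ (n ℕ.+ i) ℕ.* 2 ≡ n ℕ.* 2 ℕ.+ (1 ℕ.+ i ℕ.* 2)
            shift = solve-∀
          S≈Λ : S K.≈ Λ k
          S≈Λ = begin
            S
              ≈⟨ sumTo-shift (n ℕ.* 2) c₁ c₁-period n ⟩
            K.sumTo (n ℕ.* 2) c₁
              ≈⟨ K.sumTo-even-odd n c₁ ⟩
            K.sumTo n (λ i → c₁ (i ℕ.* 2) K.+ odd i)
              ≈⟨ ∑-distrib-+ {n} (λ i → c₁ (toℕ i ℕ.* 2)) (λ i → odd (toℕ i)) ⟩
            K.sumTo n (λ i → c₁ (i ℕ.* 2)) K.+ K.sumTo n odd
              ≈⟨ K.+-congˡ (sumTo-shift n odd odd-period h) ⟨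
            K.sumTo n (λ i → c₁ (i ℕ.* 2)) K.+ K.sumTo n (λ i → odd (h ℕ.+ i))
              ≈⟨ ∑-distrib-+ {n} (λ i → c₁ (toℕ i ℕ.* 2)) (λ i → odd (h ℕ.+ toℕ i)) ⟨
            K.sumTo n (λ i → c₁ (i ℕ.* 2) K.+ odd (h ℕ.+ i))
              ≈⟨ K.sumTo-cong n (λ i → K.trans (K.+-cong (even-term i) (odd-term i))
                (K.sym (K.distribʳ _ _ _))) ⟩
            Λ k ∎
            where
            exponent : ∀ i k → i ℕ.* 2 ℕ.* (4 ℕ.* k) ≡ i ℕ.* 4 ℕ.* (2 ℕ.* k)
            exponent = solve-∀
            even-term : ∀ i → c₁ (i ℕ.* 2) K.≈ ⟦ P ⟧ (F.1# F.+ T i) K.* η K.^ (i ℕ.* 4 ℕ.* (2 ℕ.* k))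
            even-term i = K.*-cong (P-cong (F.+-congˡ (g^-cong (ℕₚ.*-assoc i 2 2))))
              (η^-cong (exponent i k))
            odd-index : ∀ h i → 1 ℕ.+ (h ℕ.+ i) ℕ.* 2 ≡ suc (h ℕ.* 2) ℕ.+ i ℕ.* 2
            odd-index = solve-∀
            odd-term : ∀ i → odd (h ℕ.+ i) K.≈ ⟦ P ⟧ (F.1# F.- T i) K.* η K.^ (i ℕ.* 4 ℕ.* (2 ℕ.* k))
            odd-term i = K.trans (K.reflexive (≡.cong c₁ (odd-index h i)))
              (K.trans (c₁-half-period (i ℕ.* 2))
              (K.*-cong (P-cong (F.+-congˡ (F.-‿cong (g^-cong (ℕₚ.*-assoc i 2 2)))))
                (η^-cong (exponent i k))))

        -- The factor q/2 is accounted for here: `q` removes the 1/q of the evaluation, and 1/2 the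
        -- two copies of `Λ k`. The sign is C(-1), to which the part 4k of the exponent contributes
        -- nothing.
        half-hypergeometric : K.fromℕ q K.* K.1/ 2 K.*
          ₂F₁ chars (P ⁻) Q (χ ^ᶻ (ℤ.+ (4 ℕ.* k ℕ.+ r))) (F.- F.1#) K.≈ (K.- K.1#) K.^ r K.* Λ k
        half-hypergeometric = begin
          K.fromℕ q K.* K.1/ 2 K.* ₂F₁ chars (P ⁻) Q C (F.- F.1#)
            ≈⟨ K.*-congˡ (₂F₁-evaluation ζ-primitive chars χ generates P Q C (×-homo-+ χ (4 ℕ.* k) r)) ⟩
          K.fromℕ q K.* K.1/ 2 K.* (K.1/ q K.* ⟦ C ⟧ (F.- F.1#) K.* ΣF W)
            ≈⟨ K.*-congˡ (K.*-cong (K.*-congˡ C-value) ΣW) ⟩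
          K.fromℕ q K.* K.1/ 2 K.* (K.1/ q K.* ε K.* (Λ k K.+ Λ k))
            ≈⟨ K.*-congˡ (K.*-congˡ double) ⟩
          K.fromℕ q K.* K.1/ 2 K.* (K.1/ q K.* ε K.* (K.fromℕ 2 K.* Λ k))
            ≈⟨ solve 6 (λ q t ι ε d l → q :* t :* (ι :* ε :* (d :* l)) := (q :* ι) :* (d :* t) :*
              (ε :* l)) K.refl
                 (K.fromℕ q) (K.1/ 2) (K.1/ q) ε (K.fromℕ 2) (Λ k) ⟩
          K.fromℕ q K.* K.1/ q K.* (K.fromℕ 2 K.* K.1/ 2) K.* (ε K.* Λ k)
            ≈⟨ K.*-congʳ (K.trans (K.*-cong (1/-inverse q) (1/-inverse 2)) (K.*-identityˡ _)) ⟩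
          K.1# K.* (ε K.* Λ k)
            ≈⟨ K.*-identityˡ _ ⟩
          ε K.* Λ k ∎
          where
          ε = (K.- K.1#) K.^ r
          C = χ ^ᶻ (ℤ.+ (4 ℕ.* k ℕ.+ r))
          double : Λ k K.+ Λ k K.≈ K.fromℕ 2 K.* Λ k
          double = K.sym (K.trans (K.distribʳ _ _ _) (K.+-cong (K.*-identityˡ _)
            (K.trans (K.*-congʳ (K.+-identityʳ _)) (K.*-identityˡ _))))
          C-value : ⟦ C ⟧ (F.- F.1#) K.≈ ε
          C-value = begin
            ⟦ C ⟧ (F.- F.1#)                                 ≈⟨ value-at--1 (4 ℕ.* k ℕ.+ r) ⟩
            (K.- K.1#) K.^ (4 ℕ.* k ℕ.+ r)                   ≈⟨ K.^-homo-* (K.- K.1#) (4 ℕ.* k) r ⟩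
            (K.- K.1#) K.^ (4 ℕ.* k) K.* ε
              ≈⟨ K.*-congʳ (K.trans (K.sym (K.^-congˡ (4 ℕ.* k) η^half≈-1))
                                                                  (K.trans (K.^-assocʳ η (n ℕ.* 2)
                                                                    (4 ℕ.* k)) (η^-multiple
                                                                    (2 ℕ.* k) (exponent n k)))) ⟩
            K.1# K.* ε                                       ≈⟨ K.*-identityˡ ε ⟩
            ε                                                ∎
            where
            exponent : ∀ n k → n ℕ.* 2 ℕ.* (4 ℕ.* k) ≡ n ℕ.* 4 ℕ.* (2 ℕ.* k)
            exponent = solve-∀

      -- Cancelling 4, and then 2 because `n` is odd, shows that `n` divides n - k + l. This number
      -- lies strictly between 0 and 2n, so it equals `n`. Adding `n` to l - k keeps the exponent
      -- natural.
      odd-multiple : ∀ k l → k ℕ.< n → l ℕ.< n → N ∣ 4 ℕ.* (2 ℕ.* (n ℕ.∸ k ℕ.+ l)) → k ≡ l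
      odd-multiple k l k<n l<n N∣ with coprime-divisor (odd-coprime-two h) (*-cancelˡ-∣ 4
        (≡.subst (_∣ 4 ℕ.* (2 ℕ.* (n ℕ.∸ k ℕ.+ l))) (≡.trans N≡ (ℕₚ.*-comm n 4)) N∣))
      ... | divides zero eq = contradiction (ℕₚ.m<n⇒0<n∸m k<n)
        (ℕₚ.≤⇒≯ (ℕₚ.≤-reflexive (ℕₚ.m+n≡0⇒m≡0 (n ℕ.∸ k) eq)))
      ... | divides (suc zero) eq = ≡.sym (ℕₚ.+-cancelˡ-≡ (n ℕ.∸ k) l k
        (≡.trans eq (≡.trans (ℕₚ.+-identityʳ n) (≡.sym (ℕₚ.m∸n+n≡m (ℕₚ.<⇒≤ k<n))))))
      ... | divides (suc (suc j)) eq = contradiction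
        (≡.subst (n ℕ.+ n ℕ.≤_) (≡.sym eq) (ℕₚ.+-monoʳ-≤ n (ℕₚ.m≤m+n n (j ℕ.* n))))
        (ℕₚ.<⇒≱ (ℕₚ.+-mono-≤-< (ℕₚ.m∸n≤m n k) l<n))

      module _ (a : Fin n → F.Carrier) (a-injective : Injective _≡_ F._≈_ a)
               (a∈D₄ : ∀ i → D₄ (a i)) (D₄⊆a : ∀ y → D₄ y → ∃ λ i → a i F.≈ y) where

        a-power : ∀ i → ∃ λ u → a i F.≈ T u
        a-power i with a∈D₄ i
        ... | x , x#0 , a≈x^4 = toℕ (log x≉0) , F.trans a≈x^4
          (F.trans (F.^-congˡ 4 (F.sym (g^log x≉0))) (F.^-assocʳ g (toℕ (log x≉0)) 4))
          where
          x≉0 : ¬ (x F.≈ F.0#)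
          x≉0 x≈0 = proj₂ (F.tight x F.0#) x≈0 x#0

        a-onto : ∀ u → ∃ λ j → a j F.≈ T u
        a-onto u = D₄⊆a (T u) (g F.^ u , g^u#0 , F.sym (F.^-assocʳ g u 4))
          where
          open import Algebra.Apartness.Properties.HeytingCommutativeRing F.heytingCommutativeRing
            using (invertibleʳ⇒#; x-0≈x)
          g^u#0 : g F.^ u F.# F.0#
          g^u#0 = invertibleʳ⇒# (F.inv (g F.^ u) , F.trans (F.*-congʳ (x-0≈x _))
            (F.inv-nonzero (g^≉0 u)))

        module _ {c ℓ} (M : CommutativeMonoid c ℓ) where
          private module M = CommutativeMonoid M
          open Reindexing M using (sumTo; sum-same-image)
          open import Algebra.Properties.CommutativeMonoid.Sum M using (sum)

          -- For `s` in D₄, multiplication by `s` permutes D₄. With `s = a i` this centres row `i`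
          -- of the matrix at its own element.
          sum-over-coset : ∀ {s} u → s F.≈ T u → (f : F.Carrier → M.Carrier) →
            (∀ {x y} → x F.≈ y → f x M.≈ f y) → sum (f ∘ a) M.≈ sumTo n (λ i → f (s F.* T i))
          sum-over-coset {s} u s≈ = sum-same-image F.setoid a
            (λ i → s F.* T (toℕ i)) a-injective sT-injective into onto
            where
            s≉0 : ¬ (s F.≈ F.0#)
            s≉0 s≈0 = g^≉0 (u ℕ.* 4) (F.trans (F.sym s≈) s≈0)
            sT-injective : Injective _≡_ F._≈_ (λ (i : Fin n) → s F.* T (toℕ i))
            sT-injective {i} {j} eq = T-injective (F.trans (F.sym (F.*-identityˡ _))
              (F.trans (F.*-congʳ (F.sym inv-s))
              (F.trans (F.*-assoc _ _ _) (F.trans (F.*-congˡ eq) (F.trans (F.sym (F.*-assoc _ _ _))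
              (F.trans (F.*-congʳ inv-s) (F.*-identityˡ _)))))))
              where
              inv-s : F.inv s F.* s F.≈ F.1#
              inv-s = F.trans (F.*-comm _ _) (F.inv-nonzero s≉0)
            onto : ∀ i → ∃ λ j → a j F.≈ s F.* T (toℕ i)
            onto i = proj₁ (a-onto (u ℕ.+ toℕ i)) , F.trans (proj₂ (a-onto (u ℕ.+ toℕ i)))
              (F.trans (T-+ u (toℕ i)) (F.*-congʳ (F.sym s≈)))
            into : ∀ j → ∃ λ (i : Fin n) → s F.* T (toℕ i) F.≈ a j
            into j with a-power j
            ... | v , aj≈ = fromℕ< (m%n<n w n) ,
              F.trans (F.*-cong s≈ (F.trans (F.reflexive (≡.cong T (toℕ-fromℕ< (m%n<n w n))))
                (T-reduce w)))
              (F.trans (F.sym (T-+ u w)) (F.trans (F.reflexive (≡.cong T (index u v h)))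
              (F.trans (T-period v u) (F.sym aj≈))))
              where
              -- 2h is -1 modulo n = 2h + 1, so `w` stands for v - u without a subtraction.
              w = v ℕ.+ u ℕ.* (h ℕ.* 2)
              index : ∀ u v h → u ℕ.+ (v ℕ.+ u ℕ.* (h ℕ.* 2)) ≡ u ℕ.* suc (h ℕ.* 2) ℕ.+ v
              index = solve-∀

          sum-over-D₄ : (f : F.Carrier → M.Carrier) →
            (∀ {x y} → x F.≈ y → f x M.≈ f y) → sum (f ∘ a) M.≈ sumTo n (λ i → f (T i))
          sum-over-D₄ f f-cong = M.trans (sum-over-coset 0 F.refl f f-cong)
            (Reindexing.sumTo-cong M n λ i → f-cong (F.*-identityˡ (T i)))

        -- χ^(2n) is trivial on D₄, since x^(8n) = x^(2N) = 1; so the exponent 2(n - k) gives the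
        -- inverse of χ^(2k) there. `Fourier⁻¹` inverts `Fourier` only up to the factor `n`.
        B Fourier Fourier⁻¹ : Matrix n n
        B i j = ⟦ P ⟧ (a i F.+ a j) K.+ ⟦ P ⟧ (a i F.- a j)
        Fourier j k = ⟦ χ ^ᶻ (ℤ.+ (2 ℕ.* toℕ k)) ⟧ (a j)
        Fourier⁻¹ k j = ⟦ χ ^ᶻ (ℤ.+ (2 ℕ.* (n ℕ.∸ toℕ k))) ⟧ (a j)

        -- P(x + xt) = P(x) P(1 + t), and likewise with 1 - t. After recentring at x = a i, the row
        -- index survives only in P(a i) and in the value of the character at a i.
        Fourier-eigenvector : ∀ i k → (B ⊡ Fourier) i k K.≈ ⟦ P ⟧ (a i) K.* (Λ (toℕ k) K.* Fourier i k)
        Fourier-eigenvector i k = begin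
          K.sum (λ j → B i j K.* Fourier j k)
            ≈⟨ sum-over-coset RK.+-commutativeMonoid (proj₁ (a-power i)) (proj₂ (a-power i)) f f-cong ⟩
          K.sumTo n (λ l → f (a i F.* T l))
            ≈⟨ K.sumTo-cong n term ⟩
          K.sumTo n (λ l → ⟦ P ⟧ (a i) K.* ω K.* ((⟦ P ⟧ (F.1# F.+ T l) K.+ ⟦ P ⟧ (F.1# F.- T l))
            K.* η K.^ (l ℕ.* 4 ℕ.* (2 ℕ.* toℕ k))))
            ≈⟨ K.*-distribˡ-sum {n} (⟦ P ⟧ (a i) K.* ω)
              (λ l → (⟦ P ⟧ (F.1# F.+ T (toℕ l)) K.+ ⟦ P ⟧ (F.1# F.- T (toℕ l))) K.* η K.^
              (toℕ l ℕ.* 4 ℕ.* (2 ℕ.* toℕ k))) ⟨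
          ⟦ P ⟧ (a i) K.* ω K.* Λ (toℕ k)
            ≈⟨ K.trans (K.*-assoc _ _ _) (K.*-congˡ (K.*-comm _ _)) ⟩
          ⟦ P ⟧ (a i) K.* (Λ (toℕ k) K.* ω) ∎
          where
          R = χ ^ᶻ (ℤ.+ (2 ℕ.* toℕ k))
          ω = ⟦ R ⟧ (a i)
          f : F.Carrier → K.Carrier
          f x = (⟦ P ⟧ (a i F.+ x) K.+ ⟦ P ⟧ (a i F.- x)) K.* ⟦ R ⟧ x
          f-cong : ∀ {x y} → x F.≈ y → f x K.≈ f y
          f-cong eq = K.*-cong (K.+-cong (Character.⟦⟧-cong P (F.+-congˡ eq))
            (Character.⟦⟧-cong P (F.+-congˡ (F.-‿cong eq))))
            (Character.⟦⟧-cong R eq)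
          factor : ∀ x y → ⟦ P ⟧ (x F.+ x F.* y) K.≈ ⟦ P ⟧ x K.* ⟦ P ⟧ (F.1# F.+ y)
          factor x y = K.trans (Character.⟦⟧-cong P
            (F.trans (F.+-congʳ (F.sym (F.*-identityʳ x))) (F.sym (F.distribˡ _ _ _))))
            (Character.homo P _ _)
          term : ∀ l → f (a i F.* T l) K.≈ ⟦ P ⟧ (a i) K.* ω K.*
            ((⟦ P ⟧ (F.1# F.+ T l) K.+ ⟦ P ⟧ (F.1# F.- T l)) K.* η K.^ (l ℕ.* 4 ℕ.* (2 ℕ.* toℕ k)))
          term l = begin
            f (a i F.* T l)
              ≈⟨ K.*-cong (K.trans (K.+-cong (factor _ _)
                (K.trans (Character.⟦⟧-cong P (F.+-congˡ (-‿distribʳ-* _ _))) (factor _ _)))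
                (K.sym (K.distribˡ _ _ _)))
                   (K.trans (Character.homo R _ _) (K.*-congˡ
                     (power-value-g (2 ℕ.* toℕ k) (l ℕ.* 4)))) ⟩
            ⟦ P ⟧ (a i) K.* s K.* (ω K.* e)
              ≈⟨ solve 4 (λ p s w e → p :* s :* (w :* e) := p :* w :* (s :* e)) K.refl
                (⟦ P ⟧ (a i)) s ω e ⟩
            ⟦ P ⟧ (a i) K.* ω K.* (s K.* e) ∎
            where
            s = ⟦ P ⟧ (F.1# F.+ T l) K.+ ⟦ P ⟧ (F.1# F.- T l)
            e = η K.^ (l ℕ.* 4 ℕ.* (2 ℕ.* toℕ k))

        -- The product of the two characters at `T i` is the i-th power of an n-th root of unity
        -- `ω`, so the entry is a geometric sum. By `odd-multiple`, `N` divides the exponent of `ω`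
        -- only if k = l.
        Fourier-orthogonality : ∀ k l → (Fourier⁻¹ ⊡ Fourier) k l K.≈ K.fromℕ n K.* δ k l
        Fourier-orthogonality k l = begin
          K.sum (λ j → Fourier⁻¹ k j K.* Fourier j l)
            ≈⟨ sum-over-D₄ RK.+-commutativeMonoid (λ x → ⟦ A ⟧ x K.* ⟦ R ⟧ x)
                 (λ eq → K.*-cong (Character.⟦⟧-cong A eq) (Character.⟦⟧-cong R eq)) ⟩
          K.sumTo n (λ i → ⟦ A ⟧ (T i) K.* ⟦ R ⟧ (T i))
            ≈⟨ K.sumTo-cong n term ⟩
          K.sumTo n (ω K.^_)
            ≈⟨ evaluate ⟩
          K.fromℕ n K.* δ k l ∎
          where
          A = χ ^ᶻ (ℤ.+ (2 ℕ.* (n ℕ.∸ toℕ k)))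
          R = χ ^ᶻ (ℤ.+ (2 ℕ.* toℕ l))
          E = 4 ℕ.* (2 ℕ.* (n ℕ.∸ toℕ k ℕ.+ toℕ l))
          ω = η K.^ E
          exponent : ∀ i x y → i ℕ.* 4 ℕ.* (2 ℕ.* x) ℕ.+ i ℕ.* 4 ℕ.* (2 ℕ.* y) ≡ 4 ℕ.*
            (2 ℕ.* (x ℕ.+ y)) ℕ.* i
          exponent = solve-∀
          term : ∀ i → ⟦ A ⟧ (T i) K.* ⟦ R ⟧ (T i) K.≈ ω K.^ i
          term i = begin
            ⟦ A ⟧ (T i) K.* ⟦ R ⟧ (T i)
              ≈⟨ K.*-cong (power-value-g (2 ℕ.* (n ℕ.∸ toℕ k)) (i ℕ.* 4))
                (power-value-g (2 ℕ.* toℕ l) (i ℕ.* 4)) ⟩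
            η K.^ (i ℕ.* 4 ℕ.* (2 ℕ.* (n ℕ.∸ toℕ k))) K.* η K.^ (i ℕ.* 4 ℕ.* (2 ℕ.* toℕ l))
              ≈⟨ K.^-homo-* η (i ℕ.* 4 ℕ.* (2 ℕ.* (n ℕ.∸ toℕ k))) (i ℕ.* 4 ℕ.* (2 ℕ.* toℕ l)) ⟨
            η K.^ (i ℕ.* 4 ℕ.* (2 ℕ.* (n ℕ.∸ toℕ k)) ℕ.+ i ℕ.* 4 ℕ.* (2 ℕ.* toℕ l))
              ≡⟨ ≡.cong (η K.^_) (exponent i (n ℕ.∸ toℕ k) (toℕ l)) ⟩
            η K.^ (E ℕ.* i)
              ≈⟨ K.^-assocʳ η E i ⟨
            ω K.^ i ∎
          ω^n≈1 : ω K.^ n K.≈ K.1#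
          ω^n≈1 = K.trans (K.^-assocʳ η E n) (η^-multiple (2 ℕ.* (n ℕ.∸ toℕ k ℕ.+ toℕ l))
            (reorder n (n ℕ.∸ toℕ k ℕ.+ toℕ l)))
            where
            reorder : ∀ n x → 4 ℕ.* (2 ℕ.* x) ℕ.* n ≡ n ℕ.* 4 ℕ.* (2 ℕ.* x)
            reorder = solve-∀
          evaluate : K.sumTo n (ω K.^_) K.≈ K.fromℕ n K.* δ k l
          evaluate with k Finₚ.≟ l
          ... | yes ≡.refl = K.trans (K.trans (K.sumTo-cong n λ i → K.trans (K.^-congˡ i ω≈1)
            (K.1^n≈1 i)) (K.sum-replicate n {K.1#}))
            (K.sym (K.trans (K.*-congˡ (δ-diagonal k)) (K.*-identityʳ _)))
            where
            ω≈1 : ω K.≈ K.1#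
            ω≈1 = η^-multiple 2 (≡.trans (≡.cong (λ x → 4 ℕ.* (2 ℕ.* x))
              (ℕₚ.m∸n+n≡m (ℕₚ.<⇒≤ (toℕ<n k)))) (reorder n))
              where
              reorder : ∀ n → 4 ℕ.* (2 ℕ.* n) ≡ n ℕ.* 4 ℕ.* 2
              reorder = solve-∀
          ... | no k≢l = K.trans (K.geometric-sum-root-of-unity n (η-primitive E λ N∣ →
              k≢l (toℕ-injective (odd-multiple (toℕ k) (toℕ l) (toℕ<n k) (toℕ<n l) N∣))) ω^n≈1)
            (K.sym (K.trans (K.*-congˡ (δ-off-diagonal k≢l)) (K.zeroʳ _)))

        -- The product with `det Fourier⁻¹` is n^n, which is invertible in characteristic zero. The
        -- explicit inverse is what permits the cancellation in `det-B≈eigenvalues`.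
        det-Fourier-unit : ∃ λ v → det Fourier K.* v K.≈ K.1#
        det-Fourier-unit = det Fourier⁻¹ K.* ν K.^ n , (begin
          det Fourier K.* (det Fourier⁻¹ K.* ν K.^ n)
            ≈⟨ K.trans (K.sym (K.*-assoc _ _ _)) (K.*-congʳ (K.*-comm _ _)) ⟩
          det Fourier⁻¹ K.* det Fourier K.* ν K.^ n
            ≈⟨ K.*-congʳ (det-⊡ Fourier⁻¹ Fourier) ⟨
          det (Fourier⁻¹ ⊡ Fourier) K.* ν K.^ n
            ≈⟨ K.*-congʳ (K.trans (det-cong Fourier-orthogonality)
              (det-scale-rows {n} (λ _ → K.fromℕ n) δ)) ⟩
          K.product {n} (λ _ → K.fromℕ n) K.* det (δ {n}) K.* ν K.^ n
            ≈⟨ K.*-congʳ (K.trans (K.*-cong (K.product-const (K.fromℕ n) n) (det-δ n))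
              (K.*-identityʳ _)) ⟩
          K.fromℕ n K.^ n K.* ν K.^ n
            ≈⟨ K.^-distrib-* (K.fromℕ n) ν n ⟨
          (K.fromℕ n K.* ν) K.^ n
            ≈⟨ K.trans (K.^-congˡ n (1/-inverse n)) (K.1^n≈1 n) ⟩
          K.1# ∎)
          where ν = K.1/ n

        product-P≈1 : K.product (⟦ P ⟧ ∘ a) K.≈ K.1#
        product-P≈1 = begin
          K.product (⟦ P ⟧ ∘ a)
            ≈⟨ sum-over-D₄ RK.*-commutativeMonoid ⟦ P ⟧ (Character.⟦⟧-cong P) ⟩
          K.Products.sumTo n (λ i → ⟦ P ⟧ (T i))
            ≈⟨ K.Products.sumTo-cong n (λ i → K.trans (power-value-g r (i ℕ.* 4))
                 (K.trans (K.reflexive (≡.cong (η K.^_) (exponent i r)))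
                   (K.sym (K.^-assocʳ η (4 ℕ.* r) i)))) ⟩
          K.Products.sumTo n ((η K.^ (4 ℕ.* r)) K.^_)
            ≈⟨ K.product-powers (η K.^ (4 ℕ.* r)) h
              (K.trans (K.^-assocʳ η (4 ℕ.* r) n) (η^-multiple r (reorder n r))) ⟩
          K.1# ∎
          where
          exponent : ∀ i r → i ℕ.* 4 ℕ.* r ≡ 4 ℕ.* r ℕ.* i
          exponent = solve-∀
          reorder : ∀ n r → 4 ℕ.* r ℕ.* n ≡ n ℕ.* 4 ℕ.* r
          reorder = solve-∀

        -- det (B ⊡ Fourier) is computed twice: by multiplicativity, and by taking P(a i) out of the
        -- rows and `Λ` out of the columns. Then det Fourier is cancelled.
        det-B≈eigenvalues : det B K.≈ K.product {n} (λ k → Λ (toℕ k))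
        det-B≈eigenvalues = K.unit-cancel det-Fourier-unit (begin
          det Fourier K.* det B
            ≈⟨ K.*-comm _ _ ⟩
          det B K.* det Fourier
            ≈⟨ det-⊡ B Fourier ⟨
          det (B ⊡ Fourier)
            ≈⟨ det-cong Fourier-eigenvector ⟩
          det (λ i k → ⟦ P ⟧ (a i) K.* (Λ (toℕ k) K.* Fourier i k))
            ≈⟨ det-scale-rows (⟦ P ⟧ ∘ a) (λ i k → Λ (toℕ k) K.* Fourier i k) ⟩
          K.product (⟦ P ⟧ ∘ a) K.* det (λ i k → Λ (toℕ k) K.* Fourier i k)
            ≈⟨ K.trans (K.*-congʳ product-P≈1) (K.*-identityˡ _) ⟩
          det (λ i k → Λ (toℕ k) K.* Fourier i k)
            ≈⟨ det-scale-columns (λ k → Λ (toℕ k)) Fourier ⟩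
          K.product {n} (λ k → Λ (toℕ k)) K.* det Fourier
            ≈⟨ K.*-comm _ _ ⟩
          det Fourier K.* K.product {n} (λ k → Λ (toℕ k)) ∎)

        det-B≈hypergeometric : det B K.≈ (K.- K.1#) K.^ r K.* (K.fromℕ q K.* K.1/ 2) K.^ n K.*
          K.product {n} (λ k → ₂F₁ chars (P ⁻) (χ ^ᶻ (ℤ.+ (4 ℕ.* toℕ k)))
            (χ ^ᶻ (ℤ.+ (4 ℕ.* toℕ k ℕ.+ r))) (F.- F.1#))
        det-B≈hypergeometric = K.sym (begin
          ε K.* κ K.^ n K.* K.product {n} H
            ≈⟨ K.trans (K.*-assoc _ _ _) (K.*-congˡ (scale κ H)) ⟩
          ε K.* K.product {n} (λ k → κ K.* H k)
            ≈⟨ K.*-congˡ (Product.sum-cong-≋ {n} λ k → half-hypergeometric (toℕ k)) ⟩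
          ε K.* K.product {n} (λ k → ε K.* Λ (toℕ k))
            ≈⟨ K.*-congˡ (scale ε (λ k → Λ (toℕ k))) ⟨
          ε K.* (ε K.^ n K.* K.product {n} (λ k → Λ (toℕ k)))
            ≈⟨ K.*-assoc _ _ _ ⟨
          ε K.^ suc n K.* K.product {n} (λ k → Λ (toℕ k))
            ≈⟨ K.trans (K.*-congʳ ε^[1+n]≈1) (K.*-identityˡ _) ⟩
          K.product {n} (λ k → Λ (toℕ k))
            ≈⟨ det-B≈eigenvalues ⟨
          det B ∎)
          where
          ε = (K.- K.1#) K.^ r
          κ = K.fromℕ q K.* K.1/ 2
          H : Fin n → K.Carrier
          H k = ₂F₁ chars (P ⁻) (χ ^ᶻ (ℤ.+ (4 ℕ.* toℕ k))) (χ ^ᶻ (ℤ.+ (4 ℕ.* toℕ k ℕ.+ r))) (F.- F.1#)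
          scale : ∀ x (f : Fin n → K.Carrier) → x K.^ n K.* K.product f K.≈ K.product (λ k → x K.* f k)
          scale x f = K.trans (K.*-congʳ (K.sym (K.product-const x n)))
            (K.sym (Product.∑-distrib-+ (λ _ → x) f))
          ε^[1+n]≈1 : ε K.^ suc n K.≈ K.1#
          ε^[1+n]≈1 = begin
            -- `suc n` computes to `suc h ℕ.* 2`: as `n` is odd, the signs of the `n` factors and
            -- the one in front make an even power.
            ε K.^ (suc h ℕ.* 2)                 ≡⟨ ≡.cong (ε K.^_) (ℕₚ.*-comm (suc h) 2) ⟩
            ε K.^ (2 ℕ.* suc h)                 ≈⟨ K.^-multiple 2
              (K.trans (K.^-comm (K.- K.1#) r 2) (K.trans (K.^-congˡ r square) (K.1^n≈1 r))) (suc h) ⟩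
            K.1#                                ∎
            where
            square : (K.- K.1#) K.^ 2 K.≈ K.1#
            square = K.trans (K.*-congˡ (K.*-identityʳ _))
              (K.trans (KRing.-1*x≈-x _) (KRing.-‿involutive K.1#))

      -- The sizes are variables so that both equations can be matched with `refl`; in the theorem
      -- they are quotients that do not compute to `n`.
      det-of-size : ∀ {n₁ n₂} → n₁ ≡ n → n₂ ≡ n → (a : Fin n₁ → F.Carrier) → Injective _≡_ F._≈_ a →
        (∀ i → D₄ (a i)) → (∀ y → D₄ y → ∃ λ i → a i F.≈ y) →
        det (λ i j → ⟦ P ⟧ (a i F.+ a j) K.+ ⟦ P ⟧ (a i F.- a j)) K.≈
        (K.- K.1#) K.^ r K.* (K.fromℕ q K.* K.1/ 2) K.^ n₁ K.*
        K.product {n₂} (λ k → ₂F₁ chars (P ⁻) (χ ^ᶻ (ℤ.+ (4 ℕ.* toℕ k)))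
          (χ ^ᶻ (ℤ.+ (4 ℕ.* toℕ k ℕ.+ r))) (F.- F.1#))
      det-of-size ≡.refl ≡.refl = det-B≈hypergeometric

-- With q = 8h + 5 one has q - 1 = 4(2h + 1): the congruence is what makes the order of D₄ odd.
quarter-sizes : ∀ q → q % 8 ≡ 5 →
  ∃ λ h → q ℕ.∸ 1 ≡ suc (h ℕ.* 2) ℕ.* 4 ×
          (q ℕ.∸ 1) ℕ./ 4 ≡ suc (h ℕ.* 2) × 1 ℕ.+ (q ℕ.∸ 5) ℕ./ 4 ≡ suc (h ℕ.* 2)
quarter-sizes q q%8≡5 = h , q-1≡ ,
  ≡.trans (≡.cong (ℕ._/ 4) q-1≡) (m*n/n≡m (suc (h ℕ.* 2)) 4) ,
  ≡.cong suc (≡.trans (≡.cong (ℕ._/ 4) q-5≡) (m*n/n≡m (h ℕ.* 2) 4))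
  where
  h = q ℕ./ 8
  q≡ : q ≡ 5 ℕ.+ h ℕ.* 8
  q≡ = ≡.trans (m≡m%n+[m/n]*n q 8) (≡.cong (ℕ._+ h ℕ.* 8) q%8≡5)
  q-5≡ : q ℕ.∸ 5 ≡ h ℕ.* 2 ℕ.* 4
  q-5≡ = ≡.trans (≡.cong (ℕ._∸ 5) q≡) (≡.sym (ℕₚ.*-assoc h 2 4))
  q-1≡ : q ℕ.∸ 1 ≡ suc (h ℕ.* 2) ℕ.* 4
  q-1≡ = ≡.trans (≡.cong (ℕ._∸ 1) q≡) (≡.cong (4 ℕ.+_) (≡.sym (ℕₚ.*-assoc h 2 4)))

open import Data.Nat using (ℕ; _+_; _*_; _∸_; _^_; _≤_; _/_; _%_)
open import Data.Nat.Primality using (Prime)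
open import Data.Integer using (+_; -_)
open import Data.Fin using (Fin; toℕ)
open import Data.Product using (∃)
open import Function.Definitions using (Injective)
open import Relation.Binary.PropositionalEquality using (_≡_)

theorem1p2 :
  ∀ {c ℓ₁ ℓ₂ c′ ℓ₁′ ℓ₂′} (F : FiniteField c ℓ₁ ℓ₂) (K : CharZeroField c′ ℓ₁′ ℓ₂′) →
  let module F = FiniteField F
      module K = CharZeroField K
      open Characters F K
      open Determinant K.commutativeRing
  in
  (p n : ℕ) → Prime p → 1 ≤ n → q ≡ p ^ n → q % 8 ≡ 5 →
  (ζ : K.Carrier) → K.IsPrimitiveRoot (q ∸ 1) ζ →
  (chars : Finite characterSetoid) →
  (χ : Character) → Generates χ →
  (r : ℕ) → 1 ≤ r → r ≤ q ∸ 2 →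
  (a : Fin ((q ∸ 1) / 4) → F.Carrier) →
  Injective _≡_ F._≈_ a →
  (∀ i → D₄ (a i)) →
  (∀ y → D₄ y → ∃ λ i → a i F.≈ y) →
  det (λ i j → ⟦ χ ^ᶻ (+ r) ⟧ (a i F.+ a j) K.+ ⟦ χ ^ᶻ (+ r) ⟧ (a i F.- a j))
    K.≈
  (K.- K.1#) K.^ r
    K.* (K.fromℕ q K.* K.1/ 2) K.^ ((q ∸ 1) / 4)
    K.* K.product {1 + (q ∸ 5) / 4} (λ k →
          ₂F₁ chars (χ ^ᶻ (- (+ r))) (χ ^ᶻ (+ (4 * toℕ k))) (χ ^ᶻ (+ (4 * toℕ k + r)))
              (F.- F.1#))
-- The split on `r` lets `- (+ r)` compute to a negative constructor, so that the negative power of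
-- `χ` becomes, by definition, the inverse `P ⁻`.
theorem1p2 F K p n _ _ _ q%8≡5 ζ ζ-primitive chars χ generates ℕ.zero () r≤q-2 a a-injective a∈D₄ D₄⊆a
theorem1p2 F K p n _ _ _ q%8≡5 ζ ζ-primitive chars χ generates (ℕ.suc r) 1≤r r≤q-2 a a-injective a∈D₄ D₄⊆a
  with quarter-sizes (Characters.q F K) q%8≡5
... | h , N≡ , size≡ , size′≡ =
  FourthPowerMatrix.det-of-size F K ζ-primitive chars χ generates h N≡ (ℕ.suc r) size≡ size′≡ a a-injective a∈D₄ D₄⊆a
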